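{- Let $m,n,k$ be non-negative integers with $k\le n$ and let $b_1<\dots<b_k$ be positive integers with $b_k\le m+k$. The number of $(m,n,k)$-Gog trapezoids with bottom row $(b_1,\dots,b_k)$ is the constant term in $x_1,\dots,x_n$ of $$\prod_{i=1}^k(1+x_i)^{b_i}x_i^{ -n+1}\prod_{i=k+1}^n(1+x_i)^{m+k+1}x_i^{ -n+i-k}\prod_{1\le i<j\le n}(x_i-x_j)(1+x_j+x_ix_j).$$ In particular, since for $m=0$ the bottom row is necessarily $(1,2,\dots,k)$, the number of $(0,n,k)$-Gog trapezoids is the constant term of $$\prod_{i=1}^k(1+x_i)^{i}x_i^{ -n+1}\prod_{i=k+1}^n(1+x_i)^{k+1}x_i^{ -n+i-k}\prod_{1\le i<j\le n}(x_i-x_j)(1+x_j+x_ix_j).$$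
   Context: For non-negative integers $m,n,k$ with $k\le n$, an $(m,n,k)$-Gog trapezoid is an array $(m_{i,j})$ of positive integers indexed by $1\le i\le n$, $1\le j\le\min(i,k)$ (arranged like the $k$ leftmost NE-diagonals of a triangular array with $n$ rows, row $i$ on top of row $i+1$, with $m_{i,j}$ between $m_{i+1,j}$ and $m_{i+1,j+1}$), such that $m_{i+1,j}\le m_{i,j}$ and $m_{i,j}\le m_{i+1,j+1}$ whenever the entries exist (weak increase along NE- and SE-diagonals), rows are strictly increasing ($m_{i,j}<m_{i,j+1}$), and each entry $m_{i,j}$ is at most $m+n-i+j$ (the entries of the $s$-th SE-diagonal from the left, i.e. those with $n-(i-j)=s$, are bounded by $m+s$). The bottom row is $(m_{n,1},\dots,m_{n,k})$. -}

module Defs where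

open import Data.Nat using (ℕ; zero; suc; _∸_; _≤_; _<_; _⊓_)
  renaming (_+_ to _+ℕ_)
open import Data.Integer as ℤ using (ℤ; +_; 0ℤ; 1ℤ; -_; _+_; _*_; _-_)
open import Data.Fin using (Fin; toℕ; inject≤)
open import Data.Vec as V using (Vec; replicate; zipWith; lookup; _[_]≔_)
open import Data.Vec.Properties using (≡-dec)
open import Data.List as L using (List; []; _∷_; _++_; [_]; map; concatMap; foldr; length; allFin; filter)
open import Data.List.Membership.Propositional using (_∈_)
open import Data.List.Relation.Unary.Unique.Propositional using (Unique)
open import Data.Product using (Σ; _×_; proj₁; proj₂; _,_)
open import Data.Bool using (if_then_else_)
open import Data.Nat using (_<ᵇ_)
open import Relation.Binary.PropositionalEquality using (_≡_)
open import Relation.Nullary.Decidable using (does)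

-- Laurent polynomials in n variables x₀,…,x_{n-1} with integer
-- coefficients, represented (non-normalised) as lists of terms
-- (exponent vector , coefficient).

Term : ℕ → Set
Term n = Vec ℤ n × ℤ

LPoly : ℕ → Set
LPoly n = List (Term n)

oneP : ∀ {n} → LPoly n
oneP {n} = [ (replicate n 0ℤ , 1ℤ) ]

_⊗_ : ∀ {n} → LPoly n → LPoly n → LPoly n
p ⊗ q = concatMap (λ s → map (λ t → (zipWith _+_ (proj₁ s) (proj₁ t) , proj₂ s * proj₂ t)) q) p

prodP : ∀ {n} → List (LPoly n) → LPoly n
prodP = foldr _⊗_ oneP

powP : ∀ {n} → LPoly n → ℕ → LPoly n
powP p b = prodP (L.replicate b p)

mono : ∀ {n} → Fin n → ℤ → LPoly n
mono {n} i e = [ (replicate n 0ℤ [ i ]≔ e , 1ℤ) ]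

x : ∀ {n} → Fin n → LPoly n
x i = mono i 1ℤ

ct : ∀ {n} → LPoly n → ℤ
ct {n} p = foldr (λ t acc → if does (≡-dec ℤ._≟_ (proj₁ t) (replicate n 0ℤ)) then proj₂ t + acc else acc) 0ℤ p

-- The Laurent polynomial of the theorem.  Variable x_i (1-based) is
-- x (i-1) here.

onePlus : ∀ {n} → Fin n → LPoly n
onePlus i = oneP ++ x i

part1 : (n k : ℕ) → k ≤ n → Vec ℕ k → LPoly n
part1 n k k≤n b = prodP (map (λ j → powP (onePlus (inject≤ j k≤n)) (lookup b j)
                                      ⊗ mono (inject≤ j k≤n) (+ 1 - + n))
                             (allFin k))

part2 : (m n k : ℕ) → LPoly n
part2 m n k = prodP (concatMap (λ i → if k <ᵇ suc (toℕ i)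
                                         then [ powP (onePlus i) (m +ℕ k +ℕ 1)
                                                ⊗ mono i ((- + n) + + suc (toℕ i) - + k) ]
                                         else [])
                               (allFin n))

part3 : (n : ℕ) → LPoly n
part3 n = prodP (concatMap (λ i → concatMap (λ j →
                   if toℕ i <ᵇ toℕ j
                   then [ (x i ++ map (λ t → (proj₁ t , - proj₂ t)) (x j))
                          ⊗ (oneP ++ x j ++ (x i ⊗ x j)) ]
                   else []) (allFin n)) (allFin n))

gogPoly : (m n k : ℕ) → k ≤ n → Vec ℕ k → LPoly n
gogPoly m n k k≤n b = part1 n k k≤n b ⊗ (part2 m n k ⊗ part3 n)

-- Gog trapezoids.  An array is stored as the list of its rows
-- (row 1 first), row i being the list (m_{i,1},…,m_{i,min(i,k)}).
-- `at a i j` is the entry m_{i,j} (1-based; 0 outside the array).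

idx : ℕ → List ℕ → ℕ
idx _ [] = 0
idx zero (y ∷ _) = y
idx (suc i) (_ ∷ ys) = idx i ys

rowAt : ℕ → List (List ℕ) → List ℕ
rowAt _ [] = []
rowAt zero (r ∷ _) = r
rowAt (suc i) (_ ∷ rs) = rowAt i rs

at : List (List ℕ) → ℕ → ℕ → ℕ
at a i j = idx (j ∸ 1) (rowAt (i ∸ 1) a)

record IsGog (m n k : ℕ) (a : List (List ℕ)) : Set where
  field
    nrows    : length a ≡ n
    rowlen   : ∀ i → 1 ≤ i → i ≤ n → length (rowAt (i ∸ 1) a) ≡ i ⊓ k
    positive : ∀ i j → 1 ≤ i → i ≤ n → 1 ≤ j → j ≤ i ⊓ k → 1 ≤ at a i j
    neWeak   : ∀ i j → 1 ≤ i → suc i ≤ n → 1 ≤ j → j ≤ i ⊓ k →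
               at a (suc i) j ≤ at a i j
    seWeak   : ∀ i j → 1 ≤ i → suc i ≤ n → 1 ≤ j → j ≤ i ⊓ k → suc j ≤ k →
               at a i j ≤ at a (suc i) (suc j)
    rowStrict : ∀ i j → 1 ≤ i → i ≤ n → 1 ≤ j → suc j ≤ i ⊓ k →
               at a i j < at a i (suc j)
    bounded  : ∀ i j → 1 ≤ i → i ≤ n → 1 ≤ j → j ≤ i ⊓ k →
               at a i j ≤ (m +ℕ (n ∸ i)) +ℕ j

HasBottom : (n k : ℕ) → Vec ℕ k → List (List ℕ) → Set
HasBottom n k b a = (j : Fin k) → at a n (suc (toℕ j)) ≡ lookup b j

NumberOf : {A : Set} → (A → Set) → ℤ → Set
NumberOf {A} P z = Σ (List A) λ xs →
  Unique xs × (∀ t → t ∈ xs → P t) × (∀ t → P t → t ∈ xs) × (+ length xs ≡ z)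

{-# OPTIONS --safe #-}
module Submission where

-- Write G(n, k; b, M) for the constant term, where M = m + k + 1.  It satisfies the same recursion as
-- the trapezoids: G(n, k; b, M) is the sum of G(n - 1, k; c, M + 1) over the rows c that strictly
-- interlace (b₁, …, bₖ, M); for k = n the rows c have k - 1 entries and interlace b.  Two facts give this.
--
-- (1) The constant term is p ↦ ⟨p, ∏ βᵢ(eᵢ)⟩ with βᵢ(e) = [x⁰] (1 + x)^bᵢ x^(e - dᵢ), and here dᵢ < n.
-- After multiplication by x₁⋯xₙ, Laplace expansion of the Vandermonde product along its column of top
-- powers leaves a sum over i in which xᵢ occurs with exponent at least n.  Only dᵢ = n - 1 and the part
-- of the other factors with xᵢ = 0 contribute, so G is an alternating sum over i of constant terms in
-- n - 1 variables, with bᵢ omitted and bⱼ raised by 1 for j > i.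
--
-- (2) Multiplication by xᵢ is the difference operator in bᵢ.  Summing a function ΔB over strictly
-- interlacing rows telescopes to that same alternating sum of values of B, provided that
-- (1 + E E′ - E′) B vanishes whenever two neighbouring arguments agree.  For constant terms this
-- operator is multiplication by 1 + xᵢ + xᵢxᵢ₊₁, which makes the integrand antisymmetric in xᵢ, xᵢ₊₁.

open import Algebra.Bundles using (CommutativeRing; RawRing)
open import Algebra.Structures using (IsCommutativeMonoid)
open import Data.Empty using (⊥; ⊥-elim)
open import Data.Fin using (Fin; zero; suc; toℕ; fromℕ; inject≤; splitAt; _↑ˡ_; _↑ʳ_)
import Data.Fin.Properties as Fin
open import Data.List using (List; length)
open import Data.List.Membership.Propositional using (_∈_)
import Data.List.Relation.Unary.Any as Any
open import Data.List.Relation.Unary.Unique.Propositional using (Unique)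
open import Data.Nat as ℕ using (ℕ; zero; suc; s≤s; z≤n; _≤_; _<_; _⊔_; _⊓_; _∸_; _<ᵇ_; pred)
import Data.Nat.Properties as ℕ
open import Data.Product using (∃; _×_; _,_; proj₁; proj₂; swap)
open import Data.Sum using (_⊎_; inj₁; inj₂)
open import Data.Unit using (⊤; tt)
open import Data.Vec using (Vec; []; _∷_; lookup; tabulate)
import Data.Vec.Properties as Vec
open import Relation.Binary.PropositionalEquality using (_≡_)
open import Relation.Nullary using (yes; no)

private variable
  n k t : ℕ

-- For k < n the variable with index k + 1 carries (1 + x)^(m + k + 1) x^(1 - n), which is the shape
-- of the first k factors with M in place of an entry. This is why M can be appended to b as a
-- virtual entry. Interlacing with it bounds the last entry of the row above by M = (m + 1) + k, the
-- bound that this row has to meet as bottom row of a trapezoid with n - 1 rows; strictness then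
-- yields the bounds on its other entries. So no bound is ever tested when the arrays are listed.
--
-- Differences are needed because removing one variable leaves the depths unchanged: the positions
-- that belong to c keep depth n - 1, while the constant term in n - 1 variables has depth n - 2
-- there. One difference for each entry of c closes this gap, and the depths n - 2, ..., k at the
-- remaining positions are already right.
--
-- Negative exponents live only in the functional that a polynomial is paired with, and two
-- polynomials count as equal when all pairings agree, so no list of terms is ever normalised.

module Positions where
  open import Data.Vec using (map)

  atPair : ∀ {a} {A : Set a} → (A × A → A × A) → Fin n → Vec A (suc n) → Vec A (suc n)
  atPair f zero (x ∷ y ∷ xs) = proj₁ (f (x , y)) ∷ proj₂ (f (x , y)) ∷ xs
  atPair f (suc i) (x ∷ xs) = x ∷ atPair f i xs

  -- The index is a position removed from a vector that is longer by one, so the entries affected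
  -- are those that stood after it.
  mapFrom : ∀ {a} {A : Set a} → (A → A) → Fin (suc n) → Vec A n → Vec A n
  mapFrom f zero xs = map f xs
  mapFrom f (suc i) (x ∷ xs) = x ∷ mapFrom f i xs

open Positions

-- A ring solver with integer coefficients over an arbitrary commutative ring.

module RingSolver {c ℓ} (R : CommutativeRing c ℓ) where
  import Relation.Binary.PropositionalEquality as ≡
  import Algebra.Solver.Ring as Solver
  open import Algebra.Solver.Ring.AlmostCommutativeRing
    using (AlmostCommutativeRing; fromCommutativeRing; -raw-almostCommutative⟶; _-Raw-AlmostCommutative⟶_)
  open import Data.Maybe using (Maybe; just; nothing)

  open CommutativeRing R hiding (zero)
  open import Algebra.Properties.Semiring.Mult semiring
    using (×-homo-+; ×1-homo-*) renaming (_×_ to _·_)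
  open import Algebra.Properties.Ring ring using (x[y-z]≈xy-xz; [y-z]x≈yx-zx)
  open import Algebra.Properties.AbelianGroup +-abelianGroup using (⁻¹-anti-homo‿-)
  open import Algebra.Properties.Group +-group using (x∙y⁻¹≈ε⇒x≈y; x≈y⇒x∙y⁻¹≈ε)

  private
    acr : AlmostCommutativeRing c ℓ
    acr = fromCommutativeRing R

    -- Bootstrap: this solver never recognises a zero coefficient, so cancellation is beyond it. It
    -- suffices for showing that `value` is a homomorphism, on which the exported solver rests.
    module Weak = Solver (AlmostCommutativeRing.rawRing acr) acr
                         (-raw-almostCommutative⟶ acr) (λ _ _ → nothing)

    -- A pair (a , b) stands for the integer a − b.
    Differences : RawRing _ _
    Differences = record
      { Carrier = ℕ × ℕ
      ; _≈_ = ≡._≡_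
      ; _+_ = λ (a , b) (a′ , b′) → a ℕ.+ a′ , b ℕ.+ b′
      ; _*_ = λ (a , b) (a′ , b′) → a ℕ.* a′ ℕ.+ b ℕ.* b′ , a ℕ.* b′ ℕ.+ b ℕ.* a′
      ; -_  = λ (a , b) → b , a
      ; 0#  = 0 , 0
      ; 1#  = 1 , 0
      }

    difference : ℕ × ℕ → Carrier
    difference (a , b) = a · 1# - b · 1#

    -- Equal to `difference`, but `con (0 , 0)` and `con (1 , 0)` reduce to 0# and 1#.
    value : ℕ × ℕ → Carrier
    value (0 , 0) = 0#
    value (1 , 0) = 1#
    value p = difference p

    value≈ : ∀ p → value p ≈ difference p
    value≈ (0 , 0) = sym (-‿inverseʳ 0#)
    value≈ (1 , 0) = sym (trans (+-congˡ -0≈0) (trans (+-identityʳ _) (+-identityʳ 1#)))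
      where
      -0≈0 : - 0# ≈ 0#
      -0≈0 = trans (sym (+-identityˡ _)) (-‿inverseʳ 0#)
    value≈ (0 , suc _) = refl
    value≈ (1 , suc _) = refl
    value≈ (suc (suc _) , _) = refl

    value-homo : Differences -Raw-AlmostCommutative⟶ acr
    value-homo = record
      { ⟦_⟧    = value
      ; +-homo = λ p@(a , b) q@(a′ , b′) → trans (value≈ (a ℕ.+ a′ , b ℕ.+ b′)) (trans
          (trans (+-cong (×-homo-+ 1# a a′) (-‿cong (×-homo-+ 1# b b′)))
                (solve 4 (λ a b a′ b′ → (a :+ a′) :+ :- (b :+ b′) := (a :+ :- b) :+ (a′ :+ :- b′))
                  refl (a · 1#) (b · 1#) (a′ · 1#) (b′ · 1#)))
          (sym (+-cong (value≈ p) (value≈ q))))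
      ; *-homo = λ p@(a , b) q@(a′ , b′) → trans (value≈ (a ℕ.* a′ ℕ.+ b ℕ.* b′ , a ℕ.* b′ ℕ.+ b ℕ.* a′))
        (trans
          (trans (+-cong (homo-* a a′ b b′) (-‿cong (homo-* a b′ b a′)))
                (sym (expand (a · 1#) (b · 1#) (a′ · 1#) (b′ · 1#))))
          (sym (*-cong (value≈ p) (value≈ q))))
      ; -‿homo = λ p@(a , b) → trans (value≈ (b , a))
          (trans (sym (⁻¹-anti-homo‿- (a · 1#) (b · 1#))) (-‿cong (sym (value≈ p))))
      ; 0-homo = refl
      ; 1-homo = refl
      }
      where
      open Weak using (solve; _:+_; :-_; _:=_)
      homo-* : ∀ a a′ b b′ → (a ℕ.* a′ ℕ.+ b ℕ.* b′) · 1#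
                              ≈ (a · 1#) * (a′ · 1#) + (b · 1#) * (b′ · 1#)
      homo-* a a′ b b′ = trans (×-homo-+ 1# (a ℕ.* a′) (b ℕ.* b′))
                               (+-cong (×1-homo-* a a′) (×1-homo-* b b′))
      expand : ∀ a b a′ b′ → (a - b) * (a′ - b′) ≈ (a * a′ + b * b′) - (a * b′ + b * a′)
      expand a b a′ b′ = trans ([y-z]x≈yx-zx (a′ - b′) a b)
        (trans (+-cong (x[y-z]≈xy-xz a a′ b′)
                       (trans (-‿cong (x[y-z]≈xy-xz b a′ b′)) (⁻¹-anti-homo‿- (b * a′) (b * b′))))
               (solve 4 (λ p q r s → (p :+ :- q) :+ (s :+ :- r) := (p :+ s) :+ :- (q :+ r))
                 refl (a * a′) (a * b′) (b * a′) (b * b′)))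

    -- Differences are compared by cross addition in ℕ, which is sound in every ring. The answer
    -- `nothing` may miss equalities, for instance in positive characteristic.
    value-≟ : ∀ p q → Maybe (value p ≈ value q)
    value-≟ p@(a , b) q@(a′ , b′) with a ℕ.+ b′ ℕ.≟ a′ ℕ.+ b
    ... | no _ = nothing
    ... | yes eq = just (trans (value≈ p) (trans (x∙y⁻¹≈ε⇒x≈y _ _ (trans
            (trans (+-congˡ (⁻¹-anti-homo‿- (a′ · 1#) (b′ · 1#)))
            (solve 4 (λ a b a′ b′ → (a :+ :- b) :+ (b′ :+ :- a′) := (a :+ b′) :+ :- (a′ :+ b))
              refl (a · 1#) (b · 1#) (a′ · 1#) (b′ · 1#)))
            (x≈y⇒x∙y⁻¹≈ε (trans (sym (×-homo-+ 1# a b′))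
              (trans (reflexive (≡.cong (_· 1#) eq)) (×-homo-+ 1# a′ b)))))) (sym (value≈ q))))
      where open Weak using (solve; _:+_; :-_; _:=_)

  open Solver Differences acr value-homo value-≟ public using (solve; _:+_; _:*_; :-_; _:-_; _:=_; con)

-- Vandermonde and Gog products over a commutative ring.

module PairProducts {c ℓ} (R : CommutativeRing c ℓ) where
  open import Data.Vec using (map; lookup; removeAt)

  open RingSolver R
  open CommutativeRing R hiding (zero)
  open import Relation.Binary.Reasoning.Setoid setoid
  open import Algebra.Properties.Semiring.Exp semiring using (_^_)

  prod : Vec Carrier n → Carrier
  prod [] = 1#
  prod (x ∷ xs) = x * prod xs

  pairProd : (Carrier → Carrier → Carrier) → Vec Carrier n → Carrier
  pairProd f [] = 1#
  pairProd f (x ∷ xs) = prod (map (f x) xs) * pairProd f xs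

  altSum : (Fin n → Carrier) → Carrier
  altSum {zero} f = 0#
  altSum {suc n} f = f zero - altSum (λ i → f (suc i))

  altSum-cong : {f g : Fin n → Carrier} → (∀ i → f i ≈ g i) → altSum f ≈ altSum g
  altSum-cong {zero} eq = refl
  altSum-cong {suc n} eq = +-cong (eq zero) (-‿cong (altSum-cong (λ i → eq (suc i))))

  altSum-linear : ∀ k l (f g : Fin n → Carrier) →
    altSum (λ i → k * f i - l * g i) ≈ k * altSum f - l * altSum g
  altSum-linear {zero} k l f g = solve 2 (λ k l → con (0 , 0) := k :* con (0 , 0) :- l :* con (0 , 0)) refl k
    l
  altSum-linear {suc n} k l f g = trans
    (+-congˡ (-‿cong (altSum-linear k l (λ i → f (suc i)) (λ i → g (suc i)))))
    (solve 6 (λ k l a b c d → (k :* a :- l :* b) :- (k :* c :- l :* d) := k :* (a :- c) :- l :* (b :- d))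
      refl k l (f zero) (g zero) _ _)

  altSum-*ˡ : ∀ k (f : Fin n → Carrier) → altSum (λ i → k * f i) ≈ k * altSum f
  altSum-*ˡ {zero} k f = sym (zeroʳ k)
  altSum-*ˡ {suc n} k f = trans (+-congˡ (-‿cong (altSum-*ˡ k (λ i → f (suc i)))))
    (solve 3 (λ k a c → k :* a :- k :* c := k :* (a :- c)) refl k (f zero) _)

  prod-map-removeAt : ∀ (f : Carrier → Carrier) (xs : Vec Carrier (suc n)) i →
    prod (map f xs) ≈ f (lookup xs i) * prod (map f (removeAt xs i))
  prod-map-removeAt f (x ∷ xs) zero = refl
  prod-map-removeAt f (x ∷ xs@(_ ∷ _)) (suc i) = trans (*-congˡ (prod-map-removeAt f xs i))
    (solve 3 (λ a b c → a :* (b :* c) := b :* (a :* c)) refl (f x) (f (lookup xs i)) _)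

  prod-removeAt : ∀ (xs : Vec Carrier (suc n)) i → prod xs ≈ lookup xs i * prod (removeAt xs i)
  prod-removeAt (x ∷ xs) zero = refl
  prod-removeAt (x ∷ xs@(_ ∷ _)) (suc i) = trans (*-congˡ (prod-removeAt xs i))
    (solve 3 (λ a b c → a :* (b :* c) := b :* (a :* c)) refl x (lookup xs i) _)

  prod-map-* : ∀ {f g h : Carrier → Carrier} → (∀ x → f x ≈ g x * h x) → ∀ (xs : Vec Carrier n) →
    prod (map f xs) ≈ prod (map g xs) * prod (map h xs)
  prod-map-* eq [] = sym (*-identityˡ 1#)
  prod-map-* {f = f} {g} {h} eq (x ∷ xs) = trans (*-cong (eq x) (prod-map-* eq xs))
    (solve 4 (λ a b c d → (a :* b) :* (c :* d) := (a :* c) :* (b :* d)) refl (g x) (h x) _ _)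

  pairProd-* : ∀ {f g h : Carrier → Carrier → Carrier} → (∀ x y → f x y ≈ g x y * h x y) →
    ∀ (xs : Vec Carrier n) → pairProd f xs ≈ pairProd g xs * pairProd h xs
  pairProd-* eq [] = sym (*-identityˡ 1#)
  pairProd-* {f = f} {g} {h} eq (x ∷ xs) = trans (*-cong (prod-map-* (eq x) xs) (pairProd-* eq xs))
    (solve 4 (λ a b c d → (a :* b) :* (c :* d) := (a :* c) :* (b :* d)) refl _ _ (pairProd g xs)
      (pairProd h xs))

  prod-map-atPair-swap : ∀ (f : Carrier → Carrier) i (xs : Vec Carrier (suc n)) →
    prod (map f (atPair swap i xs)) ≈ prod (map f xs)
  prod-map-atPair-swap f zero (x ∷ y ∷ xs) =
    solve 3 (λ a b c → a :* (b :* c) := b :* (a :* c)) refl (f y) (f x) _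
  prod-map-atPair-swap f (suc i) (x ∷ xs) = *-congˡ (prod-map-atPair-swap f i xs)

  vandermonde : Vec Carrier n → Carrier
  vandermonde = pairProd _-_

  gogFactor : Carrier → Carrier → Carrier
  gogFactor x y = 1# + (y + x * y)

  gogProd : Vec Carrier n → Carrier
  gogProd = pairProd (λ x y → (x - y) * gogFactor x y)

  gogProd-split : (xs : Vec Carrier n) → gogProd xs ≈ vandermonde xs * pairProd gogFactor xs
  gogProd-split = pairProd-* (λ _ _ → refl)

  private
    V = vandermonde
    c′ : Carrier → Vec Carrier n → Carrier
    c′ y xs = prod (map (λ z → y - z) xs)

  -- Lagrange interpolation of the constant 1 at the nodes `xs`, multiplied by the Vandermonde
  -- product to clear denominators. In the induction y - a = (y - z) - (a - z), with z the omitted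
  -- node, splits every term in two, and the hypothesis applies at both evaluation points `a` and
  -- `y`.
  lagrange : ∀ y (xs : Vec Carrier (suc n)) →
    altSum (λ i → c′ y (removeAt xs i) * V (removeAt xs i)) ≈ V xs
  lagrange y (a ∷ []) = solve 0 (con (1 , 0) :* con (1 , 0) :- con (0 , 0) := con (1 , 0) :* con (1 , 0)) refl
  lagrange y (a ∷ as@(_ ∷ _)) = begin
    c′ y as * V as - altSum (λ i → ((y - a) * c′ y (as ─ i)) * (c′ a (as ─ i) * V (as ─ i)))
      ≈⟨ +-congˡ (-‿cong (trans (altSum-cong step) (altSum-linear (c′ y as) (c′ a as)
          (λ i → c′ a (as ─ i) * V (as ─ i)) (λ i → c′ y (as ─ i) * V (as ─ i))))) ⟩
    c′ y as * V as - (c′ y as * altSum (λ i → c′ a (as ─ i) * V (as ─ i))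
                      - c′ a as * altSum (λ i → c′ y (as ─ i) * V (as ─ i)))
      ≈⟨ +-congˡ (-‿cong (+-cong (*-congˡ (lagrange a as)) (-‿cong (*-congˡ (lagrange y as))))) ⟩
    c′ y as * V as - (c′ y as * V as - c′ a as * V as)
      ≈⟨ solve 3 (λ p q v → p :* v :- (p :* v :- q :* v) := q :* v) refl (c′ y as) (c′ a as) (V as) ⟩
    c′ a as * V as ∎
    where
    _─_ : Vec Carrier (suc n) → Fin (suc n) → Vec Carrier n
    _─_ = removeAt
    step : ∀ i → ((y - a) * c′ y (as ─ i)) * (c′ a (as ─ i) * V (as ─ i))
               ≈ c′ y as * (c′ a (as ─ i) * V (as ─ i)) - c′ a as * (c′ y (as ─ i) * V (as ─ i))
    step i = trans
      (solve 6 (λ y a z p q v → ((y :- a) :* p) :* (q :* v)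
                  := ((y :- z) :* p) :* (q :* v) :- ((a :- z) :* q) :* (p :* v))
        refl y a (lookup as i) (c′ y (as ─ i)) (c′ a (as ─ i)) (V (as ─ i)))
      (sym (+-cong (*-congʳ (prod-map-removeAt (λ z → y - z) as i))
                   (-‿cong (*-congʳ (prod-map-removeAt (λ z → a - z) as i)))))

  powerSum : ℕ → Vec Carrier (suc n) → Carrier
  powerSum m xs = altSum (λ i → lookup xs i ^ m * V (removeAt xs i))

  -- Expansion of the Vandermonde determinant along the column of m-th powers.
  powerSum-< : ∀ (xs : Vec Carrier (suc n)) {m} → m ℕ.< n → powerSum m xs ≈ 0#
  powerSum-≡ : ∀ (xs : Vec Carrier (suc n)) → powerSum n xs ≈ V xs

  -- `T m` is the Lagrange interpolant of z ↦ z ^ m at the nodes `xs`, evaluated at `y` and cleared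
  -- of denominators by `V xs`. It reproduces y ^ m for m ≤ n, and for m = n + 1 it misses y ^ m by
  -- the monic node polynomial `c′ y xs`. Since `powerSum m (y ∷ xs)` unfolds to
  -- `y ^ m * V xs - T m`, it is the interpolation error; this yields both facts about `powerSum` by
  -- simultaneous induction on the length.
  module _ (y : Carrier) (xs : Vec Carrier (suc n)) where
    private
      T : ℕ → Carrier
      T m = altSum (λ i → lookup xs i ^ m * (c′ y (removeAt xs i) * V (removeAt xs i)))

    T-zero : T 0 ≈ V xs
    T-zero = trans (altSum-cong (λ i → *-identityˡ (c′ y (removeAt xs i) * V (removeAt xs i))))
      (lagrange y xs)

    T-suc : ∀ m → T (suc m) ≈ y * T m - c′ y xs * powerSum m xs
    T-suc m = trans (altSum-cong step) (altSum-linear y (c′ y xs)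
        (λ i → lookup xs i ^ m * (c′ y (removeAt xs i) * V (removeAt xs i)))
        (λ i → lookup xs i ^ m * V (removeAt xs i)))
      where
      step : ∀ i → lookup xs i ^ suc m * (c′ y (removeAt xs i) * V (removeAt xs i))
                 ≈ y * (lookup xs i ^ m * (c′ y (removeAt xs i) * V (removeAt xs i)))
                   - c′ y xs * (lookup xs i ^ m * V (removeAt xs i))
      step i = trans
        (solve 5 (λ y x p q v → (x :* p) :* (q :* v)
                    := y :* (p :* (q :* v)) :- ((y :- x) :* q) :* (p :* v))
          refl y (lookup xs i) (lookup xs i ^ m) (c′ y (removeAt xs i)) (V (removeAt xs i)))
        (+-congˡ (-‿cong (*-congʳ (sym (prod-map-removeAt (λ z → y - z) xs i)))))

    T-≤ : ∀ {m} → m ℕ.≤ n → T m ≈ y ^ m * V xs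
    T-≤ {zero} _ = trans T-zero (sym (*-identityˡ _))
    T-≤ {suc m} m<n = begin
      T (suc m)                            ≈⟨ T-suc m ⟩
      y * T m - c′ y xs * powerSum m xs
        ≈⟨ +-cong (*-congˡ (T-≤ (ℕ.<⇒≤ m<n))) (-‿cong (*-congˡ (powerSum-< xs m<n))) ⟩
      y * (y ^ m * V xs) - c′ y xs * 0#
        ≈⟨ solve 4 (λ y p v c → y :* (p :* v) :- c :* con (0 , 0) := (y :* p) :* v) refl y (y ^ m) (V xs)
          (c′ y xs) ⟩
      (y * y ^ m) * V xs ∎

    T-top : T (suc n) ≈ y ^ suc n * V xs - c′ y xs * V xs
    T-top = trans (T-suc n) (+-cong (trans (*-congˡ (T-≤ ℕ.≤-refl)) (sym (*-assoc _ _ _)))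
                                    (-‿cong (*-congˡ (powerSum-≡ xs))))

  powerSum-< (y ∷ xs@(_ ∷ _)) {m} (s≤s m≤n) =
    trans (+-congˡ (-‿cong (T-≤ y xs m≤n))) (-‿inverseʳ _)

  powerSum-≡ (y ∷ []) = solve 0 (con (1 , 0) :* con (1 , 0) :- con (0 , 0) := con (1 , 0) :* con (1 , 0)) refl
  powerSum-≡ {n = suc n} (y ∷ xs@(_ ∷ _)) = trans (+-congˡ (-‿cong (T-top y xs)))
    (solve 3 (λ p c v → p :* v :- (p :* v :- c :* v) := c :* v) refl (y ^ suc n) (c′ y xs) (V xs))

  prodFrom : Fin (suc n) → Vec Carrier n → Carrier
  prodFrom zero xs = prod (map (λ x → 1# + x) xs)
  prodFrom (suc i) (x ∷ xs) = prodFrom i xs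

  _≡_[mod_] : Carrier → Carrier → Carrier → Set _
  a ≡ b [mod x ] = ∃ λ q → a ≈ b + x * q

  prod-gogFactor-mod : ∀ x (xs : Vec Carrier n) →
    prod (map (gogFactor x) xs) ≡ prod (map (λ y → 1# + y) xs) [mod x ]
  prod-gogFactor-mod x [] = 0# , sym (trans (+-congˡ (zeroʳ x)) (+-identityʳ 1#))
  prod-gogFactor-mod x (y ∷ xs) with prod-gogFactor-mod x xs
  ... | q , eq = _ , trans (*-congˡ eq)
    (solve 5 (λ x y p q o → (o :+ (y :+ x :* y)) :* (p :+ x :* q)
                 := (o :+ y) :* p :+ x :* (y :* p :+ (o :+ y :+ x :* y) :* q)) refl x y _ q 1#)

  -- At xᵢ = 0 the factor of a pair (i, j) with j > i becomes 1 + xⱼ, and that of a pair (j, i) with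
  -- j < i becomes 1. This asymmetry is why omitting an entry raises exactly the later ones.
  gogFactor-mod : ∀ (xs : Vec Carrier (suc n)) i →
    pairProd gogFactor xs ≡ prodFrom i (removeAt xs i) * pairProd gogFactor (removeAt xs i) [mod lookup xs i ]
  gogFactor-mod (x ∷ xs) zero with prod-gogFactor-mod x xs
  ... | q , eq = q * pairProd gogFactor xs , trans (*-congʳ eq)
    (solve 4 (λ p x q r → (p :+ x :* q) :* r := p :* r :+ x :* (q :* r)) refl _ x q _)
  gogFactor-mod (x ∷ xs@(_ ∷ _)) (suc i) with gogFactor-mod xs i
  ... | q , eq = _ , trans (*-cong (prod-map-removeAt (gogFactor x) xs i) eq)
    (solve 6 (λ x z g t h q → ((con (1 , 0) :+ (z :+ x :* z)) :* g) :* (t :* h :+ z :* q)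
         := t :* (g :* h) :+ z :* ((con (1 , 0) :+ x) :* g :* (t :* h :+ z :* q) :+ g :* q))
      refl x (lookup xs i) _ _ _ q)

  pairUnit : Fin n → Vec Carrier (suc n) → Carrier
  pairUnit zero (x ∷ y ∷ xs) = 1# + (x + x * y)
  pairUnit (suc i) (x ∷ xs) = pairUnit i xs

  -- `pairUnit` is `gogFactor` with its two arguments exchanged. It completes the factor of the
  -- adjacent pair to (x - y)(1 + y + xy)(1 + x + xy), which changes sign under the exchange, while
  -- the remaining factors are only permuted.
  gogProd-antisym : ∀ i (xs : Vec Carrier (suc n)) →
    pairUnit i (atPair swap i xs) * gogProd (atPair swap i xs) ≈ - (pairUnit i xs * gogProd xs)
  gogProd-antisym zero (x ∷ y ∷ xs) =
    solve 5 (λ x y p q r → (con (1 , 0) :+ (y :+ y :* x)) :*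
      (((y :- x) :* (con (1 , 0) :+ (x :+ y :* x)) :* p) :* (q :* r))
      := :- ((con (1 , 0) :+ (x :+ x :* y)) :*
        (((x :- y) :* (con (1 , 0) :+ (y :+ x :* y)) :* q) :* (p :* r))))
      refl x y _ _ (gogProd xs)
  gogProd-antisym (suc i) (x ∷ xs) = begin
    u * (prod (map f (atPair swap i xs)) * gogProd (atPair swap i xs))
      ≈⟨ *-congˡ (*-congʳ (prod-map-atPair-swap f i xs)) ⟩
    u * (p * gogProd (atPair swap i xs))
      ≈⟨ solve 3 (λ a b c → a :* (b :* c) := b :* (a :* c)) refl u p _ ⟩
    p * (u * gogProd (atPair swap i xs)) ≈⟨ *-congˡ (gogProd-antisym i xs) ⟩
    p * - (pairUnit i xs * gogProd xs)
      ≈⟨ solve 3 (λ a b c → a :* :- (b :* c) := :- (b :* (a :* c))) refl p _ _ ⟩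
    - (pairUnit i xs * (p * gogProd xs)) ∎
    where
    f = λ z → (x - z) * gogFactor x z
    u = pairUnit i (atPair swap i xs)
    p = prod (map f xs)

  prod-gogProd : ∀ (xs : Vec Carrier (suc n)) → prod xs * gogProd xs ≈
    altSum (λ i → lookup xs i ^ suc n * (prod (removeAt xs i) * (V (removeAt xs i) * pairProd gogFactor xs)))
  prod-gogProd {n} xs = begin
    prod xs * gogProd xs                ≈⟨ *-congˡ (gogProd-split xs) ⟩
    prod xs * (V xs * Q)                ≈⟨ *-congˡ (*-congʳ (powerSum-≡ xs)) ⟨
    prod xs * (powerSum n xs * Q)
      ≈⟨ solve 3 (λ a b c → a :* (b :* c) := (a :* c) :* b) refl (prod xs) _ _ ⟩
    (prod xs * Q) * powerSum n xs       ≈⟨ altSum-*ˡ (prod xs * Q) (λ i → lookup xs i ^ n * V (removeAt xs i))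
      ⟨
    altSum (λ i → (prod xs * Q) * (lookup xs i ^ n * V (removeAt xs i))) ≈⟨ altSum-cong step ⟩
    altSum (λ i → lookup xs i ^ suc n * (prod (removeAt xs i) * (V (removeAt xs i) * Q))) ∎
    where
    Q = pairProd gogFactor xs
    step : ∀ i → (prod xs * Q) * (lookup xs i ^ n * V (removeAt xs i))
      ≈ lookup xs i ^ suc n * (prod (removeAt xs i) * (V (removeAt xs i) * Q))
    step i = trans (*-congʳ (*-congʳ (prod-removeAt xs i)))
      (solve 5 (λ x p q y v → ((x :* p) :* q) :* (y :* v) := (x :* y) :* (p :* (v :* q)))
        refl (lookup xs i) (prod (removeAt xs i)) Q (lookup xs i ^ n) (V (removeAt xs i)))

-- Monoid rings over ℤ and their linear functionals.

module MonoidRing {E : Set} {_∙_ : E → E → E} {ε : E} (isCM : IsCommutativeMonoid _≡_ _∙_ ε) where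
  open import Relation.Binary.PropositionalEquality using (refl; sym; trans; cong; cong₂; module ≡-Reasoning)
  open import Data.Integer using (ℤ; 0ℤ; 1ℤ; _+_; _*_; -_)
  import Data.Integer.Properties as ℤ
  open import Data.Integer.Solver using (module +-*-Solver)
  open import Data.List using ([]; _∷_; [_]; map; concatMap; _++_)
  open import Relation.Binary.Structures using (IsEquivalence)
  open import Level using (0ℓ)

  open IsCommutativeMonoid isCM using () renaming (assoc to ∙-assoc; comm to ∙-comm; identityˡ to ∙-identityˡ)

  Poly : Set
  Poly = List (E × ℤ)

  pairing : Poly → (E → ℤ) → ℤ
  pairing [] f = 0ℤ
  pairing ((e , c) ∷ p) f = c * f e + pairing p f

  infix 4 _≋_
  -- An element of the monoid ring is seen through the functions E → ℤ, extended linearly. The ring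
  -- laws thereby become identities between nested finite sums, with no normal form and no decidable
  -- equality on E. The record keeps `p` and `q` visible to unification.
  record _≋_ (p q : Poly) : Set where
    constructor ≋-intro
    field pairing-≡ : ∀ f → pairing p f ≡ pairing q f

  open _≋_ public

  negP : Poly → Poly
  negP = map (λ t → proj₁ t , - proj₂ t)

  mulP : Poly → Poly → Poly
  mulP p q = concatMap (λ s → map (λ t → (proj₁ s ∙ proj₁ t , proj₂ s * proj₂ t)) q) p

  pairing-cong : ∀ p {f g} → (∀ e → f e ≡ g e) → pairing p f ≡ pairing p g
  pairing-cong [] eq = refl
  pairing-cong ((e , c) ∷ p) eq = cong₂ _+_ (cong (c *_) (eq e)) (pairing-cong p eq)

  pairing-zero : ∀ p → pairing p (λ _ → 0ℤ) ≡ 0ℤ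
  pairing-zero [] = refl
  pairing-zero ((e , c) ∷ p) = cong₂ _+_ (ℤ.*-zeroʳ c) (pairing-zero p)

  pairing-+ : ∀ p f g → pairing p (λ e → f e + g e) ≡ pairing p f + pairing p g
  pairing-+ [] f g = refl
  pairing-+ ((e , c) ∷ p) f g = trans (cong (c * (f e + g e) +_) (pairing-+ p f g))
    (solve 5 (λ c a b u v → c :* (a :+ b) :+ (u :+ v) := (c :* a :+ u) :+ (c :* b :+ v)) refl c (f e) (g e)
      (pairing p f) (pairing p g))
    where open +-*-Solver

  pairing-* : ∀ p k f → pairing p (λ e → k * f e) ≡ k * pairing p f
  pairing-* [] k f = sym (ℤ.*-zeroʳ k)
  pairing-* ((e , c) ∷ p) k f = trans (cong (c * (k * f e) +_) (pairing-* p k f))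
    (solve 4 (λ c k a u → c :* (k :* a) :+ k :* u := k :* (c :* a :+ u)) refl c k (f e) (pairing p f))
    where open +-*-Solver

  pairing-++ : ∀ p q f → pairing (p ++ q) f ≡ pairing p f + pairing q f
  pairing-++ [] q f = sym (ℤ.+-identityˡ _)
  pairing-++ ((e , c) ∷ p) q f = trans (cong (c * f e +_) (pairing-++ p q f)) (sym (ℤ.+-assoc (c * f e) _ _))

  pairing-neg : ∀ p f → pairing (negP p) f ≡ - pairing p f
  pairing-neg [] f = refl
  pairing-neg ((e , c) ∷ p) f = trans (cong (- c * f e +_) (pairing-neg p f))
    (solve 3 (λ c a u → :- c :* a :+ :- u := :- (c :* a :+ u)) refl c (f e) (pairing p f))
    where open +-*-Solver

  pairing-mul : ∀ p q f → pairing (mulP p q) f ≡ pairing p (λ s → pairing q (λ t → f (s ∙ t)))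
  pairing-mul [] q f = refl
  pairing-mul ((s , c) ∷ p) q f = trans (pairing-++ (map _ q) _ f) (cong₂ _+_ (scaled q) (pairing-mul p q f))
    where
    open +-*-Solver
    scaled : ∀ q → pairing (map (λ t → (s ∙ proj₁ t , c * proj₂ t)) q) f ≡ c * pairing q (λ t → f (s ∙ t))
    scaled [] = sym (ℤ.*-zeroʳ c)
    scaled ((t , d) ∷ q) = trans (cong ((c * d) * f (s ∙ t) +_) (scaled q))
      (solve 4 (λ c d a u → (c :* d) :* a :+ c :* u := c :* (d :* a :+ u)) refl c d (f (s ∙ t))
        (pairing q (λ t → f (s ∙ t))))

  pairing-[] : ∀ e f → pairing [ e , 1ℤ ] f ≡ f e
  pairing-[] e f = trans (ℤ.+-identityʳ _) (ℤ.*-identityˡ (f e))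

  pairing-mul-[] : ∀ e p f → pairing (mulP [ e , 1ℤ ] p) f ≡ pairing p (λ t → f (e ∙ t))
  pairing-mul-[] e p f = trans (pairing-mul [ e , 1ℤ ] p f) (pairing-[] e (λ s → pairing p (λ t → f (s ∙ t))))

  pairing-swap : ∀ p q (g : E → E → ℤ) →
    pairing p (λ s → pairing q (g s)) ≡ pairing q (λ t → pairing p (λ s → g s t))
  pairing-swap [] q g = sym (pairing-zero q)
  pairing-swap ((s , c) ∷ p) q g = trans
    (cong₂ _+_ (sym (pairing-* q c (g s))) (pairing-swap p q g))
    (sym (pairing-+ q (λ t → c * g s t) (λ t → pairing p (λ s → g s t))))

  private
    mul-cong : ∀ {p p′ q q′} → p ≋ p′ → q ≋ q′ → mulP p q ≋ mulP p′ q′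
    mul-cong {p} {p′} {q} {q′} eq eq′ = ≋-intro λ f → trans (pairing-mul p q f)
      (trans (pairing-≡ eq _) (trans (pairing-cong p′ (λ s → pairing-≡ eq′ _)) (sym (pairing-mul p′ q′ f))))

    mul-comm : ∀ p q → mulP p q ≋ mulP q p
    mul-comm p q = ≋-intro λ f → trans (pairing-mul p q f) (trans (pairing-swap p q (λ s t → f (s ∙ t)))
      (trans (pairing-cong q (λ t → pairing-cong p (λ s → cong f (∙-comm s t)))) (sym (pairing-mul q p f))))

    mul-assoc : ∀ p q r → mulP (mulP p q) r ≋ mulP p (mulP q r)
    mul-assoc p q r = ≋-intro λ f → begin
      pairing (mulP (mulP p q) r) f ≡⟨ pairing-mul (mulP p q) r f ⟩
      pairing (mulP p q) (λ s → pairing r (λ t → f (s ∙ t))) ≡⟨ pairing-mul p q _ ⟩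
      pairing p (λ s → pairing q (λ u → pairing r (λ t → f ((s ∙ u) ∙ t))))
        ≡⟨ pairing-cong p (λ s → pairing-cong q (λ u → pairing-cong r (λ t → cong f (∙-assoc s u t)))) ⟩
      pairing p (λ s → pairing q (λ u → pairing r (λ t → f (s ∙ (u ∙ t)))))
        ≡⟨ pairing-cong p (λ s → pairing-mul q r (λ v → f (s ∙ v))) ⟨
      pairing p (λ s → pairing (mulP q r) (λ v → f (s ∙ v))) ≡⟨ pairing-mul p (mulP q r) f ⟨
      pairing (mulP p (mulP q r)) f ∎
      where open ≡-Reasoning

    mul-identityˡ : ∀ p → mulP [ ε , 1ℤ ] p ≋ p
    mul-identityˡ p = ≋-intro λ f → trans (pairing-mul-[] ε p f)
      (pairing-cong p (λ t → cong f (∙-identityˡ t)))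

    mul-distribˡ : ∀ p q r → mulP p (q ++ r) ≋ mulP p q ++ mulP p r
    mul-distribˡ p q r = ≋-intro λ f → begin
      pairing (mulP p (q ++ r)) f ≡⟨ pairing-mul p (q ++ r) f ⟩
      pairing p (λ s → pairing (q ++ r) (λ t → f (s ∙ t)))
        ≡⟨ pairing-cong p (λ s → pairing-++ q r (λ t → f (s ∙ t))) ⟩
      pairing p (λ s → pairing q (λ t → f (s ∙ t)) + pairing r (λ t → f (s ∙ t))) ≡⟨ pairing-+ p _ _ ⟩
      pairing p (λ s → pairing q (λ t → f (s ∙ t))) + pairing p (λ s → pairing r (λ t → f (s ∙ t)))
        ≡⟨ cong₂ _+_ (pairing-mul p q f) (pairing-mul p r f) ⟨
      pairing (mulP p q) f + pairing (mulP p r) f ≡⟨ pairing-++ (mulP p q) _ f ⟨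
      pairing (mulP p q ++ mulP p r) f ∎
      where open ≡-Reasoning

  monoidRing : CommutativeRing 0ℓ 0ℓ
  monoidRing = record
    { Carrier = Poly ; _≈_ = _≋_ ; _+_ = _++_ ; _*_ = mulP ; -_ = negP ; 0# = [] ; 1# = [ ε , 1ℤ ]
    ; isCommutativeRing = record
      { isRing = record
        { +-isAbelianGroup = record
          { isGroup = record
            { isMonoid = record
              { isSemigroup = record
                { isMagma = record
                  { isEquivalence = ≋-isEquivalence
                  ; ∙-cong = λ {p} {p′} {q} {q′} eq eq′ → ≋-intro λ f → trans (pairing-++ p q f)
                      (trans (cong₂ _+_ (pairing-≡ eq f) (pairing-≡ eq′ f)) (sym (pairing-++ p′ q′ f)))
                  }
                ; assoc = λ p q r → ≋-intro λ f →
                  trans (trans (pairing-++ (p ++ q) r f) (cong (_+ pairing r f) (pairing-++ p q f)))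
                    (trans (ℤ.+-assoc (pairing p f) _ _)
                           (sym (trans (pairing-++ p (q ++ r) f) (cong (pairing p f +_) (pairing-++ q r f)))))
                }
              ; identity = (λ p → ≋-intro λ f → refl) ,
                (λ p → ≋-intro λ f → trans (pairing-++ p [] f) (ℤ.+-identityʳ _))
              }
            ; inverse = (λ p → ≋-intro λ f → trans (pairing-++ (negP p) p f)
                          (trans (cong (_+ pairing p f) (pairing-neg p f)) (ℤ.+-inverseˡ (pairing p f))))
                      , (λ p → ≋-intro λ f → trans (pairing-++ p (negP p) f)
                          (trans (cong (pairing p f +_) (pairing-neg p f)) (ℤ.+-inverseʳ (pairing p f))))
            ; ⁻¹-cong = λ {p} {q} eq → ≋-intro λ f → trans (pairing-neg p f)
              (trans (cong -_ (pairing-≡ eq f)) (sym (pairing-neg q f)))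
            }
          ; comm = λ p q → ≋-intro λ f → trans (pairing-++ p q f)
              (trans (ℤ.+-comm (pairing p f) (pairing q f)) (sym (pairing-++ q p f)))
          }
        ; *-cong = λ {p} {p′} {q} {q′} → mul-cong {p} {p′} {q} {q′}
        ; *-assoc = mul-assoc
        ; *-identity = mul-identityˡ , λ p → ≋-trans (mul-comm p [ ε , 1ℤ ]) (mul-identityˡ p)
        ; distrib = mul-distribˡ , λ p q r → ≋-intro λ f →
            trans (pairing-≡ (mul-comm (q ++ r) p) f) (trans (pairing-≡ (mul-distribˡ p q r) f)
            (trans (pairing-++ (mulP p q) _ f)
            (trans (cong₂ _+_ (pairing-≡ (mul-comm p q) f) (pairing-≡ (mul-comm p r) f))
            (sym (pairing-++ (mulP q p) _ f)))))
        }
      ; *-comm = mul-comm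
      }
    }
    where
    ≋-trans : ∀ {p q r} → p ≋ q → q ≋ r → p ≋ r
    ≋-trans eq eq′ = ≋-intro λ f → trans (pairing-≡ eq f) (pairing-≡ eq′ f)
    ≋-isEquivalence : IsEquivalence _≋_
    ≋-isEquivalence = record
      { refl = ≋-intro λ f → refl ; sym = λ eq → ≋-intro λ f → sym (pairing-≡ eq f) ; trans = ≋-trans }

  -- The transpose of multiplication by `p` sends the functional `f` to `g`. It is tested on
  -- monomials only and extends to all polynomials by `Acts⇒pairing`; in this form factors are
  -- absorbed into a functional one at a time.
  record Acts (p : Poly) (f g : E → ℤ) : Set where
    constructor acts-intro
    field acts : ∀ e → pairing p (λ s → f (s ∙ e)) ≡ g e

  open Acts public

  Acts⇒pairing : ∀ {p f g} → Acts p f g → ∀ q → pairing (mulP p q) f ≡ pairing q g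
  Acts⇒pairing {p} {f} act q = trans (pairing-mul p q f)
    (trans (pairing-swap p q (λ s t → f (s ∙ t))) (pairing-cong q (acts act)))

  Acts-[] : ∀ e f → Acts [ e , 1ℤ ] f (λ t → f (e ∙ t))
  Acts-[] e f = acts-intro λ t → pairing-[] e (λ s → f (s ∙ t))

  Acts-one : ∀ {f} → Acts [ ε , 1ℤ ] f f
  Acts-one {f} = acts-intro λ t → trans (acts (Acts-[] ε f) t) (cong f (∙-identityˡ t))

  Acts-mul : ∀ {p q f g h} → Acts p f g → Acts q g h → Acts (mulP p q) f h
  Acts-mul {p} {q} {f} act act′ = acts-intro λ e → trans (pairing-mul p q (λ s → f (s ∙ e)))
    (trans (pairing-swap p q (λ s t → f ((s ∙ t) ∙ e)))
    (trans (pairing-cong q (λ t → trans (pairing-cong p (λ s → cong f (∙-assoc s t e))) (acts act (t ∙ e))))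
           (acts act′ e)))

  Acts-cong : ∀ {p q f g} → p ≋ q → Acts q f g → Acts p f g
  Acts-cong eq act = acts-intro λ e → trans (pairing-≡ eq _) (acts act e)

-- Ring homomorphisms induced by monoid homomorphisms of exponents.

module ExponentMap {E F : Set} {_∙_ : E → E → E} {ε : E} {_∘_ : F → F → F} {η : F}
  (isCM : IsCommutativeMonoid _≡_ _∙_ ε) (isCM′ : IsCommutativeMonoid _≡_ _∘_ η)
  (h : E → F) (h-∙ : ∀ e e′ → h (e ∙ e′) ≡ h e ∘ h e′) (h-ε : h ε ≡ η) where
  open import Relation.Binary.PropositionalEquality using (refl; sym; trans; cong; cong₂; module ≡-Reasoning)
  open import Data.Integer using (0ℤ; 1ℤ; _+_; _*_; -_)
  open import Data.List using ([]; _∷_; map; _++_)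
  import Data.Vec as V

  private
    module P = MonoidRing isCM
    module Q = MonoidRing isCM′
    module RP = CommutativeRing P.monoidRing
    module RQ = CommutativeRing Q.monoidRing
    module AP = PairProducts P.monoidRing
    module AQ = PairProducts Q.monoidRing

  -- Four instances are used: a new variable in front (`Lift`), a new variable at position i
  -- (`Insert`), the exchange of two neighbouring variables (`Swap`), and polynomials among Laurent
  -- polynomials (`Embed`).
  mapExp : P.Poly → Q.Poly
  mapExp = map (λ t → h (proj₁ t) , proj₂ t)

  pairing-mapExp : ∀ p f → Q.pairing (mapExp p) f ≡ P.pairing p (λ e → f (h e))
  pairing-mapExp [] f = refl
  pairing-mapExp ((e , c) ∷ p) f = cong (c * f (h e) +_) (pairing-mapExp p f)

  mapExp-one : mapExp RP.1# Q.≋ RQ.1#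
  mapExp-one = Q.≋-intro λ f → cong (λ e → 1ℤ * f e + 0ℤ) h-ε

  mapExp-+ : ∀ p q → mapExp (p RP.+ q) Q.≋ mapExp p RQ.+ mapExp q
  mapExp-+ p q = Q.≋-intro λ f → trans (pairing-mapExp (p ++ q) f) (trans (P.pairing-++ p q _)
    (sym (trans (Q.pairing-++ (mapExp p) _ f) (cong₂ _+_ (pairing-mapExp p f) (pairing-mapExp q f)))))

  mapExp-neg : ∀ p → mapExp (RP.- p) Q.≋ RQ.- mapExp p
  mapExp-neg p = Q.≋-intro λ f → trans (pairing-mapExp (P.negP p) f) (trans (P.pairing-neg p _)
    (sym (trans (Q.pairing-neg (mapExp p) f) (cong -_ (pairing-mapExp p f)))))

  mapExp-* : ∀ p q → mapExp (p RP.* q) Q.≋ mapExp p RQ.* mapExp q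
  mapExp-* p q = Q.≋-intro λ f → begin
    Q.pairing (mapExp (P.mulP p q)) f ≡⟨ pairing-mapExp (P.mulP p q) f ⟩
    P.pairing (P.mulP p q) (λ e → f (h e)) ≡⟨ P.pairing-mul p q _ ⟩
    P.pairing p (λ s → P.pairing q (λ t → f (h (s ∙ t))))
      ≡⟨ P.pairing-cong p (λ s → P.pairing-cong q (λ t → cong f (h-∙ s t))) ⟩
    P.pairing p (λ s → P.pairing q (λ t → f (h s ∘ h t)))
      ≡⟨ P.pairing-cong p (λ s → pairing-mapExp q (λ t → f (h s ∘ t))) ⟨
    P.pairing p (λ s → Q.pairing (mapExp q) (λ t → f (h s ∘ t))) ≡⟨ pairing-mapExp p _ ⟨
    Q.pairing (mapExp p) (λ s → Q.pairing (mapExp q) (λ t → f (s ∘ t)))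
      ≡⟨ Q.pairing-mul (mapExp p) (mapExp q) f ⟨
    Q.pairing (Q.mulP (mapExp p) (mapExp q)) f ∎
    where open ≡-Reasoning

  mapExp-- : ∀ p q → mapExp (p RP.- q) Q.≋ mapExp p RQ.- mapExp q
  mapExp-- p q = RQ.trans (mapExp-+ p (RP.- q)) (RQ.+-congˡ (mapExp-neg q))

  mapExp-gogFactor : ∀ p q → mapExp (AP.gogFactor p q) Q.≋ AQ.gogFactor (mapExp p) (mapExp q)
  mapExp-gogFactor p q = RQ.trans (mapExp-+ RP.1# _)
    (RQ.+-cong mapExp-one (RQ.trans (mapExp-+ q _) (RQ.+-congˡ (mapExp-* p q))))

  mapExp-prod-map : ∀ {f g} → (∀ p → mapExp (f p) Q.≋ g (mapExp p)) →
    ∀ {n} (ps : V.Vec P.Poly n) → mapExp (AP.prod (V.map f ps)) Q.≋ AQ.prod (V.map g (V.map mapExp ps))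
  mapExp-prod-map eq V.[] = mapExp-one
  mapExp-prod-map {f} {g} eq (p V.∷ ps) = RQ.trans (mapExp-* (f p) (AP.prod (V.map f ps)))
    (RQ.*-cong {x = mapExp (f p)} {y = g (mapExp p)} (eq p) (mapExp-prod-map eq ps))

  mapExp-prod : ∀ {n} (ps : V.Vec P.Poly n) → mapExp (AP.prod ps) Q.≋ AQ.prod (V.map mapExp ps)
  mapExp-prod V.[] = mapExp-one
  mapExp-prod (p V.∷ ps) = RQ.trans (mapExp-* p (AP.prod ps)) (RQ.*-congˡ {x = mapExp p} (mapExp-prod ps))

  mapExp-pairProd : ∀ {f g} → (∀ p q → mapExp (f p q) Q.≋ g (mapExp p) (mapExp q)) →
    ∀ {n} (ps : V.Vec P.Poly n) → mapExp (AP.pairProd f ps) Q.≋ AQ.pairProd g (V.map mapExp ps)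
  mapExp-pairProd eq V.[] = mapExp-one
  mapExp-pairProd {f} {g} eq (p V.∷ ps) =
    RQ.trans (mapExp-* (AP.prod (V.map (f p) ps)) (AP.pairProd f ps))
             (RQ.*-cong (mapExp-prod-map (eq p) ps) (mapExp-pairProd eq ps))

  mapExp-gogProd : ∀ {n} (ps : V.Vec P.Poly n) → mapExp (AP.gogProd ps) Q.≋ AQ.gogProd (V.map mapExp ps)
  mapExp-gogProd = mapExp-pairProd λ p q →
    RQ.trans (mapExp-* (p RP.- q) _) (RQ.*-cong (mapExp-- p q) (mapExp-gogFactor p q))

  mapExp-prodFrom : ∀ {n} i (ps : V.Vec P.Poly n) → mapExp (AP.prodFrom i ps) Q.≋ AQ.prodFrom i
    (V.map mapExp ps)
  mapExp-prodFrom zero ps = mapExp-prod-map (λ p → RQ.trans (mapExp-+ RP.1# p) (RQ.+-congʳ mapExp-one)) ps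
  mapExp-prodFrom (suc i) (p V.∷ ps) = mapExp-prodFrom i ps

  mapExp-pairUnit : ∀ {n} i (ps : V.Vec P.Poly (suc n)) → mapExp (AP.pairUnit i ps) Q.≋ AQ.pairUnit i
    (V.map mapExp ps)
  mapExp-pairUnit zero (p V.∷ q V.∷ ps) = RQ.trans (mapExp-+ RP.1# _)
    (RQ.+-cong mapExp-one (RQ.trans (mapExp-+ p _) (RQ.+-congˡ (mapExp-* p q))))
  mapExp-pairUnit (suc i) (p V.∷ ps) = mapExp-pairUnit i ps

-- Constant terms of the Gog product: expansion and antisymmetry.

module ConstantTerm where
  open import Relation.Binary.PropositionalEquality using
    (refl; sym; trans; cong; cong₂; subst; isEquivalence; module ≡-Reasoning)
  open import Data.Integer using (ℤ; 0ℤ; 1ℤ; _+_; _*_; -_; _-_)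
  import Data.Integer.Properties as ℤ
  open import Data.Integer.Solver using (module +-*-Solver)
  open import Agda.Builtin.Int using (pos; negsuc)
  import Algebra.Properties.Semiring.Exp as Exp
  import Data.List as L
  import Data.List.Properties as L
  open import Data.Vec using (map; lookup; removeAt; insertAt; replicate; zipWith)
  open import Function using (_∘_)

  Vec-isCommutativeMonoid : ∀ {A : Set} {_∙_ : A → A → A} {ε : A} → IsCommutativeMonoid _≡_ _∙_ ε →
    ∀ n → IsCommutativeMonoid _≡_ (zipWith {n = n} _∙_) (replicate n ε)
  Vec-isCommutativeMonoid isCM n = record
    { isMonoid = record
      { isSemigroup = record
        { isMagma = record { isEquivalence = isEquivalence ; ∙-cong = cong₂ _ }
        ; assoc = Vec.zipWith-assoc M.assoc
        }
      ; identity = Vec.zipWith-identityˡ M.identityˡ , Vec.zipWith-identityʳ M.identityʳ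
      }
    ; comm = Vec.zipWith-comm M.comm
    }
    where module M = IsCommutativeMonoid isCM

  ℕⁿ : ∀ n → IsCommutativeMonoid _≡_ (zipWith {n = n} ℕ._+_) (replicate n 0)
  ℕⁿ = Vec-isCommutativeMonoid ℕ.+-0-isCommutativeMonoid

  open module Polynomial {n : ℕ} = MonoidRing (ℕⁿ n)
  open module Products {n : ℕ} = PairProducts (monoidRing {n}) hiding (altSum; altSum-cong)
  private module AS {n : ℕ} = PairProducts (monoidRing {n})
  open PairProducts ℤ.+-*-commutativeRing using (altSum; altSum-cong)
  module R {n : ℕ} = CommutativeRing (monoidRing {n})
  open module Power {n : ℕ} = Exp (R.semiring {n}) using (_^_)

  infixl 6 _⊕_
  _⊕_ : Vec ℕ n → Vec ℕ n → Vec ℕ n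
  _⊕_ = zipWith ℕ._+_

  monomial : Vec ℕ n → Poly {n}
  monomial e = L.[ e , 1ℤ ]

  δ : ℕ → ℕ → ℤ
  δ zero zero = 1ℤ
  δ zero (suc e) = 0ℤ
  δ (suc d) zero = 0ℤ
  δ (suc d) (suc e) = δ d e

  -- The constant term of (1 + x)^b x^(e - d).
  β : ℕ → ℕ → ℕ → ℤ
  β zero d e = δ d e
  β (suc b) d e = β b d e + β b d (suc e)

  δ-≡ : ∀ d → δ d d ≡ 1ℤ
  δ-≡ zero = refl
  δ-≡ (suc d) = δ-≡ d

  δ-< : ∀ {d e} → d ℕ.< e → δ d e ≡ 0ℤ
  δ-< {zero} (s≤s _) = refl
  δ-< {suc d} (s≤s lt) = δ-< lt

  β-suc-suc : ∀ b d e → β b (suc d) (suc e) ≡ β b d e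
  β-suc-suc zero d e = refl
  β-suc-suc (suc b) d e = cong₂ _+_ (β-suc-suc b d e) (β-suc-suc b d (suc e))

  β-< : ∀ b {d e} → d ℕ.< e → β b d e ≡ 0ℤ
  β-< zero lt = δ-< lt
  β-< (suc b) lt = cong₂ _+_ (β-< b lt) (β-< b (ℕ.m<n⇒m<1+n lt))

  -- For e ≥ d no negative power of x occurs, so the constant term is the value at x = 0 and does
  -- not depend on b. Hence the entry of the removed variable disappears from the expansion.
  β-≤ : ∀ b {d e} → d ℕ.≤ e → β b d e ≡ δ d e
  β-≤ zero d≤e = refl
  β-≤ (suc b) d≤e = trans (cong₂ _+_ (β-≤ b d≤e) (β-< b (s≤s d≤e))) (ℤ.+-identityʳ _)

  -- The pair (b , d) at position i stands for the factor (1 + xᵢ)^b xᵢ^(-d).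
  Weight : Set
  Weight = ℕ × ℕ

  bump deepen : Weight → Weight
  bump (b , d) = suc b , d
  deepen (b , d) = b , suc d

  -- Its linear extension sends p to the constant term of p ∏ (1 + xᵢ)^bᵢ xᵢ^(-dᵢ). The negative
  -- powers are part of the functional, so polynomials keep exponents in ℕ.
  ω : Vec Weight n → Vec ℕ n → ℤ
  ω [] [] = 1ℤ
  ω ((b , d) ∷ ws) (a ∷ e) = β b d a * ω ws e

  CT : Vec Weight n → Poly → ℤ
  CT ws p = pairing p (ω ws)

  module Lift {n : ℕ} = ExponentMap (ℕⁿ n) (ℕⁿ (suc n)) (0 ∷_) (λ _ _ → refl) refl
  open Lift using () renaming (mapExp to lift)

  x₀ : Poly {suc n}
  x₀ {n} = monomial (1 ∷ replicate n 0)

  vars : ∀ n → Vec (Poly {n}) n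
  vars zero = []
  vars (suc n) = x₀ ∷ map lift (vars n)

  Acts-lift : ∀ {n} {p : Poly {n}} {ws ws′} w → Acts p (ω ws) (ω ws′) → Acts (lift p) (ω (w ∷ ws))
    (ω (w ∷ ws′))
  Acts-lift {p = p} {ws} w@(b , d) act = acts-intro λ { (a ∷ e) → trans (Lift.pairing-mapExp p _)
    (trans (pairing-* p (β b d a) (λ s → ω ws (s ⊕ e))) (cong (β b d a *_) (acts act e))) }

  zero-⊕ : (e : Vec ℕ n) → replicate n 0 ⊕ e ≡ e
  zero-⊕ = IsCommutativeMonoid.identityˡ (ℕⁿ _)

  Acts-1+x₀ : ∀ w (ws : Vec Weight n) → Acts (R.1# R.+ x₀) (ω (w ∷ ws)) (ω (bump w ∷ ws))
  Acts-1+x₀ {n} (b , d) ws = acts-intro λ { (a ∷ e) → trans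
    (cong (λ e′ → 1ℤ * (β b d a * ω ws e′) + (1ℤ * (β b d (suc a) * ω ws e′) + 0ℤ)) (zero-⊕ e))
    (solve 3 (λ p q r → con 1ℤ :* (p :* r) :+ (con 1ℤ :* (q :* r) :+ con 0ℤ) := (p :+ q) :* r) refl
      (β b d a) (β b d (suc a)) (ω ws e)) }
    where open +-*-Solver

  Acts-x₀ : ∀ w (ws : Vec Weight n) → Acts x₀ (ω (deepen w ∷ ws)) (ω (w ∷ ws))
  Acts-x₀ (b , d) ws = acts-intro λ { (a ∷ e) → trans (ℤ.+-identityʳ _) (trans (ℤ.*-identityˡ _)
    (cong₂ (λ c e′ → c * ω ws e′) (β-suc-suc b d a) (zero-⊕ e))) }

  Acts-prod-1+ : ∀ (ws : Vec Weight n) → Acts (prod (map (λ x → R.1# R.+ x) (vars n))) (ω ws)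
    (ω (map bump ws))
  Acts-prod-1+ [] = Acts-one
  Acts-prod-1+ {suc n} (w ∷ ws) = Acts-mul {p = R.1# R.+ x₀}
    {q = prod (map (λ x → R.1# R.+ x) (map lift (vars n)))}
    (Acts-1+x₀ w ws)
    (Acts-cong (R.sym (Lift.mapExp-prodFrom zero (vars n)))
      (Acts-lift {p = prod (map (λ x → R.1# R.+ x) (vars n))} (bump w) (Acts-prod-1+ ws)))

  Acts-prod : ∀ (ws : Vec Weight n) → Acts (prod (vars n)) (ω (map deepen ws)) (ω ws)
  Acts-prod [] = Acts-one
  Acts-prod {suc n} (w ∷ ws) = Acts-mul {p = x₀} {q = prod (map lift (vars n))}
    (Acts-x₀ w (map deepen ws))
    (Acts-cong (R.sym (Lift.mapExp-prod (vars n))) (Acts-lift {p = prod (vars n)} w (Acts-prod ws)))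

  Acts-prodFrom : ∀ i (ws : Vec Weight n) → Acts (prodFrom i (vars n)) (ω ws) (ω (mapFrom bump i ws))
  Acts-prodFrom zero ws = Acts-prod-1+ ws
  Acts-prodFrom {suc n} (suc i) (w ∷ ws) = Acts-cong (R.sym (Lift.mapExp-prodFrom i (vars n)))
    (Acts-lift {p = prodFrom i (vars n)} w (Acts-prodFrom i ws))

  power : Fin n → ℕ → Vec ℕ n
  power {suc n} zero m = m ∷ replicate n 0
  power (suc i) m = 0 ∷ power i m

  lookup-vars : (i : Fin n) → lookup (vars n) i ≡ monomial (power i 1)
  lookup-vars zero = refl
  lookup-vars {suc n} (suc i) = trans (Vec.lookup-map i lift (vars n)) (cong lift (lookup-vars i))

  power-⊕ : ∀ (i : Fin n) k m → power i k ⊕ power i m ≡ power i (k ℕ.+ m)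
  power-⊕ zero k m = cong (_ ∷_) (zero-⊕ _)
  power-⊕ (suc i) k m = cong (0 ∷_) (power-⊕ i k m)

  power-zero : (i : Fin n) → power i 0 ≡ replicate n 0
  power-zero zero = refl
  power-zero (suc i) = cong (0 ∷_) (power-zero i)

  var-^ : ∀ (i : Fin n) m → lookup (vars n) i ^ m R.≈ monomial (power i m)
  var-^ i zero = R.reflexive (cong monomial (sym (power-zero i)))
  var-^ {n} i (suc m) = R.trans (R.*-cong (R.reflexive (lookup-vars i)) (var-^ i m))
    (≋-intro λ f → trans (pairing-mul-[] (power i 1) (monomial (power i m)) f)
      (trans (pairing-[] (power i m) (λ t → f (power i 1 ⊕ t)))
        (trans (cong f (power-⊕ i 1 m)) (sym (pairing-[] (power i (suc m)) f)))))

  ω-power : ∀ (ws : Vec Weight (suc n)) i m e → proj₂ (lookup ws i) ℕ.≤ m →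
    ω ws (power i m ⊕ insertAt e i 0) ≡ δ (proj₂ (lookup ws i)) m * ω (removeAt ws i) e
  ω-power ((b , d) ∷ ws) zero m e d≤m rewrite zero-⊕ e | ℕ.+-identityʳ m | β-≤ b d≤m = refl
  ω-power ((b , d) ∷ ws@(_ ∷ _)) (suc i) m (a ∷ e) d≤m rewrite ω-power ws i m e d≤m =
    solve 3 (λ p q r → p :* (q :* r) := q :* (p :* r)) refl (β b d a) (δ (proj₂ (lookup ws i)) m)
      (ω (removeAt ws i) e)
    where open +-*-Solver

  ω-power-< : ∀ (ws : Vec Weight n) i m e → proj₂ (lookup ws i) ℕ.< m → ω ws (power i m ⊕ e) ≡ 0ℤ
  ω-power-< ((b , d) ∷ ws) zero m (a ∷ e) d<m rewrite β-< b (ℕ.<-≤-trans d<m (ℕ.m≤m+n m a)) =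
    ℤ.*-zeroˡ (ω ws e)
  ω-power-< ((b , d) ∷ ws) (suc i) m (a ∷ e) d<m rewrite ω-power-< ws i m e d<m = ℤ.*-zeroʳ (β b d a)

  insertAt-⊕ : ∀ (i : Fin (suc n)) e e′ → insertAt (e ⊕ e′) i 0 ≡ insertAt e i 0 ⊕ insertAt e′ i 0
  insertAt-⊕ zero e e′ = refl
  insertAt-⊕ (suc i) (a ∷ e) (a′ ∷ e′) = cong (_ ∷_) (insertAt-⊕ i e e′)

  insertAt-zero : ∀ (i : Fin (suc n)) → insertAt (replicate n 0) i 0 ≡ replicate (suc n) 0
  insertAt-zero zero = refl
  insertAt-zero {suc n} (suc i) = cong (0 ∷_) (insertAt-zero i)

  module Insert {n : ℕ} (i : Fin (suc n)) =
    ExponentMap (ℕⁿ n) (ℕⁿ (suc n)) (λ e → insertAt e i 0) (insertAt-⊕ i) (insertAt-zero i)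

  removeAt-map : ∀ {A B : Set} (f : A → B) (xs : Vec A (suc n)) i →
    removeAt (map f xs) i ≡ map f (removeAt xs i)
  removeAt-map f (x ∷ xs) zero = refl
  removeAt-map f (x ∷ xs@(_ ∷ _)) (suc i) = cong (f x ∷_) (removeAt-map f xs i)

  -- Identifies the variables other than xᵢ with those of the ring with one variable less, so that
  -- what remains of the i-th term of the expansion can be read as a constant term there.
  removeAt-vars : ∀ (i : Fin (suc n)) → removeAt (vars (suc n)) i ≡ map (Insert.mapExp i) (vars n)
  removeAt-vars zero = refl
  removeAt-vars {suc n} (suc i) = cong₂ _∷_ (cong (λ e → monomial (1 ∷ e)) (sym (insertAt-zero i))) (begin
    removeAt (map lift (vars (suc n))) i          ≡⟨ removeAt-map lift (vars (suc n)) i ⟩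
    map lift (removeAt (vars (suc n)) i)          ≡⟨ cong (map lift) (removeAt-vars i) ⟩
    map lift (map (Insert.mapExp i) (vars n))     ≡⟨ Vec.map-∘ lift (Insert.mapExp i) (vars n) ⟨
    map (lift ∘ Insert.mapExp i) (vars n)         ≡⟨ Vec.map-cong (λ p → trans (sym (L.map-∘ p)) (L.map-∘ p))
      (vars n) ⟩
    map (Insert.mapExp (suc i) ∘ lift) (vars n)   ≡⟨ Vec.map-∘ (Insert.mapExp (suc i)) lift (vars n) ⟩
    map (Insert.mapExp (suc i)) (map lift (vars n)) ∎)
    where open ≡-Reasoning

  gogCT : Vec Weight n → ℤ
  gogCT {n} ws = CT ws (gogProd (vars n))

  pairing-altSum : ∀ {m} (f : Fin m → Poly {n}) φ → pairing (AS.altSum f) φ ≡ altSum (λ i → pairing (f i) φ)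
  pairing-altSum {m = zero} f φ = refl
  pairing-altSum {m = suc m} f φ = trans (pairing-++ (f zero) _ φ)
    (cong (pairing (f zero) φ +_) (trans (pairing-neg (AS.altSum (λ i → f (suc i))) φ)
      (cong -_ (pairing-altSum (λ i → f (suc i)) φ))))

  gogCT-expand : ∀ {N} (ws : Vec Weight (suc N)) → (∀ i → proj₂ (lookup ws i) ℕ.≤ N) →
    gogCT ws ≡ altSum (λ i → δ (proj₂ (lookup ws i)) N * gogCT (mapFrom bump i (removeAt ws i)))
  gogCT-expand {N} ws d≤N = begin
    pairing (gogProd X) (ω ws)
      ≡⟨ Acts⇒pairing (Acts-prod ws) (gogProd X) ⟨
    pairing (prod X R.* gogProd X) φ
      ≡⟨ pairing-≡ (prod-gogProd X) φ ⟩
    pairing (AS.altSum (λ i → lookup X i ^ suc N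
      R.* (prod (removeAt X i) R.* (vandermonde (removeAt X i) R.* Q)))) φ
      ≡⟨ pairing-altSum (λ i → lookup X i ^ suc N
        R.* (prod (removeAt X i) R.* (vandermonde (removeAt X i) R.* Q))) φ ⟩
    altSum (λ i → pairing (lookup X i ^ suc N
      R.* (prod (removeAt X i) R.* (vandermonde (removeAt X i) R.* Q))) φ)
      ≡⟨ altSum-cong term ⟩
    altSum (λ i → δ (proj₂ (lookup ws i)) N * gogCT (mapFrom bump i (removeAt ws i))) ∎
    where
    open ≡-Reasoning
    X = vars (suc N)
    Y = vars N
    Q = pairProd gogFactor X
    φ = ω (map deepen ws)
    depth : ∀ i → proj₂ (lookup (map deepen ws) i) ≡ suc (proj₂ (lookup ws i))
    depth i = cong proj₂ (Vec.lookup-map i deepen ws)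
    module _ (i : Fin (suc N)) where
      module I = Insert i
      open RingSolver (monoidRing {suc N}) using (solve; _:+_; _:*_; _:=_)
      x = lookup X i
      Z = removeAt X i
      q = proj₁ (gogFactor-mod X i)
      S = prod Y R.* (prodFrom i Y R.* gogProd Y)
      rest : prod Z R.* (vandermonde Z R.* (prodFrom i Z R.* pairProd gogFactor Z)) ≋ I.mapExp S
      rest = R.trans (R.reflexive
        (cong (λ Z → prod Z R.* (vandermonde Z R.* (prodFrom i Z R.* pairProd gogFactor Z)))
        (removeAt-vars i)))
        (R.trans (R.*-congˡ {x = prod (map I.mapExp Y)} (R.trans
          (solve 3 (λ v f g → v :* (f :* g) := f :* (v :* g)) R.refl
             (vandermonde (map I.mapExp Y)) (prodFrom i (map I.mapExp Y))
               (pairProd gogFactor (map I.mapExp Y)))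
          (R.*-congˡ {x = prodFrom i (map I.mapExp Y)} (R.sym (gogProd-split (map I.mapExp Y))))))
        (R.sym (R.trans (I.mapExp-* (prod Y) (prodFrom i Y R.* gogProd Y))
          (R.*-cong (I.mapExp-prod Y) (R.trans (I.mapExp-* (prodFrom i Y) (gogProd Y))
            (R.*-cong (I.mapExp-prodFrom i Y) (I.mapExp-gogProd Y)))))))
      -- The part of the Gog factors at xᵢ = 0 leaves xᵢ with exponent exactly N + 1. The remainder
      -- has exponent at least N + 2, above the deepened depth of at most N + 1, and pairs to zero.
      split : x ^ suc N R.* (prod Z R.* (vandermonde Z R.* Q))
        ≋ monomial (power i (suc N)) R.* I.mapExp S R.+ monomial (power i (2 ℕ.+ N))
          R.* (prod Z R.* (vandermonde Z R.* q))
      split = R.trans (R.*-congˡ {x = x ^ suc N}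
        (R.*-congˡ {x = prod Z} (R.*-congˡ {x = vandermonde Z} (proj₂ (gogFactor-mod X i)))))
        (R.trans (solve 6 (λ y p v f x q → y :* (p :* (v :* (f :+ x :* q))) := y :* (p :* (v :* f)) :+
          (x :* y) :* (p :* (v :* q)))
            R.refl (x ^ suc N) (prod Z) (vandermonde Z) (prodFrom i Z R.* pairProd gogFactor Z) x q)
          (R.+-cong (R.*-cong (var-^ i (suc N)) rest)
                    (R.*-congʳ {x = prod Z R.* (vandermonde Z R.* q)} (var-^ i (2 ℕ.+ N)))))
      term : pairing (x ^ suc N R.* (prod Z R.* (vandermonde Z R.* Q))) φ
        ≡ δ (proj₂ (lookup ws i)) N * gogCT (mapFrom bump i (removeAt ws i))
      term = begin
        pairing (x ^ suc N R.* (prod Z R.* (vandermonde Z R.* Q))) φ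
          ≡⟨ trans (pairing-≡ split φ) (pairing-++ (monomial (power i (suc N)) R.* I.mapExp S) _ φ) ⟩
        pairing (monomial (power i (suc N)) R.* I.mapExp S) φ
          + pairing (monomial (power i (2 ℕ.+ N)) R.* (prod Z R.* (vandermonde Z R.* q))) φ
          ≡⟨ cong₂ _+_ main vanish ⟩
        δ (proj₂ (lookup ws i)) N * gogCT (mapFrom bump i (removeAt ws i)) + 0ℤ
          ≡⟨ ℤ.+-identityʳ _ ⟩
        δ (proj₂ (lookup ws i)) N * gogCT (mapFrom bump i (removeAt ws i)) ∎
        where
        vanish : pairing (monomial (power i (2 ℕ.+ N)) R.* (prod Z R.* (vandermonde Z R.* q))) φ ≡ 0ℤ
        vanish = trans (pairing-mul-[] (power i (2 ℕ.+ N)) (prod Z R.* (vandermonde Z R.* q)) φ)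
          (trans (pairing-cong (prod Z R.* (vandermonde Z R.* q))
            (λ e → ω-power-< (map deepen ws) i (2 ℕ.+ N) e
                   (subst (ℕ._< 2 ℕ.+ N) (sym (depth i)) (s≤s (s≤s (d≤N i))))))
                 (pairing-zero (prod Z R.* (vandermonde Z R.* q))))
        d = proj₂ (lookup ws i)
        main : pairing (monomial (power i (suc N)) R.* I.mapExp S) φ ≡
          δ d N * gogCT (mapFrom bump i (removeAt ws i))
        main = begin
          pairing (monomial (power i (suc N)) R.* I.mapExp S) φ
            ≡⟨ pairing-mul-[] (power i (suc N)) (I.mapExp S) φ ⟩
          pairing (I.mapExp S) (λ e → φ (power i (suc N) ⊕ e))
            ≡⟨ I.pairing-mapExp S _ ⟩
          pairing S (λ e → φ (power i (suc N) ⊕ insertAt e i 0))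
            ≡⟨ pairing-cong S (λ e → trans
                 (ω-power (map deepen ws) i (suc N) e (subst (ℕ._≤ suc N) (sym (depth i)) (s≤s (d≤N i))))
                 (cong₂ (λ d ws → δ d (suc N) * ω ws e) (depth i) (removeAt-map deepen ws i))) ⟩
          pairing S (λ e → δ d N * ω (map deepen (removeAt ws i)) e)
            ≡⟨ pairing-* S (δ d N) _ ⟩
          δ d N * pairing S (ω (map deepen (removeAt ws i)))
            -- `prod Y` takes the deepened weights back to the original depths, and `prodFrom i Y`
            -- raises the powers of 1 + xⱼ at the positions after i.
            ≡⟨ cong (δ d N *_) (trans (Acts⇒pairing (Acts-prod (removeAt ws i)) (prodFrom i Y R.* gogProd Y))
                                      (Acts⇒pairing (Acts-prodFrom i (removeAt ws i)) (gogProd Y))) ⟩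
          δ d N * gogCT (mapFrom bump i (removeAt ws i)) ∎

  atPair-zero : ∀ (i : Fin n) → atPair swap i (replicate (suc n) 0) ≡ replicate (suc n) 0
  atPair-zero zero = refl
  atPair-zero (suc i) = cong (0 ∷_) (atPair-zero i)

  atPair-⊕ : ∀ (i : Fin n) e e′ → atPair swap i (e ⊕ e′) ≡ atPair swap i e ⊕ atPair swap i e′
  atPair-⊕ zero (_ ∷ _ ∷ _) (_ ∷ _ ∷ _) = refl
  atPair-⊕ (suc i) (_ ∷ e) (_ ∷ e′) = cong (_ ∷_) (atPair-⊕ i e e′)

  module Swap {n : ℕ} (i : Fin n) =
    ExponentMap (ℕⁿ (suc n)) (ℕⁿ (suc n)) (atPair swap i) (atPair-⊕ i) (atPair-zero i)

  map-swap-vars : ∀ (i : Fin n) → map (Swap.mapExp i) (vars (suc n)) ≡ atPair swap i (vars (suc n))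
  map-swap-vars {suc n} zero = cong (λ ps → lift x₀ ∷ x₀ ∷ ps) (begin
    map (Swap.mapExp zero) (map lift (map lift (vars n)))
      ≡⟨ cong (map (Swap.mapExp zero)) (Vec.map-∘ lift lift (vars n)) ⟨
    map (Swap.mapExp zero) (map (lift ∘ lift) (vars n))
      ≡⟨ Vec.map-∘ (Swap.mapExp zero) (lift ∘ lift) (vars n) ⟨
    map (Swap.mapExp zero ∘ lift ∘ lift) (vars n)
      ≡⟨ Vec.map-cong (λ p → trans (cong (Swap.mapExp zero) (sym (L.map-∘ p)))
        (trans (sym (L.map-∘ p)) (L.map-∘ p))) (vars n) ⟩
    map (lift ∘ lift) (vars n)
      ≡⟨ Vec.map-∘ lift lift (vars n) ⟩
    map lift (map lift (vars n)) ∎)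
    where open ≡-Reasoning
  map-swap-vars {suc n} (suc i) = cong₂ _∷_ (cong (λ e → monomial (1 ∷ e)) (atPair-zero i)) (begin
    map (Swap.mapExp (suc i)) (map lift (vars (suc n)))
      ≡⟨ Vec.map-∘ (Swap.mapExp (suc i)) lift (vars (suc n)) ⟨
    map (Swap.mapExp (suc i) ∘ lift) (vars (suc n))
      ≡⟨ Vec.map-cong (λ p → trans (sym (L.map-∘ p)) (L.map-∘ p)) (vars (suc n)) ⟩
    map (lift ∘ Swap.mapExp i) (vars (suc n))
      ≡⟨ Vec.map-∘ lift (Swap.mapExp i) (vars (suc n)) ⟩
    map lift (map (Swap.mapExp i) (vars (suc n)))
      ≡⟨ cong (map lift) (map-swap-vars i) ⟩
    map lift (atPair swap i (vars (suc n)))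
      ≡⟨ map-atPair-swap lift i (vars (suc n)) ⟩
    atPair swap i (map lift (vars (suc n))) ∎)
    where
    open ≡-Reasoning
    map-atPair-swap : ∀ {n} {A B : Set} (f : A → B) (i : Fin n) xs →
      map f (atPair swap i xs) ≡ atPair swap i (map f xs)
    map-atPair-swap f zero (_ ∷ _ ∷ _) = refl
    map-atPair-swap f (suc i) (_ ∷ xs) = cong (_ ∷_) (map-atPair-swap f i xs)

  ω-atPair-swap : ∀ (i : Fin n) ws e → ω (atPair swap i ws) (atPair swap i e) ≡ ω ws e
  ω-atPair-swap zero ((b , d) ∷ (b′ , d′) ∷ ws) (a ∷ a′ ∷ e) =
    solve 3 (λ p q r → p :* (q :* r) := q :* (p :* r)) refl (β b′ d′ a′) (β b d a) (ω ws e)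
    where open +-*-Solver
  ω-atPair-swap (suc i) ((b , d) ∷ ws) (a ∷ e) = cong (β b d a *_) (ω-atPair-swap i ws e)

  bumpBoth bumpSecond : Weight × Weight → Weight × Weight
  bumpBoth (w , w′) = bump w , bump w′
  bumpSecond (w , w′) = w , bump w′

  -- With E and E′ the shifts of the two powers, multiplication by the variables is E - 1 and E′ -
  -- 1, and 1 + (E - 1) + (E - 1)(E′ - 1) = 1 + E E′ - E′.
  Acts-pairUnit : ∀ i (ws : Vec Weight (suc n)) → Acts (pairUnit i (vars (suc n))) (ω ws)
    (λ e → (ω ws e + ω (atPair bumpBoth i ws) e) - ω (atPair bumpSecond i ws) e)
  Acts-pairUnit {suc n} zero ((b , d) ∷ (b′ , d′) ∷ ws) = acts-intro λ { (a ∷ a′ ∷ e) → trans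
    (cong₂ (λ e₁ e₂ → 1ℤ * (β b d a * (β b′ d′ a′ * ω ws e₁))
        + (1ℤ * (β b d (suc a) * (β b′ d′ a′ * ω ws e₁))
          + (1ℤ * (β b d (suc a) * (β b′ d′ (suc a′) * ω ws e₂)) + 0ℤ)))
      (zero-⊕ e) (trans (cong (_⊕ e) (zero-⊕ (replicate n 0))) (zero-⊕ e)))
    (solve 5 (λ p p′ q q′ r → con 1ℤ :* (p :* (q :* r)) :+
      (con 1ℤ :* (p′ :* (q :* r)) :+ (con 1ℤ :* (p′ :* (q′ :* r)) :+ con 0ℤ))
        := (p :* (q :* r) :+ (p :+ p′) :* ((q :+ q′) :* r)) :- (p :* ((q :+ q′) :* r)))
      refl (β b d a) (β b d (suc a)) (β b′ d′ a′) (β b′ d′ (suc a′)) (ω ws e)) }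
    where open +-*-Solver
  Acts-pairUnit {suc n} (suc i) ((b , d) ∷ ws) = acts-intro λ { (a ∷ e) →
    trans (pairing-≡ (R.sym (Lift.mapExp-pairUnit i (vars (suc n)))) _)
    (trans (Lift.pairing-mapExp (pairUnit i (vars (suc n))) _)
    (trans (pairing-* (pairUnit i (vars (suc n))) (β b d a) (λ s → ω ws (s ⊕ e)))
    (trans (cong (β b d a *_) (acts (Acts-pairUnit i ws) e))
    (solve 4 (λ p x y z → p :* ((x :+ y) :- z) := (p :* x :+ p :* y) :- p :* z) refl
      (β b d a) (ω ws e) (ω (atPair bumpBoth i ws) e) (ω (atPair bumpSecond i ws) e))))) }
    where open +-*-Solver

  ≡-neg⇒≡0 : ∀ {z} → z ≡ - z → z ≡ 0ℤ
  ≡-neg⇒≡0 {pos zero} eq = refl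
  ≡-neg⇒≡0 {pos (suc _)} ()
  ≡-neg⇒≡0 {negsuc _} ()

  pairing-sub : ∀ (p : Poly {n}) f g → pairing p (λ e → f e - g e) ≡ pairing p f - pairing p g
  pairing-sub p f g = trans (pairing-+ p f (λ e → - g e)) (cong (pairing p f +_)
    (trans (pairing-cong p (λ e → sym (ℤ.-1*i≡-i (g e))))
    (trans (pairing-* p (- 1ℤ) g) (ℤ.-1*i≡-i (pairing p g)))))

  -- Multiplying by 1 + xᵢ + xᵢxᵢ₊₁ makes the product antisymmetric in xᵢ and xᵢ₊₁, so its constant
  -- term against weights that agree at these positions vanishes.
  gogCT-pair : ∀ i (ws : Vec Weight (suc n)) → atPair swap i ws ≡ ws →
    (gogCT ws + gogCT (atPair bumpBoth i ws)) - gogCT (atPair bumpSecond i ws) ≡ 0ℤ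
  gogCT-pair {n} i ws sym-ws = trans (sym expand) (≡-neg⇒≡0 anti)
    where
    open ≡-Reasoning
    X = vars (suc n)
    P = gogProd X
    U = pairUnit i X R.* P
    expand : pairing U (ω ws) ≡ (gogCT ws + gogCT (atPair bumpBoth i ws)) - gogCT (atPair bumpSecond i ws)
    expand = trans (Acts⇒pairing (Acts-pairUnit i ws) P)
      (trans (pairing-sub P (λ e → ω ws e + ω (atPair bumpBoth i ws) e) (ω (atPair bumpSecond i ws)))
             (cong (_- gogCT (atPair bumpSecond i ws)) (pairing-+ P (ω ws) (ω (atPair bumpBoth i ws)))))
    swapped : Swap.mapExp i U R.≈ R.- U
    swapped = R.trans (Swap.mapExp-* i (pairUnit i X) P)
      (R.trans (R.*-cong (Swap.mapExp-pairUnit i i X) (Swap.mapExp-gogProd i X))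
      (R.trans (R.reflexive (cong (λ ps → pairUnit i ps R.* gogProd ps) (map-swap-vars i)))
               (gogProd-antisym i X)))
    anti : pairing U (ω ws) ≡ - pairing U (ω ws)
    anti = begin
      pairing U (ω ws)
        ≡⟨ pairing-cong U (λ e → sym (ω-atPair-swap i ws e)) ⟩
      pairing U (λ e → ω (atPair swap i ws) (atPair swap i e))
        ≡⟨ cong (λ ws → pairing U (λ e → ω ws (atPair swap i e))) sym-ws ⟩
      pairing U (λ e → ω ws (atPair swap i e))           ≡⟨ Swap.pairing-mapExp i U (ω ws) ⟨
      pairing (Swap.mapExp i U) (ω ws)                   ≡⟨ pairing-≡ swapped (ω ws) ⟩
      pairing (R.- U) (ω ws)                             ≡⟨ pairing-neg U (ω ws) ⟩
      - pairing U (ω ws) ∎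

-- Summation over interlacing rows and the recursion for the constant term.

module Interlacing where
  open import Relation.Binary.PropositionalEquality using
    (refl; sym; trans; cong; cong₂; subst; module ≡-Reasoning)
  open import Data.Integer using (ℤ; 0ℤ; _+_; _*_; -_; _-_)
  import Data.Integer.Properties as ℤ
  open import Data.Integer.Solver using (module +-*-Solver)
  open import Agda.Builtin.Int using (pos)
  import Data.List as L
  import Data.List.Properties as L
  open import Data.List.Membership.Propositional using (find; lose)
  open import Data.List.Membership.Propositional.Properties using (∈-map⁻; ∈-map⁺; ∈-concatMap⁻; ∈-concatMap⁺)
  open import Data.Vec using (_∷ʳ_; _++_; map; lookup; removeAt; updateAt; toList)
  import Data.Vec.Relation.Unary.All as All
  import Data.Vec.Relation.Unary.All.Properties as All
  open import Function using (_∘_)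
  open PairProducts ℤ.+-*-commutativeRing using (altSum)
  open ConstantTerm
  open Polynomial

  sumOver : ∀ {A : Set} → List A → (A → ℤ) → ℤ
  sumOver L.[] f = 0ℤ
  sumOver (x L.∷ xs) f = f x + sumOver xs f

  sumOver-cong : ∀ {A : Set} (xs : List A) {f g : A → ℤ} → (∀ x → x ∈ xs → f x ≡ g x) →
    sumOver xs f ≡ sumOver xs g
  sumOver-cong L.[] eq = refl
  sumOver-cong (x L.∷ xs) eq = cong₂ _+_ (eq x (Any.here refl))
    (sumOver-cong xs (λ y y∈ → eq y (Any.there y∈)))

  sumOver-++ : ∀ {A : Set} (xs ys : List A) (f : A → ℤ) → sumOver (xs L.++ ys) f ≡ sumOver xs f + sumOver ys f
  sumOver-++ L.[] ys f = sym (ℤ.+-identityˡ _)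
  sumOver-++ (x L.∷ xs) ys f = trans (cong (λ z → f x + z) (sumOver-++ xs ys f)) (sym (ℤ.+-assoc (f x) _ _))

  sumOver-map : ∀ {A B : Set} (g : A → B) xs (f : B → ℤ) → sumOver (L.map g xs) f ≡ sumOver xs (f ∘ g)
  sumOver-map g L.[] f = refl
  sumOver-map g (x L.∷ xs) f = cong (λ z → f (g x) + z) (sumOver-map g xs f)

  sumOver-concatMap : ∀ {A B : Set} (g : A → List B) xs (f : B → ℤ) →
    sumOver (L.concatMap g xs) f ≡ sumOver xs (λ x → sumOver (g x) f)
  sumOver-concatMap g L.[] f = refl
  sumOver-concatMap g (x L.∷ xs) f = trans (sumOver-++ (g x) _ f)
    (cong (λ z → sumOver (g x) f + z) (sumOver-concatMap g xs f))

  from_count_ : ℕ → ℕ → List ℕ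
  from u count zero = L.[]
  from u count (suc n) = u L.∷ from suc u count n

  -- Rows (l₁ < ⋯ < lₖ) with u ≤ l₁ ≤ v₁ ≤ l₂ ≤ v₂ ≤ ⋯ ≤ lₖ ≤ vₖ.
  rowsAbove : ℕ → Vec ℕ k → List (Vec ℕ k)
  rowsAbove u [] = L.[ [] ]
  rowsAbove u (v ∷ vs) = L.concatMap (λ l → L.map (l ∷_) (rowsAbove (v ⊔ suc l) vs))
    (from u count (suc v ∸ u))

  -- The first comparison is weak because the bound `v ⊔ suc l`, passed on when an entry l = v is
  -- chosen, is `suc v` and may equal the next entry.
  Increasing : ℕ → Vec ℕ k → Set
  Increasing u [] = ⊤
  Increasing u (v ∷ vs) = u ≤ v × Increasing (suc v) vs

  Increasing-≤ : ∀ {u u′} (vs : Vec ℕ k) → u′ ≤ u → Increasing u vs → Increasing u′ vs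
  Increasing-≤ [] _ _ = tt
  Increasing-≤ (v ∷ vs) u′≤u (u≤v , inc) = ℕ.≤-trans u′≤u u≤v , inc

  -- The product of the forward differences in all arguments. The first difference is pushed into B,
  -- so that for a fixed first entry the sum over the other entries has the same form again.
  differences : (Vec ℕ k → ℤ) → Vec ℕ k → ℤ
  differences B [] = B []
  differences B (l ∷ c) = differences (λ r → B (suc l ∷ r) - B (l ∷ r)) c

  differences-cong : {B B′ : Vec ℕ k → ℤ} → (∀ c → B c ≡ B′ c) → ∀ c → differences B c ≡ differences B′ c
  differences-cong eq [] = eq []
  differences-cong eq (l ∷ c) = differences-cong (λ r → cong₂ _-_ (eq (suc l ∷ r)) (eq (l ∷ r))) c

  sucBoth sucSecond : ℕ × ℕ → ℕ × ℕ
  sucBoth (l , l′) = suc l , suc l′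
  sucSecond (l , l′) = l , suc l′

  -- (1 + E E′ - E′) B = 0 whenever two neighbouring arguments agree, E and E′ being the shifts in them.
  PairCondition : (Vec ℕ k → ℤ) → Set
  PairCondition {zero} B = ⊤
  PairCondition {suc k} B = ∀ (i : Fin k) c → atPair swap i c ≡ c →
    (B c + B (atPair sucBoth i c)) - B (atPair sucSecond i c) ≡ 0ℤ

  PairCondition-tail : (B : Vec ℕ (suc k) → ℤ) → PairCondition B → ∀ l → PairCondition (λ c → B (l ∷ c))
  PairCondition-tail {zero} B cond l = tt
  PairCondition-tail {suc k} B cond l i c eq = cond (suc i) (l ∷ c) (cong (l ∷_) eq)

  PairCondition-- : (B B′ : Vec ℕ k → ℤ) → PairCondition B → PairCondition B′ →
    PairCondition (λ c → B c - B′ c)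
  PairCondition-- {zero} B B′ _ _ = tt
  PairCondition-- {suc k} B B′ cond cond′ i c eq = trans
    (solve 6 (λ x y z x′ y′ z′ → ((x :- x′) :+ (y :- y′)) :- (z :- z′) := ((x :+ y) :- z) :-
      ((x′ :+ y′) :- z′)) refl
       (B c) (B (atPair sucBoth i c)) (B (atPair sucSecond i c)) (B′ c) (B′ (atPair sucBoth i c))
         (B′ (atPair sucSecond i c)))
    (cong₂ _-_ (cond i c eq) (cond′ i c eq))
    where open +-*-Solver

  altSum-zero : ∀ (f : Fin n → ℤ) → (∀ i → f i ≡ 0ℤ) → altSum f ≡ 0ℤ
  altSum-zero {zero} f eq = refl
  altSum-zero {suc n} f eq = cong₂ _-_ (eq zero) (altSum-zero (λ i → f (suc i)) (λ i → eq (suc i)))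

  altSum-- : ∀ (f g : Fin n → ℤ) → altSum (λ i → f i - g i) ≡ altSum f - altSum g
  altSum-- {zero} f g = refl
  altSum-- {suc n} f g = trans
    (cong (λ z → (f zero - g zero) - z) (altSum-- (λ i → f (suc i)) (λ i → g (suc i))))
    (solve 4 (λ a b c d → (a :- b) :- (c :- d) := (a :- c) :- (b :- d)) refl (f zero) (g zero)
      (altSum (λ i → f (suc i))) (altSum (λ i → g (suc i))))
    where open +-*-Solver

  altSum-+ : ∀ (f g : Fin n → ℤ) → altSum (λ i → f i + g i) ≡ altSum f + altSum g
  altSum-+ {zero} f g = refl
  altSum-+ {suc n} f g = trans
    (cong (λ z → (f zero + g zero) - z) (altSum-+ (λ i → f (suc i)) (λ i → g (suc i))))
    (solve 4 (λ a b c d → (a :+ b) :- (c :+ d) := (a :- c) :+ (b :- d)) refl (f zero) (g zero)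
      (altSum (λ i → f (suc i))) (altSum (λ i → g (suc i))))
    where open +-*-Solver

  omit : Fin (suc k) → Vec ℕ (suc k) → Vec ℕ k
  omit i vs = mapFrom suc i (removeAt vs i)

  -- The value that the induction assigns to the sum over the entries after the first: `l` is the
  -- first argument of B, not yet differenced, and `w` is the lower bound for the next entry.
  omitAfter : (Vec ℕ (suc k) → ℤ) → Vec ℕ k → ℕ → ℕ → ℤ
  omitAfter B vs l w = altSum (λ i → B (l ∷ omit i (w ∷ vs)))

  -- In the term that omits w the three summands reduce to B at `suc v ∷ map suc vs`, as w no longer
  -- occurs there. In every other term l and w are the first two arguments, with values (v, v), (v +
  -- 1, v + 1) and (v, v + 1), so the pair condition makes it vanish.
  omitAfter-corner : ∀ (B : Vec ℕ (suc k) → ℤ) → PairCondition B → ∀ v vs →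
    (omitAfter B vs v v + omitAfter B vs (suc v) (suc v)) - omitAfter B vs v (suc v) ≡ B (suc v ∷ map suc vs)
  omitAfter-corner B cond v [] =
    solve 2 (λ x y → ((x :- con 0ℤ) :+ (y :- con 0ℤ)) :- (x :- con 0ℤ) := y) refl (B (v ∷ []))
      (B (suc v ∷ []))
    where open +-*-Solver
  omitAfter-corner B cond v vs@(_ ∷ _) = trans
    (solve 5 (λ x y p q r → ((x :- p) :+ (y :- q)) :- (x :- r) := y :- ((p :+ q) :- r)) refl
      (B (v ∷ map suc vs)) (B (suc v ∷ map suc vs)) (altSum f) (altSum g) (altSum h))
    (trans (cong (λ z → B (suc v ∷ map suc vs) - z)
        (trans (sym (trans (altSum-- (λ i → f i + g i) h) (cong (_- altSum h) (altSum-+ f g))))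
               (altSum-zero (λ i → (f i + g i) - h i) (λ i → cond zero (v ∷ v ∷ omit i vs) refl))))
      (ℤ.+-identityʳ _))
    where
    open +-*-Solver
    f g h : Fin _ → ℤ
    f i = B (v ∷ v ∷ omit i vs)
    g i = B (suc v ∷ suc v ∷ omit i vs)
    h i = B (v ∷ suc v ∷ omit i vs)

  module _ {k} (B : Vec ℕ (suc k) → ℤ) (v : ℕ) (vs : Vec ℕ k) where
    private
      C : ℕ → ℕ → ℤ
      C = omitAfter B vs

    -- For l < v the bound `v ⊔ suc l` is constantly v and the sum telescopes. Strictness shows only
    -- at l = v, where the bound jumps to v + 1; this last term stays apart.
    telescope : ∀ d u → u ℕ.+ d ≡ v →
      sumOver (from u count (suc d)) (λ l → C (suc l) (v ⊔ suc l) - C l (v ⊔ suc l))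
        ≡ (C v v - C u v) + (C (suc v) (suc v) - C v (suc v))
    telescope zero u eq with trans (sym (ℕ.+-identityʳ u)) eq
    ... | refl rewrite ℕ.m≤n⇒m⊔n≡n (ℕ.n≤1+n v) =
      solve 3 (λ x y z → (x :- y) :+ con 0ℤ := (z :- z) :+ (x :- y)) refl (C (suc v) (suc v)) (C v (suc v))
        (C v v)
      where open +-*-Solver
    telescope (suc d) u eq rewrite ℕ.m≥n⇒m⊔n≡m
      (ℕ.≤-trans (ℕ.m≤m+n (suc u) d) (ℕ.≤-reflexive (trans (sym (ℕ.+-suc u d)) eq))) =
      trans (cong (λ z → (C (suc u) v - C u v) + z) (telescope d (suc u) (trans (sym (ℕ.+-suc u d)) eq)))
      (solve 4 (λ x y z w → (x :- y) :+ ((z :- x) :+ w) := (z :- y) :+ w) refl (C (suc u) v) (C u v) (C v v)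
        (C (suc v) (suc v) - C v (suc v)))
      where open +-*-Solver

  ∈-from⇒≤ : ∀ u n {l} → l ∈ from u count n → u ≤ l
  ∈-from⇒≤ u (suc n) (Any.here refl) = ℕ.≤-refl
  ∈-from⇒≤ u (suc n) (Any.there l∈) = ℕ.<⇒≤ (∈-from⇒≤ (suc u) n l∈)

  ∈-from⇒< : ∀ u n {l} → l ∈ from u count n → l < u ℕ.+ n
  ∈-from⇒< u (suc n) (Any.here refl) = ℕ.m<m+n u (s≤s z≤n)
  ∈-from⇒< u (suc n) (Any.there l∈) rewrite ℕ.+-suc u n = ∈-from⇒< (suc u) n l∈

  ∈-from⁺ : ∀ u n {l} → u ≤ l → l < u ℕ.+ n → l ∈ from u count n
  ∈-from⁺ u zero u≤l l< rewrite ℕ.+-identityʳ u with () ← ℕ.<⇒≱ l< u≤l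
  ∈-from⁺ u (suc n) {l} u≤l l< with u ℕ.≟ l
  ... | Relation.Nullary.yes refl = Any.here refl
  ... | Relation.Nullary.no u≢l =
    Any.there (∈-from⁺ (suc u) n (ℕ.≤∧≢⇒< u≤l u≢l) (subst (l <_) (ℕ.+-suc u n) l<))

  -- Summing the differences telescopes; the strictness of the rows only costs the terms that
  -- the pair condition cancels.
  sum-rowsAbove : (B : Vec ℕ k → ℤ) → PairCondition B → ∀ u vs → Increasing u vs →
    sumOver (rowsAbove u vs) (differences B) ≡ altSum (λ i → B (omit i (u ∷ vs)))
  sum-rowsAbove B cond u [] _ = refl
  sum-rowsAbove B cond u (v ∷ vs) (u≤v , inc) = begin
    sumOver (rowsAbove u (v ∷ vs)) (differences B)
      ≡⟨ sumOver-concatMap (λ l → L.map (l ∷_) (rowsAbove (v ⊔ suc l) vs)) (from u count (suc v ∸ u))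
        (differences B) ⟩
    sumOver (from u count (suc v ∸ u))
      (λ l → sumOver (L.map (l ∷_) (rowsAbove (v ⊔ suc l) vs)) (differences B))
      ≡⟨ sumOver-cong (from u count (suc v ∸ u)) inner ⟩
    sumOver (from u count (suc v ∸ u)) (λ l → C (suc l) (v ⊔ suc l) - C l (v ⊔ suc l))
      ≡⟨ cong (λ n → sumOver (from u count n) (λ l → C (suc l) (v ⊔ suc l) - C l (v ⊔ suc l)))
        (ℕ.+-∸-assoc 1 u≤v) ⟩
    sumOver (from u count (suc (v ∸ u))) (λ l → C (suc l) (v ⊔ suc l) - C l (v ⊔ suc l))
      ≡⟨ telescope B v vs (v ∸ u) u (ℕ.m+[n∸m]≡n u≤v) ⟩
    (C v v - C u v) + (C (suc v) (suc v) - C v (suc v))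
      ≡⟨ solve 4 (λ x y z w → (x :- y) :+ (z :- w) := ((x :+ z) :- w) :- y) refl (C v v) (C u v)
        (C (suc v) (suc v)) (C v (suc v)) ⟩
    ((C v v + C (suc v) (suc v)) - C v (suc v)) - C u v
      ≡⟨ cong (_- C u v) (omitAfter-corner B cond v vs) ⟩
    B (suc v ∷ map suc vs) - C u v ∎
    where
    open ≡-Reasoning
    open +-*-Solver
    C = omitAfter B vs
    inner : ∀ l → l ∈ from u count (suc v ∸ u) →
      sumOver (L.map (l ∷_) (rowsAbove (v ⊔ suc l) vs)) (differences B) ≡ C (suc l) (v ⊔ suc l) - C l
        (v ⊔ suc l)
    inner l l∈ = trans (sumOver-map (l ∷_) (rowsAbove (v ⊔ suc l) vs) (differences B))
      (trans (sum-rowsAbove (λ r → B (suc l ∷ r) - B (l ∷ r))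
                (PairCondition-- (λ r → B (suc l ∷ r)) (λ r → B (l ∷ r)) (PairCondition-tail B cond (suc l))
                  (PairCondition-tail B cond l))
                (v ⊔ suc l) vs (Increasing-≤ vs (ℕ.⊔-lub (ℕ.n≤1+n v) l<) inc))
             (altSum-- (λ i → B (suc l ∷ omit i ((v ⊔ suc l) ∷ vs)))
               (λ i → B (l ∷ omit i ((v ⊔ suc l) ∷ vs)))))
      where
      l< : l < suc v
      l< = subst (l <_) (ℕ.m+[n∸m]≡n (ℕ.m≤n⇒m≤1+n u≤v)) (∈-from⇒< u (suc v ∸ u) l∈)

  topUp : Weight → Weight
  topUp w = bump (deepen w)

  -- (1 + x)^(b + 1) x^(-d - 1) - (1 + x)^b x^(-d - 1) = (1 + x)^b x^(-d): a difference in b lowers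
  -- the depth by one.
  ω-difference : ∀ i (r : Vec Weight k) (ws : Vec Weight t) e →
    ω (updateAt r i topUp ++ ws) e - ω (updateAt r i deepen ++ ws) e ≡ ω (r ++ ws) e
  ω-difference zero ((b , d) ∷ r) ws (a ∷ e) rewrite β-suc-suc b d a =
    solve 3 (λ p q r → (p :+ q) :* r :- p :* r := q :* r) refl (β b (suc d) a) (β b d a) (ω (r ++ ws) e)
    where open +-*-Solver
  ω-difference (suc i) ((b , d) ∷ r) ws (a ∷ e) = trans
    (solve 3 (λ p q r → p :* q :- p :* r := p :* (q :- r)) refl (β b d a) (ω (updateAt r i topUp ++ ws) e)
      (ω (updateAt r i deepen ++ ws) e))
    (cong (λ z → β b d a * z) (ω-difference i r ws e))
    where open +-*-Solver

  gogCT-difference : ∀ i (r : Vec Weight k) (ws : Vec Weight t) →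
    gogCT (updateAt r i topUp ++ ws) - gogCT (updateAt r i deepen ++ ws) ≡ gogCT (r ++ ws)
  gogCT-difference {k} {t} i r ws = trans
    (sym (pairing-sub P (ω (updateAt r i topUp ++ ws)) (ω (updateAt r i deepen ++ ws))))
    (pairing-cong P (ω-difference i r ws))
    where P = Products.gogProd (vars (k ℕ.+ t))

  differences-weights : ∀ N (G : Vec Weight k → ℤ) →
    (∀ i r → G (updateAt r i topUp) - G (updateAt r i deepen) ≡ G r) →
    ∀ c → differences (λ ls → G (map (_, suc N) ls)) c ≡ G (map (_, N) c)
  differences-weights N G diff [] = refl
  differences-weights N G diff (l ∷ c) = trans
    (differences-cong (λ r → diff zero ((l , N) ∷ map (_, suc N) r)) c)
    (differences-weights N (λ r → G ((l , N) ∷ r)) (λ i r → diff (suc i) ((l , N) ∷ r)) c)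

  map-atPair : ∀ {A B : Set} (f : A → B) g h →
    (∀ p → (f (proj₁ (g p)) , f (proj₂ (g p))) ≡ h (f (proj₁ p) , f (proj₂ p))) →
    ∀ (i : Fin n) xs → map f (atPair g i xs) ≡ atPair h i (map f xs)
  map-atPair f g h eq zero (x ∷ y ∷ xs) = cong₂ (λ a b → a ∷ b ∷ map f xs) (cong proj₁ (eq (x , y)))
    (cong proj₂ (eq (x , y)))
  map-atPair f g h eq (suc i) (x ∷ xs) = cong (f x ∷_) (map-atPair f g h eq i xs)

  atPair-++ : ∀ {A : Set} (g : A × A → A × A) (i : Fin n) (xs : Vec A (suc n)) (ys : Vec A t) →
    atPair g (i ↑ˡ t) (xs ++ ys) ≡ atPair g i xs ++ ys
  atPair-++ g zero (x ∷ y ∷ xs) ys = refl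
  atPair-++ g (suc i) (x ∷ xs) ys = cong (x ∷_) (atPair-++ g i xs ys)

  PairCondition-gogCT : ∀ k N (ws : Vec Weight t) → PairCondition {k} (λ ls → gogCT (map (_, N) ls ++ ws))
  PairCondition-gogCT zero N ws = tt
  PairCondition-gogCT {t} (suc k) N ws i c eq = trans
    (cong₂ (λ x y → (gogCT v + gogCT x) - gogCT y) (shift sucBoth bumpBoth (λ _ → refl))
      (shift sucSecond bumpSecond (λ _ → refl)))
    (gogCT-pair (i ↑ˡ t) v (trans (sym (shift swap swap (λ _ → refl))) (cong (λ c → map (_, N) c ++ ws) eq)))
    where
    v = map (_, N) c ++ ws
    shift : ∀ g h → (∀ p → ((proj₁ (g p) , N) , (proj₂ (g p) , N)) ≡ h ((proj₁ p , N) , (proj₂ p , N))) →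
      map (_, N) (atPair g i c) ++ ws ≡ atPair h (i ↑ˡ t) v
    shift g h eq = trans (cong (_++ ws) (map-atPair (_, N) g h eq i c))
      (sym (atPair-++ h i (map (_, N) c) ws))

  -- The factor δ keeps only the positions of depth N, which are those of `ls`. All of `ws` stands
  -- after the omitted position, hence is bumped as a whole in every surviving term.
  altSum-top : ∀ N (ls : Vec ℕ (suc k)) (ws : Vec Weight t) → (∀ i → proj₂ (lookup ws i) < N) →
    (G : Vec Weight (k ℕ.+ t) → ℤ) →
    altSum (λ i → δ (proj₂ (lookup (map (_, N) ls ++ ws) i)) N * G
      (mapFrom bump i (removeAt (map (_, N) ls ++ ws) i)))
      ≡ altSum (λ i → G (map (_, N) (omit i ls) ++ map bump ws))
  altSum-top N (l ∷ []) ws d<N G = cong₂ _-_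
    (trans (cong (_* G (map bump ws)) (δ-≡ N)) (ℤ.*-identityˡ _))
    (altSum-zero (λ i → δ (proj₂ (lookup ws i)) N * G
      (mapFrom bump (suc i) (removeAt ((l , N) ∷ ws) (suc i))))
      (λ i → trans (cong (_* G (mapFrom bump (suc i) (removeAt ((l , N) ∷ ws) (suc i)))) (δ-< (d<N i)))
        (ℤ.*-zeroˡ (G (mapFrom bump (suc i) (removeAt ((l , N) ∷ ws) (suc i)))))))
  altSum-top N (l ∷ ls@(_ ∷ _)) ws d<N G = cong₂ _-_
    (trans (cong₂ _*_ (δ-≡ N) (cong G (trans (Vec.map-++ bump (map (_, N) ls) ws)
             (cong (_++ map bump ws) (trans (sym (Vec.map-∘ bump (_, N) ls)) (Vec.map-∘ (_, N) suc ls))))))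
           (ℤ.*-identityˡ _))
    (altSum-top N ls ws d<N (λ r → G ((l , N) ∷ r)))

  -- The weights of the last t = n - k variables: the exponents i - k - n for i = k + 1, ..., n are
  -- depths that fall from n - 1 to k.
  staircase : ℕ → ℕ → ∀ t → Vec Weight t
  staircase M k zero = []
  staircase M k (suc t) = (M , t ℕ.+ k) ∷ staircase M k t

  staircase-< : ∀ M k t (i : Fin t) → proj₂ (lookup (staircase M k t) i) < k ℕ.+ t
  staircase-< M k (suc t) zero rewrite ℕ.+-comm t k | ℕ.+-suc k t = ℕ.≤-refl
  staircase-< M k (suc t) (suc i) rewrite ℕ.+-suc k t = ℕ.m<n⇒m<1+n (staircase-< M k t i)

  map-bump-staircase : ∀ M k t → map bump (staircase M k t) ≡ staircase (suc M) k t
  map-bump-staircase M k zero = refl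
  map-bump-staircase M k (suc t) = cong ((suc M , t ℕ.+ k) ∷_) (map-bump-staircase M k t)

  above : Vec ℕ (suc k) → List (Vec ℕ k)
  above (v ∷ vs) = rowsAbove v vs

  -- The constant term of the theorem for n = k + t and M = m + k + 1.
  trapezoidCT : ∀ (t : ℕ) → Vec ℕ k → ℕ → ℤ
  trapezoidCT {k} t b M = gogCT (map (_, pred (k ℕ.+ t)) b ++ staircase M k t)

  -- One step of the recursion, stated for k + 1 entries of top depth so that it serves both cases:
  -- v = b for t = 0, and v = `b ∷ʳ M` otherwise. M grows to M + 1 because the staircase stands
  -- after whichever entry is omitted.
  gogCT-above : ∀ M t (v : Vec ℕ (suc k)) → Increasing 0 v →
    gogCT (map (_, k ℕ.+ t) v ++ staircase M k t) ≡ sumOver (above v) (λ c → trapezoidCT t c (suc M))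
  gogCT-above {k} M t v@(u ∷ vs) (_ , inc) = begin
    gogCT (map (_, N) v ++ ws)
      ≡⟨ gogCT-expand (map (_, N) v ++ ws) depth ⟩
    altSum (λ i → δ (proj₂ (lookup (map (_, N) v ++ ws) i)) N * gogCT
      (mapFrom bump i (removeAt (map (_, N) v ++ ws) i)))
      ≡⟨ altSum-top N v ws (staircase-< M k t) gogCT ⟩
    altSum (λ i → gogCT (map (_, N) (omit i v) ++ map bump ws))
      ≡⟨ sum-rowsAbove (λ ls → gogCT (map (_, N) ls ++ map bump ws)) (PairCondition-gogCT k N (map bump ws)) u
        vs (Increasing-≤ vs (ℕ.n≤1+n u) inc) ⟨
    sumOver (rowsAbove u vs) (differences (λ ls → gogCT (map (_, N) ls ++ map bump ws)))
      ≡⟨ sumOver-cong (rowsAbove u vs)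
        (λ c _ → trans (diff k c) (cong (λ w → gogCT (map (_, pred N) c ++ w)) (map-bump-staircase M k t))) ⟩
    sumOver (rowsAbove u vs) (λ c → trapezoidCT t c (suc M)) ∎
    where
    open ≡-Reasoning
    N = k ℕ.+ t
    ws = staircase M k t
    diff : ∀ k {w : Vec Weight t} (c : Vec ℕ k) →
      differences (λ ls → gogCT (map (_, k ℕ.+ t) ls ++ w)) c ≡ gogCT (map (_, pred (k ℕ.+ t)) c ++ w)
    diff zero [] = refl
    diff (suc k) {w} c = differences-weights (k ℕ.+ t) (λ r → gogCT (r ++ w)) (λ i r → gogCT-difference i r w)
      c
    depth : ∀ i → proj₂ (lookup (map (_, N) v ++ ws) i) ≤ N
    depth = All.lookup⁺ {P = λ w → proj₂ w ≤ N}
      (All.++⁺ {xs = map (_, N) v} {ys = ws} (All.map⁺ {f = _, N} (All.universal (λ _ → ℕ.≤-refl) v))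
                                 (All.lookup⁻ (λ i → ℕ.<⇒≤ (staircase-< M k t i))))

  gogCT-toList : ∀ {n n′} (v : Vec Weight n) (v′ : Vec Weight n′) → toList v ≡ toList v′ → gogCT v ≡ gogCT v′
  gogCT-toList v v′ eq with trans (sym (Vec.length-toList v))
    (trans (cong L.length eq) (Vec.length-toList v′))
  ... | refl = cong gogCT (trans (sym (Vec.cast-is-id refl v)) (Vec.toList-injective refl v v′ eq))

  -- The first stair has the depth n - 1 of the entries of b, so its M joins them as one more entry.
  -- The comparison goes through lists because the two vectors have lengths that are equal only
  -- propositionally.
  trapezoidCT-suc : ∀ t (b : Vec ℕ k) M →
    trapezoidCT (suc t) b M ≡ gogCT (map (_, k ℕ.+ t) (b ∷ʳ M) ++ staircase M k t)
  trapezoidCT-suc {k} t b M = gogCT-toList (map (_, pred (k ℕ.+ suc t)) b ++ (M , t ℕ.+ k) ∷ ws)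
    (map (_, k ℕ.+ t) (b ∷ʳ M) ++ ws) (begin
    toList (map (_, pred (k ℕ.+ suc t)) b ++ (M , t ℕ.+ k) ∷ ws)
      ≡⟨ cong₂ (λ N N′ → toList (map (_, pred N) b ++ (M , N′) ∷ ws)) (ℕ.+-suc k t) (ℕ.+-comm t k) ⟩
    toList (map (_, N) b ++ (M , N) ∷ ws)
      ≡⟨ Vec.toList-++ (map (_, N) b) ((M , N) ∷ ws) ⟩
    toList (map (_, N) b) L.++ L.[ M , N ] L.++ toList ws
      ≡⟨ L.++-assoc (toList (map (_, N) b)) L.[ M , N ] (toList ws) ⟨
    (toList (map (_, N) b) L.++ L.[ M , N ]) L.++ toList ws
      ≡⟨ cong (L._++ toList ws) (Vec.toList-∷ʳ (M , N) (map (_, N) b)) ⟨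
    toList (map (_, N) b ∷ʳ (M , N)) L.++ toList ws
      ≡⟨ cong (λ v → toList v L.++ toList ws) (Vec.map-∷ʳ (_, N) M b) ⟨
    toList (map (_, N) (b ∷ʳ M)) L.++ toList ws
      ≡⟨ Vec.toList-++ (map (_, N) (b ∷ʳ M)) ws ⟨
    toList (map (_, N) (b ∷ʳ M) ++ ws) ∎)
    where
    open ≡-Reasoning
    N = k ℕ.+ t
    ws = staircase M k t

  Interlaces : ℕ → Vec ℕ k → Vec ℕ k → Set
  Interlaces u [] [] = ⊤
  Interlaces u (v ∷ vs) (l ∷ c) = u ≤ l × l ≤ v × Interlaces (v ⊔ suc l) vs c

  ∈-rowsAbove⁻ : ∀ u (vs : Vec ℕ k) {c} → c ∈ rowsAbove u vs → Interlaces u vs c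
  ∈-rowsAbove⁻ u [] {[]} _ = tt
  ∈-rowsAbove⁻ u (v ∷ vs) c∈ with find (∈-concatMap⁻ (λ l → L.map (l ∷_) (rowsAbove (v ⊔ suc l) vs))
    {xs = from u count (suc v ∸ u)} c∈)
  ... | l , l∈ , c∈l with ∈-map⁻ (l ∷_) c∈l
  ... | c′ , c′∈ , refl = u≤l , ℕ.s≤s⁻¹ (bound (ℕ.≤-total u (suc v))) , ∈-rowsAbove⁻ (v ⊔ suc l) vs c′∈
    where
    u≤l = ∈-from⇒≤ u (suc v ∸ u) l∈
    l< = ∈-from⇒< u (suc v ∸ u) l∈
    bound : u ≤ suc v ⊎ suc v ≤ u → l < suc v
    bound (inj₁ u≤) = subst (l <_) (ℕ.m+[n∸m]≡n u≤) l<
    bound (inj₂ ≤u) with () ← ℕ.<⇒≱ (subst (l <_) (trans (cong (u ℕ.+_) (ℕ.m≤n⇒m∸n≡0 ≤u)) (ℕ.+-identityʳ u))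
      l<) u≤l

  ∈-rowsAbove⁺ : ∀ u (vs : Vec ℕ k) c → Interlaces u vs c → c ∈ rowsAbove u vs
  ∈-rowsAbove⁺ u [] [] _ = Any.here refl
  ∈-rowsAbove⁺ u (v ∷ vs) (l ∷ c) (u≤l , l≤v , inter) =
    ∈-concatMap⁺ (λ l → L.map (l ∷_) (rowsAbove (v ⊔ suc l) vs))
    (lose (∈-from⁺ u (suc v ∸ u) u≤l (subst (l <_) (sym (ℕ.m+[n∸m]≡n (ℕ.m≤n⇒m≤1+n (ℕ.≤-trans u≤l l≤v))))
      (s≤s l≤v)))
          (∈-map⁺ (l ∷_) (∈-rowsAbove⁺ (v ⊔ suc l) vs c inter)))

  Interlaces⇒Increasing : ∀ u (vs c : Vec ℕ k) {M} → Increasing u (vs ∷ʳ M) → Interlaces u vs c →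
    Increasing u (c ∷ʳ M)
  Interlaces⇒Increasing u [] [] inc _ = inc
  Interlaces⇒Increasing u (v ∷ vs) (l ∷ c) {M} (u≤v , inc) (u≤l , l≤v , inter) =
    u≤l , Increasing-≤ (c ∷ʳ M) (ℕ.m≤n⊔m v (suc l)) (Interlaces⇒Increasing (v ⊔ suc l) vs c
      (Increasing-≤ (vs ∷ʳ M) (ℕ.⊔-lub (ℕ.n≤1+n v) (s≤s l≤v)) inc) inter)

  above-Increasing : ∀ {u M} (v : Vec ℕ (suc k)) → Increasing u (v ∷ʳ M) → ∀ {c} → c ∈ above v →
    Increasing u (c ∷ʳ M)
  above-Increasing {M = M} (v ∷ vs) (u≤v , inc) {c} c∈ = Increasing-≤ (c ∷ʳ M) u≤v
    (Interlaces⇒Increasing v vs c (Increasing-≤ (vs ∷ʳ M) (ℕ.n≤1+n v) inc) (∈-rowsAbove⁻ v vs c∈))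

  Increasing-init : ∀ {u M} (v : Vec ℕ k) → Increasing u (v ∷ʳ M) → Increasing u v
  Increasing-init [] _ = tt
  Increasing-init (v ∷ vs) (u≤v , inc) = u≤v , Increasing-init vs inc

  Increasing-∷ʳ-suc : ∀ {u M} (v : Vec ℕ k) → Increasing u (v ∷ʳ M) → Increasing u ((v ∷ʳ M) ∷ʳ suc M)
  Increasing-∷ʳ-suc [] (u≤M , _) = u≤M , ℕ.≤-refl , tt
  Increasing-∷ʳ-suc (v ∷ vs) (u≤v , inc) = u≤v , Increasing-∷ʳ-suc vs inc

  Array : Set
  Array = List (List ℕ)

  -- Built from the bottom row upwards, along the recursion of the constant term. While t > 0 all
  -- rows have k entries and M acts as an entry after the last; from t = 0 on, every row above is
  -- shorter by one.
  trapezoids : ∀ (t : ℕ) {k} → Vec ℕ k → ℕ → List Array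
  trapezoids zero {zero} b M = L.[ L.[] ]
  trapezoids zero {suc k} b M = L.concatMap (λ c → L.map (L._∷ʳ toList b) (trapezoids zero c M)) (above b)
  trapezoids (suc t) b M = L.concatMap (λ c → L.map (L._∷ʳ toList b) (trapezoids t c (suc M)))
    (above (b ∷ʳ M))

  length-concatMap : ∀ {A B C : Set} (f : A → List B) (g : B → C) xs →
    pos (length (L.concatMap (λ x → L.map g (f x)) xs)) ≡ sumOver xs (λ x → pos (length (f x)))
  length-concatMap f g L.[] = refl
  length-concatMap f g (x L.∷ xs) = trans (cong pos (L.length-++ (L.map g (f x))))
    (trans (ℤ.pos-+ _ (length (L.concatMap (λ x → L.map g (f x)) xs)))
           (cong₂ _+_ (cong pos (L.length-map g (f x))) (length-concatMap f g xs)))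

  length-trapezoids : ∀ (t : ℕ) {k} (b : Vec ℕ k) M → Increasing 0 (b ∷ʳ M) → pos (length (trapezoids t b M))
    ≡ trapezoidCT t b M
  length-trapezoids zero {zero} [] M inc = refl
  length-trapezoids zero {suc k} b M inc = begin
    pos (length (trapezoids zero b M))
      ≡⟨ length-concatMap (λ c → trapezoids zero c M) (L._∷ʳ toList b) (above b) ⟩
    sumOver (above b) (λ c → pos (length (trapezoids zero c M)))
      ≡⟨ sumOver-cong (above b) (λ c c∈ → length-trapezoids zero c M (above-Increasing b inc c∈)) ⟩
    sumOver (above b) (λ c → trapezoidCT zero c M)
      ≡⟨ gogCT-above M zero b (Increasing-init b inc) ⟨
    trapezoidCT zero b M ∎
    where open ≡-Reasoning
  length-trapezoids (suc t) {k} b M inc = begin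
    pos (length (trapezoids (suc t) b M))
      ≡⟨ length-concatMap (λ c → trapezoids t c (suc M)) (L._∷ʳ toList b) (above (b ∷ʳ M)) ⟩
    sumOver (above (b ∷ʳ M)) (λ c → pos (length (trapezoids t c (suc M))))
      ≡⟨ sumOver-cong (above (b ∷ʳ M))
        (λ c c∈ → length-trapezoids t c (suc M) (above-Increasing (b ∷ʳ M) (Increasing-∷ʳ-suc b inc) c∈)) ⟩
    sumOver (above (b ∷ʳ M)) (λ c → trapezoidCT t c (suc M))
      ≡⟨ gogCT-above M t (b ∷ʳ M) inc ⟨
    gogCT (map (_, k ℕ.+ t) (b ∷ʳ M) ++ staircase M k t)
      ≡⟨ trapezoidCT-suc t b M ⟨
    trapezoidCT (suc t) b M ∎
    where open ≡-Reasoning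

-- The listed arrays are exactly the Gog trapezoids, each listed once.

module Trapezoids where
  open import Relation.Binary.PropositionalEquality using (refl; sym; trans; cong; subst)
  open import Defs using (idx; rowAt; IsGog)
  open import Data.Nat using (_+_)
  import Data.List as L
  import Data.List.Properties as L
  open import Data.List.Membership.Propositional using (find; lose)
  open import Data.List.Membership.Propositional.Properties using (∈-map⁻; ∈-map⁺; ∈-concatMap⁻; ∈-concatMap⁺)
  import Data.List.Relation.Unary.Unique.Propositional.Properties as Unique
  import Data.List.Relation.Unary.AllPairs as AllPairs
  import Data.List.Relation.Unary.All as All
  open import Data.Vec using (_∷ʳ_; toList)
  open Interlacing

  concatMap-unique : ∀ {A B : Set} (f : A → List B) → (∀ x → Unique (f x)) →
    (∀ {x y z} → z ∈ f x → z ∈ f y → x ≡ y) → ∀ {xs} → Unique xs → Unique (L.concatMap f xs)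
  concatMap-unique f uf disj AllPairs.[] = AllPairs.[]
  concatMap-unique f uf disj {x L.∷ xs} (x∉ AllPairs.∷ u) = Unique.++⁺ (uf x) (concatMap-unique f uf disj u)
    apart
    where
    apart : ∀ {z} → (z ∈ f x × z ∈ L.concatMap f xs) → ⊥
    apart (z∈ , z∈′) with find (∈-concatMap⁻ f {xs = xs} z∈′)
    ... | y , y∈ , z∈y = All.lookup x∉ y∈ (disj z∈ z∈y)

  from-unique : ∀ u n → Unique (from u count n)
  from-unique u zero = AllPairs.[]
  from-unique u (suc n) = All.tabulate (λ l∈ → ℕ.<⇒≢ (∈-from⇒≤ (suc u) n l∈)) AllPairs.∷ from-unique (suc u) n

  rowsAbove-unique : ∀ u (vs : Vec ℕ k) → Unique (rowsAbove u vs)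
  rowsAbove-unique u [] = All.[] AllPairs.∷ AllPairs.[]
  rowsAbove-unique u (v ∷ vs) = concatMap-unique (λ l → L.map (l ∷_) (rowsAbove (v ⊔ suc l) vs))
    (λ l → Unique.map⁺ Vec.∷-injectiveʳ (rowsAbove-unique (v ⊔ suc l) vs))
    (λ c∈ c∈′ → same (∈-map⁻ (_ ∷_) c∈) (∈-map⁻ (_ ∷_) c∈′))
    (from-unique u (suc v ∸ u))
    where
    same : ∀ {l l′ c} {rs rs′ : List (Vec ℕ _)} → ∃ (λ r → r ∈ rs × c ≡ l ∷ r) →
      ∃ (λ r → r ∈ rs′ × c ≡ l′ ∷ r) → l ≡ l′
    same (_ , _ , refl) (_ , _ , eq) = Vec.∷-injectiveˡ eq

  above-unique : (v : Vec ℕ (suc k)) → Unique (above v)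
  above-unique (v ∷ vs) = rowsAbove-unique v vs

  toList-injective : (b c : Vec ℕ k) → toList b ≡ toList c → b ≡ c
  toList-injective b c eq = trans (sym (Vec.cast-is-id refl b)) (Vec.toList-injective refl b c eq)

  rowAt-∷ʳ-< : ∀ (a : Array) r {i} → i < length a → rowAt i (a L.∷ʳ r) ≡ rowAt i a
  rowAt-∷ʳ-< (_ L.∷ a) r {zero} _ = refl
  rowAt-∷ʳ-< (_ L.∷ a) r {suc i} (s≤s i<) = rowAt-∷ʳ-< a r i<

  rowAt-∷ʳ-≡ : ∀ (a : Array) r → rowAt (length a) (a L.∷ʳ r) ≡ r
  rowAt-∷ʳ-≡ L.[] r = refl
  rowAt-∷ʳ-≡ (_ L.∷ a) r = rowAt-∷ʳ-≡ a r

  HasShape : ∀ n → Vec ℕ k → Array → Set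
  HasShape n b a = length a ≡ n × rowAt (n ∸ 1) a ≡ toList b

  ∷ʳ-HasShape : ∀ {n a} {b : Vec ℕ k} → length a ≡ n → HasShape (suc n) b (a L.∷ʳ toList b)
  ∷ʳ-HasShape {a = a} {b} refl = trans (L.length-++ a) (ℕ.+-comm (length a) 1) , rowAt-∷ʳ-≡ a (toList b)

  ∈-step : ∀ {A : Set} (f : A → List Array) r cs {a} → a ∈ L.concatMap (λ c → L.map (L._∷ʳ r) (f c)) cs →
    ∃ λ c → c ∈ cs × ∃ λ a′ → a′ ∈ f c × a ≡ a′ L.∷ʳ r
  ∈-step f r cs a∈ with find (∈-concatMap⁻ (λ c → L.map (L._∷ʳ r) (f c)) {xs = cs} a∈)
  ... | c , c∈ , a∈c with ∈-map⁻ (L._∷ʳ r) a∈c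
  ... | a′ , a′∈ , eq = c , c∈ , a′ , a′∈ , eq

  trapezoids-shape : ∀ (t : ℕ) {k} (b : Vec ℕ k) M {a} → a ∈ trapezoids t b M → HasShape (k + t) b a
  trapezoids-shape zero {zero} [] M (Any.here refl) = refl , refl
  trapezoids-shape zero {suc k} b M a∈ with ∈-step (λ c → trapezoids zero c M) (toList b) (above b) a∈
  ... | c , _ , a′ , a′∈ , refl = ∷ʳ-HasShape {a = a′} (proj₁ (trapezoids-shape zero c M a′∈))
  trapezoids-shape (suc t) {k} b M a∈ with ∈-step (λ c → trapezoids t c (suc M)) (toList b) (above (b ∷ʳ M))
    a∈
  ... | c , _ , a′ , a′∈ , refl = subst (λ n → HasShape n b (a′ L.∷ʳ toList b)) (sym (ℕ.+-suc k t))
    (∷ʳ-HasShape {a = a′} (proj₁ (trapezoids-shape t c (suc M) a′∈)))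

  -- The row c can be read off as the last row of the array before r is appended, so the blocks that
  -- belong to different c are disjoint.
  step-unique : ∀ {k} (f : Vec ℕ k → List Array) r n → (∀ c → Unique (f c)) →
    (∀ c {a} → a ∈ f c → HasShape n c a) →
    ∀ {cs} → Unique cs → Unique (L.concatMap (λ c → L.map (L._∷ʳ r) (f c)) cs)
  step-unique {k} f r n uf shape = concatMap-unique (λ c → L.map (L._∷ʳ r) (f c))
    (λ c → Unique.map⁺ (L.∷ʳ-injectiveˡ _ _) (uf c))
    (λ {c} {c′} a∈ a∈′ → same c c′ (∈-map⁻ (L._∷ʳ r) a∈) (∈-map⁻ (L._∷ʳ r) a∈′))
    where
    same : ∀ c c′ {a} → ∃ (λ a′ → a′ ∈ f c × a ≡ a′ L.∷ʳ r) → ∃ (λ a′ → a′ ∈ f c′ × a ≡ a′ L.∷ʳ r) → c ≡ c′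
    same c c′ (a′ , a′∈ , eq) (a″ , a″∈ , eq′) with L.∷ʳ-injectiveˡ a′ a″ (trans (sym eq) eq′)
    ... | refl = toList-injective c c′ (trans (sym (proj₂ (shape c a′∈))) (proj₂ (shape c′ a″∈)))

  trapezoids-unique : ∀ (t : ℕ) {k} (b : Vec ℕ k) M → Unique (trapezoids t b M)
  trapezoids-unique zero {zero} b M = All.[] AllPairs.∷ AllPairs.[]
  trapezoids-unique zero {suc k} b M = step-unique (λ c → trapezoids zero c M) (toList b) (k + zero)
    (λ c → trapezoids-unique zero c M) (λ c → trapezoids-shape zero c M) (above-unique b)
  trapezoids-unique (suc t) {k} b M = step-unique (λ c → trapezoids t c (suc M)) (toList b) (k + t)
    (λ c → trapezoids-unique t c (suc M)) (λ c → trapezoids-shape t c (suc M)) (above-unique (b ∷ʳ M))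

  cell : Array → ℕ → ℕ → ℕ
  cell a i j = idx j (rowAt i a)

  -- `IsGog` with rows and columns numbered from 0.
  record IsGog₀ (m n k : ℕ) (a : Array) : Set where
    field
      nrows     : length a ≡ n
      rowlen    : ∀ {i} → i < n → length (rowAt i a) ≡ suc i ⊓ k
      positive  : ∀ {i j} → i < n → j ≤ i → j < k → 1 ≤ cell a i j
      neWeak    : ∀ {i j} → suc i < n → j ≤ i → j < k → cell a (suc i) j ≤ cell a i j
      seWeak    : ∀ {i j} → suc i < n → j ≤ i → suc j < k → cell a i j ≤ cell a (suc i) (suc j)
      rowStrict : ∀ {i j} → i < n → suc j ≤ i → suc j < k → cell a i j < cell a i (suc j)
      bounded   : ∀ {i j} → i < n → j ≤ i → j < k → cell a i j ≤ (m + (n ∸ suc i)) + suc j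

  toIsGog₀ : ∀ {m a} → IsGog m n k a → IsGog₀ m n k a
  toIsGog₀ G = record
    { nrows = nrows
    ; rowlen = λ {i} i<n → rowlen (suc i) (s≤s z≤n) i<n
    ; positive = λ {i} {j} i<n j≤i j<k → positive (suc i) (suc j) (s≤s z≤n) i<n (s≤s z≤n)
      (ℕ.⊓-glb (s≤s j≤i) j<k)
    ; neWeak = λ {i} {j} i<n j≤i j<k → neWeak (suc i) (suc j) (s≤s z≤n) i<n (s≤s z≤n) (ℕ.⊓-glb (s≤s j≤i) j<k)
    ; seWeak = λ {i} {j} i<n j≤i j<k → seWeak (suc i) (suc j) (s≤s z≤n) i<n (s≤s z≤n)
      (ℕ.⊓-glb (s≤s j≤i) (ℕ.<⇒≤ j<k)) j<k
    ; rowStrict = λ {i} {j} i<n j<i j<k → rowStrict (suc i) (suc j) (s≤s z≤n) i<n (s≤s z≤n)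
      (ℕ.⊓-glb (s≤s j<i) j<k)
    ; bounded = λ {i} {j} i<n j≤i j<k → bounded (suc i) (suc j) (s≤s z≤n) i<n (s≤s z≤n)
      (ℕ.⊓-glb (s≤s j≤i) j<k)
    }
    where open IsGog G

  fromIsGog₀ : ∀ {m a} → IsGog₀ m n k a → IsGog m n k a
  fromIsGog₀ {k = k} G = record
    { nrows = nrows
    ; rowlen = λ { (suc i) _ i<n → rowlen i<n }
    ; positive = λ { (suc i) (suc j) _ i<n _ j≤ → positive i<n (≤ˡ i j≤) (≤ʳ i j≤) }
    ; neWeak = λ { (suc i) (suc j) _ i<n _ j≤ → neWeak i<n (≤ˡ i j≤) (≤ʳ i j≤) }
    ; seWeak = λ { (suc i) (suc j) _ i<n _ j≤ j<k → seWeak i<n (≤ˡ i j≤) j<k }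
    ; rowStrict = λ { (suc i) (suc j) _ i<n _ j≤ → rowStrict i<n (≤ˡ i j≤) (≤ʳ i j≤) }
    ; bounded = λ { (suc i) (suc j) _ i<n _ j≤ → bounded i<n (≤ˡ i j≤) (≤ʳ i j≤) }
    }
    where
    open IsGog₀ G
    ≤ˡ : ∀ i {j} → suc j ≤ suc i ⊓ k → j ≤ i
    ≤ˡ i j≤ = ℕ.s≤s⁻¹ (ℕ.≤-trans j≤ (ℕ.m⊓n≤m (suc i) k))
    ≤ʳ : ∀ i {j} → suc j ≤ suc i ⊓ k → suc j ≤ k
    ≤ʳ i j≤ = ℕ.≤-trans j≤ (ℕ.m⊓n≤n (suc i) k)

  record IsRow (m k : ℕ) (r : List ℕ) : Set where
    field
      rowLength   : length r ≡ k
      rowPositive : ∀ {j} → j < k → 1 ≤ idx j r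
      rowIncrease : ∀ {j} → suc j < k → idx j r < idx (suc j) r
      rowBounded  : ∀ {j} → j < k → idx j r ≤ m + suc j

  record Between (n k : ℕ) (p r : List ℕ) : Set where
    field
      weakNE : ∀ {j} → j < n → j < k → idx j r ≤ idx j p
      weakSE : ∀ {j} → j < n → suc j < k → idx j p ≤ idx (suc j) r

  IsGog₀⇒IsRow : ∀ {m a} → k ≤ n → IsGog₀ m n k a → IsRow m k (rowAt (n ∸ 1) a)
  IsGog₀⇒IsRow {a = L.[]} z≤n G = record
    { rowLength = refl ; rowPositive = λ () ; rowIncrease = λ () ; rowBounded = λ () }
  IsGog₀⇒IsRow {n = zero} {a = _ L.∷ _} z≤n G with () ← IsGog₀.nrows G
  IsGog₀⇒IsRow {k} {suc n} {m} k≤n G = record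
    { rowLength = trans (rowlen ℕ.≤-refl) (ℕ.m≥n⇒m⊓n≡n k≤n)
    ; rowPositive = λ j<k → positive ℕ.≤-refl (≤n j<k) j<k
    ; rowIncrease = λ j<k → rowStrict ℕ.≤-refl (≤n j<k) j<k
    ; rowBounded = λ {j} j<k → ℕ.≤-trans (bounded ℕ.≤-refl (≤n j<k) j<k)
        (ℕ.≤-reflexive (cong (_+ suc j) (trans (cong (m +_) (ℕ.n∸n≡0 n)) (ℕ.+-identityʳ m))))
    }
    where
    open IsGog₀ G
    ≤n : ∀ {j} → j < k → j ≤ n
    ≤n j<k = ℕ.s≤s⁻¹ (ℕ.≤-trans j<k k≤n)

  module _ {m n k : ℕ} {a : Array} {r : List ℕ} (k≤n : k ≤ suc n) where
    private
      bound-shift : ∀ {i} → i < n → m + (n ∸ i) ≡ suc m + (n ∸ suc i)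
      bound-shift {i} i<n = trans (cong (m +_) (trans (cong (_∸ i) (sym (ℕ.m+[n∸m]≡n i<n)))
          (trans (cong (_∸ i) (sym (ℕ.+-suc i (n ∸ suc i)))) (ℕ.m+n∸m≡n i (suc (n ∸ suc i))))))
        (ℕ.+-suc m (n ∸ suc i))
      <-⊓ : ∀ {i j} → i < n → j ≤ i → j < k → j < n ⊓ k
      <-⊓ i<n j≤i j<k = ℕ.⊓-glb (ℕ.≤-<-trans j≤i i<n) j<k
      ⊓-⊓ : ∀ {i} → i < n → suc i ⊓ (n ⊓ k) ≡ suc i ⊓ k
      ⊓-⊓ {i} i<n = trans (sym (ℕ.⊓-assoc (suc i) n k)) (cong (_⊓ k) (ℕ.m≤n⇒m⊓n≡m i<n))

    -- SE-diagonals are counted from the bottom row: without that row the s-th becomes the (s -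
    -- 1)-st, and its bound m + s is kept by passing to m + 1. The width `n ⊓ k` accounts for k = n
    -- + 1, where the row above has only n entries.
    IsGog₀-∷ʳ⁺ : IsGog₀ (suc m) n (n ⊓ k) a → IsRow m k r → Between n k (rowAt (n ∸ 1) a) r →
      IsGog₀ m (suc n) k (a L.∷ʳ r)
    IsGog₀-∷ʳ⁺ G R B = record
      { nrows = trans (L.length-++ a) (trans (ℕ.+-comm (length a) 1) (cong suc nrows))
      ; rowlen = λ {i} i< → byRow i< (λ row → length row ≡ suc i ⊓ k)
          (λ i<n → trans (rowlen i<n) (⊓-⊓ i<n))
          (λ { refl → trans rowLength (sym (ℕ.m≥n⇒m⊓n≡n k≤n)) })
      ; positive = λ {i} {j} i< j≤i j<k → byRow i< (λ row → 1 ≤ idx j row)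
          (λ i<n → positive i<n j≤i (<-⊓ i<n j≤i j<k)) (λ _ → rowPositive j<k)
      ; neWeak = λ {i} {j} i< j≤i j<k → byRow₂ i< (λ p q → idx j q ≤ idx j p)
          (λ i<n → neWeak i<n j≤i (<-⊓ (ℕ.<⇒≤ i<n) j≤i j<k))
          (λ eq → weakNE (subst (j <_) eq (s≤s j≤i)) j<k)
      ; seWeak = λ {i} {j} i< j≤i j<k → byRow₂ i< (λ p q → idx j p ≤ idx (suc j) q)
          (λ i<n → seWeak i<n j≤i (<-⊓ i<n (s≤s j≤i) j<k))
          (λ eq → weakSE (subst (j <_) eq (s≤s j≤i)) j<k)
      ; rowStrict = λ {i} {j} i< j<i j<k → byRow i< (λ row → idx j row < idx (suc j) row)
          (λ i<n → rowStrict i<n j<i (<-⊓ i<n j<i j<k)) (λ _ → rowIncrease j<k)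
      ; bounded = λ {i} {j} i< j≤i j<k → byRow i< (λ row → idx j row ≤ (m + (n ∸ i)) + suc j)
          (λ i<n → ℕ.≤-trans (bounded i<n j≤i (<-⊓ i<n j≤i j<k))
            (ℕ.≤-reflexive (cong (_+ suc j) (sym (bound-shift i<n)))))
          (λ { refl → ℕ.≤-trans (rowBounded j<k) (ℕ.+-monoˡ-≤ (suc j) (ℕ.m≤m+n m (n ∸ n))) })
      }
      where
      open IsGog₀ G
      open IsRow R
      open Between B
      byRow : ∀ {i} → i < suc n → (P : List ℕ → Set) → (i < n → P (rowAt i a)) → (i ≡ n → P r) →
        P (rowAt i (a L.∷ʳ r))
      byRow {i} (s≤s i≤n) P old new with ℕ.m≤n⇒m<n∨m≡n i≤n
      ... | inj₁ i<n = subst P (sym (rowAt-∷ʳ-< a r (subst (i <_) (sym nrows) i<n))) (old i<n)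
      ... | inj₂ i≡n = subst P (sym (trans (cong (λ i → rowAt i (a L.∷ʳ r)) (trans i≡n (sym nrows)))
        (rowAt-∷ʳ-≡ a r))) (new i≡n)
      byRow₂ : ∀ {i} → suc i < suc n → (P : List ℕ → List ℕ → Set) →
        (suc i < n → P (rowAt i a) (rowAt (suc i) a)) →
        (suc i ≡ n → P (rowAt (n ∸ 1) a) r) → P (rowAt i (a L.∷ʳ r)) (rowAt (suc i) (a L.∷ʳ r))
      byRow₂ {i} i< P old new = subst (λ p → P p (rowAt (suc i) (a L.∷ʳ r)))
        (sym (rowAt-∷ʳ-< a r (subst (i <_) (sym nrows) (ℕ.s≤s⁻¹ i<))))
        (byRow i< (P (rowAt i a)) old (λ eq → subst (λ i′ → P (rowAt i′ a) r) (cong (_∸ 1) (sym eq))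
          (new eq)))

    IsGog₀-∷ʳ⁻ : IsGog₀ m (suc n) k (a L.∷ʳ r) → IsGog₀ (suc m) n (n ⊓ k) a × IsRow m k r ×
      Between n k (rowAt (n ∸ 1) a) r
    IsGog₀-∷ʳ⁻ G = record
      { nrows = len
      ; rowlen = λ {i} i<n → trans (old i<n (λ row → length row ≡ suc i ⊓ k) (rowlen (ℕ.m<n⇒m<1+n i<n)))
        (sym (⊓-⊓ i<n))
      ; positive = λ {i} {j} i<n j≤i j< → old i<n (λ row → 1 ≤ idx j row)
        (positive (ℕ.m<n⇒m<1+n i<n) j≤i (<k j<))
      ; neWeak = λ {i} {j} i<n j≤i j< → old₂ i<n (λ p q → idx j q ≤ idx j p)
        (neWeak (ℕ.m<n⇒m<1+n i<n) j≤i (<k j<))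
      ; seWeak = λ {i} {j} i<n j≤i j< → old₂ i<n (λ p q → idx j p ≤ idx (suc j) q)
        (seWeak (ℕ.m<n⇒m<1+n i<n) j≤i (<k j<))
      ; rowStrict = λ {i} {j} i<n j<i j< → old i<n (λ row → idx j row < idx (suc j) row)
        (rowStrict (ℕ.m<n⇒m<1+n i<n) j<i (<k j<))
      ; bounded = λ {i} {j} i<n j≤i j< → ℕ.≤-trans
          (old i<n (λ row → idx j row ≤ (m + (n ∸ i)) + suc j) (bounded (ℕ.m<n⇒m<1+n i<n) j≤i (<k j<)))
          (ℕ.≤-reflexive (cong (_+ suc j) (bound-shift i<n)))
      } , new (IsRow m k) (IsGog₀⇒IsRow k≤n G) , record
      { weakNE = λ {j} j<n j<k → last j<n (λ p q → idx j q ≤ idx j p) (neWeak (s≤s (n∸1< j<n)) (≤n∸1 j<n) j<k)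
      ; weakSE = λ {j} j<n j<k → last j<n (λ p q → idx j p ≤ idx (suc j) q)
        (seWeak (s≤s (n∸1< j<n)) (≤n∸1 j<n) j<k)
      }
      where
      open IsGog₀ G
      len : length a ≡ n
      len = ℕ.suc-injective (trans (ℕ.+-comm 1 (length a)) (trans (sym (L.length-++ a)) nrows))
      <k : ∀ {j} → j < n ⊓ k → j < k
      <k j< = ℕ.≤-trans j< (ℕ.m⊓n≤n n k)
      n∸1< : ∀ {j} → j < n → n ∸ 1 < n
      n∸1< (s≤s _) = ℕ.≤-refl
      ≤n∸1 : ∀ {j} → j < n → j ≤ n ∸ 1
      ≤n∸1 (s≤s j≤) = j≤
      old : ∀ {i} → i < n → (P : List ℕ → Set) → P (rowAt i (a L.∷ʳ r)) → P (rowAt i a)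
      old {i} i<n P = subst P (rowAt-∷ʳ-< a r (subst (i <_) (sym len) i<n))
      old₂ : ∀ {i} → suc i < n → (P : List ℕ → List ℕ → Set) → P (rowAt i (a L.∷ʳ r))
        (rowAt (suc i) (a L.∷ʳ r)) →
        P (rowAt i a) (rowAt (suc i) a)
      old₂ {i} i<n P p = old i<n (P (rowAt i a)) (old (ℕ.<⇒≤ i<n) (λ row → P row (rowAt (suc i) (a L.∷ʳ r)))
        p)
      new : (P : List ℕ → Set) → P (rowAt n (a L.∷ʳ r)) → P r
      new P = subst P (trans (cong (λ i → rowAt i (a L.∷ʳ r)) (sym len)) (rowAt-∷ʳ-≡ a r))
      last : ∀ {j} → j < n → (P : List ℕ → List ℕ → Set) →
        P (rowAt (n ∸ 1) (a L.∷ʳ r)) (rowAt (suc (n ∸ 1)) (a L.∷ʳ r)) → P (rowAt (n ∸ 1) a) r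
      last j<n P p = new (P (rowAt (n ∸ 1) a)) (old (n∸1< j<n) (λ row → P row (rowAt n (a L.∷ʳ r)))
        (subst (λ i → P (rowAt (n ∸ 1) (a L.∷ʳ r)) (rowAt i (a L.∷ʳ r)))
          (ℕ.m+[n∸m]≡n (ℕ.≤-trans (s≤s z≤n) j<n)) p))

  idx-≥ : ∀ {u} (b : Vec ℕ k) → Increasing u b → ∀ {j} → j < k → u ≤ idx j (toList b)
  idx-≥ (v ∷ b) (u≤v , inc) {zero} _ = u≤v
  idx-≥ (v ∷ b) (u≤v , inc) {suc j} (s≤s j<k) = ℕ.≤-trans u≤v (ℕ.<⇒≤ (idx-≥ b inc j<k))

  idx-< : ∀ {u} (b : Vec ℕ k) → Increasing u b → ∀ {j} → suc j < k → idx j (toList b) < idx (suc j) (toList b)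
  idx-< (v ∷ b) (u≤v , inc) {zero} (s≤s j<k) = idx-≥ b inc j<k
  idx-< (v ∷ b) (u≤v , inc) {suc j} (s≤s j<k) = idx-< b inc j<k

  Increasing⇒≤ : ∀ {u M} (b : Vec ℕ k) → Increasing u (b ∷ʳ M) → u + k ≤ M
  Increasing⇒≤ {u = u} [] (u≤M , _) = ℕ.≤-trans (ℕ.≤-reflexive (ℕ.+-identityʳ u)) u≤M
  Increasing⇒≤ {suc k} {u} (v ∷ b) (u≤v , inc) = ℕ.≤-trans (ℕ.≤-reflexive (ℕ.+-suc u k))
    (ℕ.≤-trans (s≤s (ℕ.+-monoˡ-≤ k u≤v)) (Increasing⇒≤ b inc))

  -- The entries after position j and the final m + k + 1 must still fit in strictly increasing
  -- order above it. Passing to the tail trades one unit of k for one of m.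
  idx-≤ : ∀ {u} (b : Vec ℕ k) m → Increasing u (b ∷ʳ suc (m + k)) → ∀ {j} → j < k →
    idx j (toList b) ≤ m + suc j
  idx-≤ {suc k} (v ∷ b) m (_ , inc) {zero} _ = ℕ.+-cancelʳ-≤ k v (m + 1)
    (ℕ.≤-trans (ℕ.s≤s⁻¹ (Increasing⇒≤ b inc))
    (ℕ.≤-reflexive (trans (ℕ.+-suc m k) (cong (_+ k) (ℕ.+-comm 1 m)))))
  idx-≤ {suc k} (v ∷ b) m (_ , inc) {suc j} (s≤s j<k) = ℕ.≤-trans
    (idx-≤ b (suc m) (subst (λ M → Increasing (suc v) (b ∷ʳ suc M)) (ℕ.+-suc m k) inc) j<k)
    (ℕ.≤-reflexive (sym (ℕ.+-suc m (suc j))))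

  Increasing⇒IsRow : ∀ m (b : Vec ℕ k) → Increasing 1 (b ∷ʳ suc (m + k)) → IsRow m k (toList b)
  Increasing⇒IsRow m b inc = record
    { rowLength = Vec.length-toList b
    ; rowPositive = idx-≥ b (Increasing-init b inc)
    ; rowIncrease = idx-< b (Increasing-init b inc)
    ; rowBounded = idx-≤ b m inc
    }

  idx-∷ʳ-< : ∀ (b : Vec ℕ k) M {j} → j < k → idx j (toList (b ∷ʳ M)) ≡ idx j (toList b)
  idx-∷ʳ-< (_ ∷ b) M {zero} _ = refl
  idx-∷ʳ-< (_ ∷ b) M {suc j} (s≤s j<k) = idx-∷ʳ-< b M j<k

  idx-∷ʳ-≡ : ∀ (b : Vec ℕ k) M → idx k (toList (b ∷ʳ M)) ≡ M
  idx-∷ʳ-≡ [] M = refl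
  idx-∷ʳ-≡ (_ ∷ b) M = idx-∷ʳ-≡ b M

  Interlaces-lower : ∀ {u w} (vs c : Vec ℕ k) → u ≤ w → Interlaces w vs c → ∀ {j} → j < k →
    idx j (u L.∷ toList vs) ≤ idx j (toList c)
  Interlaces-lower (v ∷ vs) (l ∷ c) u≤w (w≤l , l≤v , inter) {zero} _ = ℕ.≤-trans u≤w w≤l
  Interlaces-lower (v ∷ vs) (l ∷ c) u≤w (w≤l , l≤v , inter) {suc j} (s≤s j<k) =
    Interlaces-lower vs c (ℕ.m≤m⊔n v (suc l)) inter j<k

  Interlaces-upper : ∀ {w} (vs c : Vec ℕ k) → Interlaces w vs c → ∀ {j} → j < k →
    idx j (toList c) ≤ idx j (toList vs)
  Interlaces-upper (v ∷ vs) (l ∷ c) (w≤l , l≤v , inter) {zero} _ = l≤v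
  Interlaces-upper (v ∷ vs) (l ∷ c) (w≤l , l≤v , inter) {suc j} (s≤s j<k) = Interlaces-upper vs c inter j<k

  Interlaces-intro : ∀ {w} (vs c : Vec ℕ k) → (0 < k → w ≤ idx 0 (toList c)) →
    (∀ {j} → suc j < k → idx j (toList vs) ≤ idx (suc j) (toList c)) →
    (∀ {j} → j < k → idx j (toList c) ≤ idx j (toList vs)) →
    (∀ {j} → suc j < k → idx j (toList c) < idx (suc j) (toList c)) → Interlaces w vs c
  Interlaces-intro [] [] _ _ _ _ = tt
  Interlaces-intro (v ∷ vs) (l ∷ c) first lower upper strict = first (s≤s z≤n) , upper (s≤s z≤n) ,
    Interlaces-intro vs c (λ 0<k → ℕ.⊔-lub (lower (s≤s 0<k)) (strict (s≤s 0<k)))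
      (λ j< → lower (s≤s j<)) (λ j< → upper (s≤s j<)) (λ j< → strict (s≤s j<))

  above-lower : ∀ (v : Vec ℕ (suc k)) {c} → c ∈ above v → ∀ {j} → j < k → idx j (toList v) ≤ idx j (toList c)
  above-lower (v ∷ vs) {c} c∈ = Interlaces-lower vs c ℕ.≤-refl (∈-rowsAbove⁻ v vs c∈)

  above-upper : ∀ (v : Vec ℕ (suc k)) {c} → c ∈ above v → ∀ {j} → j < k → idx j (toList c) ≤ idx (suc j)
    (toList v)
  above-upper (v ∷ vs) {c} c∈ = Interlaces-upper vs c (∈-rowsAbove⁻ v vs c∈)

  ∈-above : ∀ (v : Vec ℕ (suc k)) c → (∀ {j} → j < k → idx j (toList v) ≤ idx j (toList c)) →
    (∀ {j} → j < k → idx j (toList c) ≤ idx (suc j) (toList v)) →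
    (∀ {j} → suc j < k → idx j (toList c) < idx (suc j) (toList c)) → c ∈ above v
  ∈-above (v ∷ vs) c lower upper strict =
    ∈-rowsAbove⁺ v vs c (Interlaces-intro vs c (λ 0<k → lower 0<k) lower upper strict)

  -- The equation M = m + k + 1 is an argument because the recursion preserves it in two ways: for t
  -- = 0, m grows while k drops and M stays; for t > 0, m and M grow together.
  trapezoids-sound : ∀ (t : ℕ) {k} m n M (b : Vec ℕ k) → n ≡ k + t → M ≡ suc (m + k) → Increasing 1 (b ∷ʳ M) →
    ∀ {a} → a ∈ trapezoids t b M → IsGog₀ m n k a
  trapezoids-sound zero {zero} m n M b refl refl inc (Any.here refl) = record
    { nrows = refl ; rowlen = λ () ; positive = λ () ; neWeak = λ () ; seWeak = λ () ; rowStrict =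
      λ () ; bounded = λ () }
  trapezoids-sound zero {suc k} m n M b refl refl inc a∈
    with ∈-step (λ c → trapezoids zero c M) (toList b) (above b) a∈
  ... | c , c∈ , a′ , a′∈ , refl = IsGog₀-∷ʳ⁺ (s≤s (ℕ.m≤m+n k 0))
    (subst (λ k′ → IsGog₀ (suc m) (k + 0) k′ a′)
      (sym (trans (cong (_⊓ suc k) (ℕ.+-identityʳ k)) (ℕ.m≤n⇒m⊓n≡m (ℕ.n≤1+n k))))
      (trapezoids-sound zero (suc m) (k + 0) M c refl (cong suc (ℕ.+-suc m k)) (above-Increasing b inc c∈)
        a′∈))
    (Increasing⇒IsRow m b inc)
    (subst (λ p → Between (k + 0) (suc k) p (toList b)) (sym (proj₂ (trapezoids-shape zero c M a′∈))) (record
      { weakNE = λ j<n _ → above-lower b c∈ (subst (_ <_) (ℕ.+-identityʳ k) j<n)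
      ; weakSE = λ j<n _ → above-upper b c∈ (subst (_ <_) (ℕ.+-identityʳ k) j<n)
      }))
  trapezoids-sound (suc t) {k} m n M b n≡ refl inc a∈
    with ∈-step (λ c → trapezoids t c (suc M)) (toList b) (above (b ∷ʳ M)) a∈ | trans n≡ (ℕ.+-suc k t)
  ... | c , c∈ , a′ , a′∈ , refl | refl = IsGog₀-∷ʳ⁺ (ℕ.m≤n⇒m≤1+n (ℕ.m≤m+n k t))
    (subst (λ k′ → IsGog₀ (suc m) (k + t) k′ a′) (sym (ℕ.m≥n⇒m⊓n≡n (ℕ.m≤m+n k t)))
      (trapezoids-sound t (suc m) (k + t) (suc M) c refl refl
        (above-Increasing (b ∷ʳ M) (Increasing-∷ʳ-suc b inc) c∈) a′∈))
    (Increasing⇒IsRow m b inc)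
    (subst (λ p → Between (k + t) k p (toList b)) (sym (proj₂ (trapezoids-shape t c (suc M) a′∈))) (record
      { weakNE = λ {j} _ j<k → subst (_≤ idx j (toList c)) (idx-∷ʳ-< b M j<k) (above-lower (b ∷ʳ M) c∈ j<k)
      ; weakSE = λ {j} _ j<k → subst (idx j (toList c) ≤_) (idx-∷ʳ-< b M j<k)
        (above-upper (b ∷ʳ M) c∈ (ℕ.<⇒≤ j<k))
      }))

  fromLength : ∀ (r : List ℕ) → length r ≡ k → ∃ λ (c : Vec ℕ k) → toList c ≡ r
  fromLength L.[] refl = [] , refl
  fromLength (x L.∷ r) refl with fromLength r refl
  ... | c , eq = x ∷ c , cong (x L.∷_) eq

  unsnoc : ∀ (a : Array) {n} → length a ≡ suc n → ∃ λ a′ → ∃ λ r → a ≡ a′ L.∷ʳ r × length a′ ≡ n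
  unsnoc (r L.∷ L.[]) refl = L.[] , r , refl , refl
  unsnoc (r L.∷ a@(_ L.∷ _)) refl with unsnoc a refl
  ... | a′ , r′ , eq , len = r L.∷ a′ , r′ , cong (r L.∷_) eq , cong suc len

  trapezoids-complete : ∀ (t : ℕ) {k} m n M (b : Vec ℕ k) → n ≡ k + t → M ≡ suc (m + k) →
    Increasing 1 (b ∷ʳ M) →
    ∀ {a} → IsGog₀ m n k a → rowAt (n ∸ 1) a ≡ toList b → a ∈ trapezoids t b M
  trapezoids-complete zero {zero} m n M b refl refl inc {L.[]} G eq = Any.here refl
  trapezoids-complete zero {zero} m n M b refl refl inc {_ L.∷ _} G eq with () ← IsGog₀.nrows G
  trapezoids-complete zero {suc k} m n M b refl refl inc {a} G eq with unsnoc a (IsGog₀.nrows G)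
  ... | a′ , r , refl , len with trans (sym (rowAt-∷ʳ-≡ a′ r))
    (trans (cong (λ i → rowAt i (a′ L.∷ʳ r)) len) eq)
  ... | refl with IsGog₀-∷ʳ⁻ (s≤s (ℕ.m≤m+n k 0)) G
  ... | G′ , R , B = ∈-concatMap⁺ (λ c → L.map (L._∷ʳ toList b) (trapezoids zero c M))
    (lose c∈ (∈-map⁺ (L._∷ʳ toList b)
      (trapezoids-complete zero (suc m) (k + 0) M c refl (cong suc (ℕ.+-suc m k)) (above-Increasing b inc c∈)
        G″ (sym c≡))))
    where
    G″ = subst (λ k′ → IsGog₀ (suc m) (k + 0) k′ a′)
      (trans (cong (_⊓ suc k) (ℕ.+-identityʳ k)) (ℕ.m≤n⇒m⊓n≡m (ℕ.n≤1+n k))) G′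
    R′ = IsGog₀⇒IsRow (ℕ.m≤m+n k 0) G″
    open Between B
    p = fromLength (rowAt (k + 0 ∸ 1) a′) (IsRow.rowLength R′)
    c = proj₁ p
    c≡ = proj₂ p
    <n : ∀ {j} → j < k → j < k + 0
    <n = subst (_ <_) (sym (ℕ.+-identityʳ k))
    c∈ : c ∈ above b
    c∈ = ∈-above b c
      (λ {j} j<k → subst (λ p → idx j (toList b) ≤ idx j p) (sym c≡) (weakNE (<n j<k) (ℕ.m<n⇒m<1+n j<k)))
      (λ {j} j<k → subst (λ p → idx j p ≤ idx (suc j) (toList b)) (sym c≡) (weakSE (<n j<k) (s≤s j<k)))
      (λ {j} j<k → subst (λ p → idx j p < idx (suc j) p) (sym c≡) (IsRow.rowIncrease R′ j<k))
  trapezoids-complete (suc t) {k} m n M b n≡ refl inc {a} G eq with trans n≡ (ℕ.+-suc k t)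
  ... | refl with unsnoc a (IsGog₀.nrows G)
  ... | a′ , r , refl , len with trans (sym (rowAt-∷ʳ-≡ a′ r))
    (trans (cong (λ i → rowAt i (a′ L.∷ʳ r)) len) eq)
  ... | refl with IsGog₀-∷ʳ⁻ (ℕ.m≤n⇒m≤1+n (ℕ.m≤m+n k t)) G
  ... | G′ , R , B = ∈-concatMap⁺ (λ c → L.map (L._∷ʳ toList b) (trapezoids t c (suc M)))
    (lose c∈ (∈-map⁺ (L._∷ʳ toList b)
      (trapezoids-complete t (suc m) (k + t) (suc M) c refl refl
        (above-Increasing (b ∷ʳ M) (Increasing-∷ʳ-suc b inc) c∈) G″ (sym c≡))))
    where
    G″ = subst (λ k′ → IsGog₀ (suc m) (k + t) k′ a′) (ℕ.m≥n⇒m⊓n≡n (ℕ.m≤m+n k t)) G′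
    R′ = IsGog₀⇒IsRow (ℕ.m≤m+n k t) G″
    open Between B
    p = fromLength (rowAt (k + t ∸ 1) a′) (IsRow.rowLength R′)
    c = proj₁ p
    c≡ = proj₂ p
    <n : ∀ {j} → j < k → j < k + t
    <n j<k = ℕ.≤-trans j<k (ℕ.m≤m+n k t)
    upper : ∀ {j} → j < k → idx j (rowAt (k + t ∸ 1) a′) ≤ idx (suc j) (toList (b ∷ʳ M))
    upper {j} j<k with ℕ.m≤n⇒m<n∨m≡n j<k
    ... | inj₁ j+1<k = ℕ.≤-trans (weakSE (<n j<k) j+1<k) (ℕ.≤-reflexive (sym (idx-∷ʳ-< b M j+1<k)))
    -- The last entry of the upper row has no SE-neighbour in the array. Its own bound (m + 1) + k
    -- is M, the virtual entry that takes the neighbour's place.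
    ... | inj₂ refl = ℕ.≤-trans (IsRow.rowBounded R′ j<k) (ℕ.≤-reflexive (sym (idx-∷ʳ-≡ b M)))
    c∈ : c ∈ above (b ∷ʳ M)
    c∈ = ∈-above (b ∷ʳ M) c
      (λ {j} j<k → subst (λ p → idx j (toList (b ∷ʳ M)) ≤ idx j p) (sym c≡)
         (ℕ.≤-trans (ℕ.≤-reflexive (idx-∷ʳ-< b M j<k)) (weakNE (<n j<k) j<k)))
      (λ {j} j<k → subst (λ p → idx j p ≤ idx (suc j) (toList (b ∷ʳ M))) (sym c≡) (upper j<k))
      (λ {j} j<k → subst (λ p → idx j p < idx (suc j) p) (sym c≡) (IsRow.rowIncrease R′ j<k))

-- From the Laurent polynomial of the statement to weights.

module GogPolynomial where
  open import Relation.Binary.PropositionalEquality using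
    (_≢_; refl; sym; trans; cong; cong₂; subst; module ≡-Reasoning)
  open import Data.Integer using (ℤ; 0ℤ; 1ℤ; _+_; _*_; -_; _-_)
  import Data.Integer.Properties as ℤ
  open import Data.Integer.Solver using (module +-*-Solver)
  open import Defs
  import Data.Integer as ℤ
  import Data.Integer as ℤ
  open import Agda.Builtin.Int using (pos; negsuc)
  open import Data.Bool using (Bool; true; false; if_then_else_)
  import Data.List as L
  import Data.List.Properties as L
  open import Data.List.Membership.Propositional.Properties using (∈-allFin)
  import Data.List.Relation.Unary.Unique.Propositional.Properties as Unique
  import Data.List.Relation.Unary.AllPairs as AllPairs
  import Data.List.Relation.Unary.All as All
  open import Data.Vec using (_++_; map; replicate; zipWith; updateAt; _[_]≔_)
  open import Function using (_∘_; id)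
  open ConstantTerm
  open Interlacing

  module _ {c ℓ} (S : CommutativeRing c ℓ) where
    private
      module S = CommutativeRing S
      module A = PairProducts S
    product : List S.Carrier → S.Carrier
    product = L.foldr S._*_ S.1#

    product-++ : ∀ xs ys → product (xs L.++ ys) S.≈ product xs S.* product ys
    product-++ L.[] ys = S.sym (S.*-identityˡ _)
    product-++ (x L.∷ xs) ys = S.trans (S.*-congˡ (product-++ xs ys)) (S.sym (S.*-assoc _ _ _))

    product-tabulate : ∀ (f : Fin n → S.Carrier) → product (L.tabulate f) S.≈ A.prod (tabulate f)
    product-tabulate {zero} f = S.refl
    product-tabulate {suc n} f = S.*-congˡ (product-tabulate (f ∘ suc))

    orderedPairs : (S.Carrier → S.Carrier → S.Carrier) → (Fin n → S.Carrier) → List S.Carrier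
    orderedPairs {n} f g = L.concatMap (λ i → L.concatMap (λ j →
      if toℕ i <ᵇ toℕ j then L.[ f (g i) (g j) ] else L.[]) (L.allFin n)) (L.allFin n)

    -- Row 0 of the double loop keeps every later column, and column 0 fails the test in each row;
    -- what remains is the double loop on the shifted indices.
    orderedPairs-suc : ∀ f (g : Fin (suc n) → S.Carrier) →
      orderedPairs f g ≡ L.tabulate (λ j → f (g zero) (g (suc j))) L.++ orderedPairs f (g ∘ suc)
    orderedPairs-suc {n} f g = cong₂ L._++_
      (trans (concatMap-suc (λ j → if 0 <ᵇ toℕ j then L.[ f (g zero) (g j) ] else L.[]))
        (trans (trans (sym (L.concatMap-map L.[_] (λ j → f (g zero) (g (suc j))) (L.allFin n)))
                      (L.concatMap-pure (L.map (λ j → f (g zero) (g (suc j))) (L.allFin n))))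
               (L.map-tabulate id (λ j → f (g zero) (g (suc j))))))
      (trans (concatMap-suc (λ i → L.concatMap (λ j → if toℕ i <ᵇ toℕ j then L.[ f (g i) (g j) ] else L.[])
        (L.allFin (suc n))))
        (L.concatMap-cong (λ i → concatMap-suc (λ j → if toℕ (suc i) <ᵇ toℕ j then L.[ f (g (suc i)) (g j) ]
          else L.[])) (L.allFin n)))
      where
      concatMap-suc : ∀ (F : Fin (suc n) → List S.Carrier) →
        L.concatMap F (L.tabulate suc) ≡ L.concatMap (F ∘ suc) (L.allFin n)
      concatMap-suc F = trans (cong (L.concatMap F) (sym (L.map-tabulate id suc)))
        (L.concatMap-map F suc (L.allFin n))

    product-orderedPairs : ∀ f (g : Fin n → S.Carrier) → product (orderedPairs f g) S.≈
      A.pairProd f (tabulate g)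
    product-orderedPairs {zero} f g = S.refl
    product-orderedPairs {suc n} f g = S.trans (S.reflexive (cong product (orderedPairs-suc f g)))
      (S.trans (product-++ (L.tabulate (λ j → f (g zero) (g (suc j)))) (orderedPairs f (g ∘ suc)))
      (S.*-cong (S.trans (product-tabulate (λ j → f (g zero) (g (suc j))))
        (S.reflexive (cong A.prod (Vec.tabulate-∘ (f (g zero)) (g ∘ suc)))))
                (product-orderedPairs f (g ∘ suc))))

  ℤⁿ : ∀ n → IsCommutativeMonoid _≡_ (zipWith {n = n} _+_) (replicate n 0ℤ)
  ℤⁿ = Vec-isCommutativeMonoid ℤ.+-0-isCommutativeMonoid

  module Laurent {n : ℕ} = MonoidRing (ℤⁿ n)
  module LP {n : ℕ} = PairProducts (Laurent.monoidRing {n})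
  module LR {n : ℕ} = CommutativeRing (Laurent.monoidRing {n})

  map-pos-⊕ : ∀ {n} (e e′ : Vec ℕ n) → map pos (e ⊕ e′) ≡ zipWith _+_ (map pos e) (map pos e′)
  map-pos-⊕ [] [] = refl
  map-pos-⊕ (a ∷ e) (a′ ∷ e′) = cong₂ _∷_ (ℤ.pos-+ a a′) (map-pos-⊕ e e′)

  map-pos-zero : ∀ n → map pos (replicate n 0) ≡ replicate n 0ℤ
  map-pos-zero zero = refl
  map-pos-zero (suc n) = cong (0ℤ ∷_) (map-pos-zero n)

  module Embed {n : ℕ} = ExponentMap (ℕⁿ n) (ℤⁿ n) (map pos) map-pos-⊕ (map-pos-zero n)

  embed-vars : map Embed.mapExp (vars n) ≡ tabulate x
  embed-vars {n} = trans (sym (Vec.tabulate∘lookup _)) (Vec.tabulate-cong (λ i →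
    trans (Vec.lookup-map i Embed.mapExp (vars n))
      (trans (cong Embed.mapExp (lookup-vars i)) (cong (λ e → L.[ e , 1ℤ ]) (exponent i)))))
    where
    exponent : ∀ {n} (i : Fin n) → map pos (power i 1) ≡ replicate n 0ℤ [ i ]≔ 1ℤ
    exponent {suc n} zero = cong (1ℤ ∷_) (map-pos-zero n)
    exponent (suc i) = cong (0ℤ ∷_) (exponent i)

  -- This factor has no negative exponents. Once the other two factors are absorbed into the
  -- functional, only the values of the functional on ℕ-exponents matter.
  part3-embed : ∀ n → part3 n LR.≈ Embed.mapExp (Products.gogProd (vars n))
  part3-embed n = LR.trans (product-orderedPairs Laurent.monoidRing (λ p q → (p LR.- q) LR.* LP.gogFactor p q)
    x)
    (LR.trans (LR.reflexive (cong LP.gogProd (sym embed-vars))) (LR.sym (Embed.mapExp-gogProd (vars n))))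

  δ₀ : ℤ → ℤ
  δ₀ (pos zero) = 1ℤ
  δ₀ (pos (suc _)) = 0ℤ
  δ₀ (negsuc _) = 0ℤ

  -- The extension of `β` to integer depths and exponents. It is needed while factors of the Laurent
  -- polynomial are absorbed, because the functional must then be defined at every integer exponent.
  βℤ : ℕ → ℤ → ℤ → ℤ
  βℤ zero d e = δ₀ (e - d)
  βℤ (suc b) d e = βℤ b d e + βℤ b d (1ℤ + e)

  βℤ-shift : ∀ b d z e → βℤ b d (z + e) ≡ βℤ b (d - z) e
  βℤ-shift zero d z e = cong δ₀ (solve 3 (λ d z e → (z :+ e) :- d := e :- (d :- z)) refl d z e)
    where open +-*-Solver
  βℤ-shift (suc b) d z e = cong₂ _+_ (βℤ-shift b d z e)
    (trans (cong (βℤ b d) (solve 2 (λ z e → con 1ℤ :+ (z :+ e) := z :+ (con 1ℤ :+ e)) refl z e))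
      (βℤ-shift b d z (1ℤ + e)))
    where open +-*-Solver

  βℤ-pos : ∀ b d e → βℤ b (pos d) (pos e) ≡ β b d e
  βℤ-pos zero d e = trans (cong δ₀ (ℤ.m-n≡m⊖n e d)) (base d e)
    where
    base : ∀ d e → δ₀ (e ℤ.⊖ d) ≡ δ d e
    base zero zero = refl
    base zero (suc e) = refl
    base (suc d) zero = refl
    base (suc d) (suc e) = trans (cong δ₀ (ℤ.[1+m]⊖[1+n]≡m⊖n e d)) (base d e)
  βℤ-pos (suc b) d e = cong₂ _+_ (βℤ-pos b d e) (βℤ-pos b d (suc e))

  Weightℤ : Set
  Weightℤ = ℕ × ℤ

  Ω : Vec Weightℤ n → Vec ℤ n → ℤ
  Ω [] [] = 1ℤ
  Ω ((b , d) ∷ ws) (a ∷ e) = βℤ b d a * Ω ws e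

  Ω-pos : ∀ (ws : Vec Weight n) e → Ω (map (λ (b , d) → b , pos d) ws) (map pos e) ≡ ω ws e
  Ω-pos [] [] = refl
  Ω-pos ((b , d) ∷ ws) (a ∷ e) = cong₂ _*_ (βℤ-pos b d a) (Ω-pos ws e)

  -- The first weight stands for (1 + x)^b x^z, with z an exponent, and the second stores a depth;
  -- this explains the sign.
  multiply : Weightℤ → Weightℤ → Weightℤ
  multiply (b , z) (b₀ , d) = b ℕ.+ b₀ , d - z

  zero-+ : (e : Vec ℤ n) → zipWith _+_ (replicate n 0ℤ) e ≡ e
  zero-+ = IsCommutativeMonoid.identityˡ (ℤⁿ _)

  Ω-mono : ∀ (ws : Vec Weightℤ n) i z e →
    Ω ws (zipWith _+_ (replicate n 0ℤ [ i ]≔ z) e) ≡ Ω (updateAt ws i (multiply (0 , z))) e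
  Ω-mono ((b , d) ∷ ws) zero z (a ∷ e) = cong₂ _*_ (βℤ-shift b d z a) (cong (Ω ws) (zero-+ e))
  Ω-mono ((b , d) ∷ ws) (suc i) z (a ∷ e) = cong₂ _*_ (cong (βℤ b d) (ℤ.+-identityˡ a)) (Ω-mono ws i z e)

  Ω-onePlus : ∀ (ws : Vec Weightℤ n) i e →
    Ω ws e + Ω ws (zipWith _+_ (replicate n 0ℤ [ i ]≔ 1ℤ) e) ≡ Ω (updateAt ws i (multiply (1 , 0ℤ))) e
  Ω-onePlus ((b , d) ∷ ws) zero (a ∷ e) =
    trans (cong (λ e′ → βℤ b d a * Ω ws e + βℤ b d (1ℤ + a) * Ω ws e′) (zero-+ e))
    (trans (sym (ℤ.*-distribʳ-+ (Ω ws e) (βℤ b d a) (βℤ b d (1ℤ + a))))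
           (cong (λ d′ → (βℤ b d′ a + βℤ b d′ (1ℤ + a)) * Ω ws e) (sym (ℤ.+-identityʳ d))))
  Ω-onePlus {suc n} ((b , d) ∷ ws) (suc i) (a ∷ e) = trans
    (cong (λ a′ → βℤ b d a * Ω ws e + βℤ b d a′ * Ω ws (zipWith _+_ (replicate n 0ℤ [ i ]≔ 1ℤ) e))
      (ℤ.+-identityˡ a))
    (trans (sym (ℤ.*-distribˡ-+ (βℤ b d a) (Ω ws e) _)) (cong (βℤ b d a *_) (Ω-onePlus ws i e)))

  open Laurent using (Acts; acts-intro; Acts-mul; Acts-one; Acts-cong)

  ActsAt : LPoly n → (Vec Weightℤ n → Vec Weightℤ n) → Set
  ActsAt p f = ∀ ws → Acts p (Ω ws) (Ω (f ws))

  ActsAt-mono : ∀ (i : Fin n) z → ActsAt (mono i z) (λ ws → updateAt ws i (multiply (0 , z)))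
  ActsAt-mono i z ws = acts-intro λ e →
    trans (Laurent.pairing-[] (replicate _ 0ℤ [ i ]≔ z) (λ s → Ω ws (zipWith _+_ s e))) (Ω-mono ws i z e)

  ActsAt-onePlus : ∀ (i : Fin n) → ActsAt (onePlus i) (λ ws → updateAt ws i (multiply (1 , 0ℤ)))
  ActsAt-onePlus {n} i ws = acts-intro λ e →
    trans (Laurent.pairing-++ oneP (x i) (λ s → Ω ws (zipWith _+_ s e)))
    (trans (cong₂ _+_ (Laurent.acts (Acts-one {f = Ω ws}) e)
      (Laurent.pairing-[] (replicate n 0ℤ [ i ]≔ 1ℤ) (λ s → Ω ws (zipWith _+_ s e))))
           (Ω-onePlus ws i e))

  ActsAt-updateAt : ∀ {p : LPoly n} {i f g} → (∀ w → f w ≡ g w) → ActsAt p (λ ws → updateAt ws i f) →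
    ActsAt p (λ ws → updateAt ws i g)
  ActsAt-updateAt {p = p} {i} eq act ws = subst (λ ws′ → Acts p (Ω ws) (Ω ws′)) (Vec.updateAt-cong i eq ws)
    (act ws)

  ActsAt-⊗-updateAt : ∀ {p q : LPoly n} {i f g} → ActsAt p (λ ws → updateAt ws i f) →
    ActsAt q (λ ws → updateAt ws i g) →
    ActsAt (p ⊗ q) (λ ws → updateAt ws i (g ∘ f))
  ActsAt-⊗-updateAt {p = p} {q} {i} {f} act act′ ws = subst (λ ws′ → Acts (p ⊗ q) (Ω ws) (Ω ws′))
    (Vec.updateAt-updateAt i ws)
    (Acts-mul {p = p} {q = q} (act ws) (act′ (updateAt ws i f)))

  ActsAt-one : ∀ (i : Fin n) → ActsAt oneP (λ ws → updateAt ws i id)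
  ActsAt-one i ws = subst (λ ws′ → Acts oneP (Ω ws) (Ω ws′)) (sym (Vec.updateAt-id i ws)) Acts-one

  ActsAt-powP : ∀ (i : Fin n) b → ActsAt (powP (onePlus i) b) (λ ws → updateAt ws i (multiply (b , 0ℤ)))
  ActsAt-powP i zero = ActsAt-updateAt {p = oneP} (λ w → cong (proj₁ w ,_) (sym (ℤ.+-identityʳ (proj₂ w))))
    (ActsAt-one i)
  ActsAt-powP i (suc b) = ActsAt-updateAt {p = powP (onePlus i) (suc b)}
    (λ (b₀ , d) → cong₂ _,_ (ℕ.+-suc b b₀) (ℤ.+-identityʳ (d - 0ℤ)))
    (ActsAt-⊗-updateAt {p = onePlus i} {q = powP (onePlus i) b} (ActsAt-onePlus i) (ActsAt-powP i b))

  factor : Fin n → Weightℤ → LPoly n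
  factor i (b , z) = powP (onePlus i) b ⊗ mono i z

  ActsAt-factor : ∀ (i : Fin n) w → ActsAt (factor i w) (λ ws → updateAt ws i (multiply w))
  ActsAt-factor i (b , z) = ActsAt-updateAt {p = factor i (b , z)}
    (λ (b₀ , d) → cong (λ d → b ℕ.+ b₀ , d - z) (ℤ.+-identityʳ d))
    (ActsAt-⊗-updateAt {p = powP (onePlus i) b} {q = mono i z} (ActsAt-powP i b) (ActsAt-mono i z))

  prodP-++ : ∀ (ps qs : List (LPoly n)) → prodP (ps L.++ qs) LR.≈ prodP ps ⊗ prodP qs
  prodP-++ = product-++ Laurent.monoidRing

  updates : ∀ {J : Set} → (J → Fin n) → (J → Weightℤ → Weightℤ) → List J → Vec Weightℤ n → Vec Weightℤ n
  updates g f L.[] ws = ws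
  updates g f (j L.∷ js) ws = updates g f js (updateAt ws (g j) (f j))

  -- Each index yields a list of factors so that the conditional product `part2` fits: an index that
  -- fails its test yields the empty list, which acts as the identity.
  ActsAt-prodP : ∀ {J : Set} (g : J → Fin n) f (h : J → List (LPoly n)) →
    (∀ j → ActsAt (prodP (h j)) (λ ws → updateAt ws (g j) (f j))) →
    ∀ js → ActsAt (prodP (L.concatMap h js)) (updates g f js)
  ActsAt-prodP g f h act L.[] ws = Acts-one
  ActsAt-prodP g f h act (j L.∷ js) ws = Acts-cong (prodP-++ (h j) (L.concatMap h js))
    (Acts-mul {p = prodP (h j)} {q = prodP (L.concatMap h js)} (act j ws)
      (ActsAt-prodP g f h act js (updateAt ws (g j) (f j))))

  lookup-updates-∉ : ∀ {J : Set} (g : J → Fin n) f js ws {i} → (∀ {j} → j ∈ js → i ≢ g j) →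
    lookup (updates g f js ws) i ≡ lookup ws i
  lookup-updates-∉ g f L.[] ws i∉ = refl
  lookup-updates-∉ g f (j L.∷ js) ws {i} i∉ =
    trans (lookup-updates-∉ g f js (updateAt ws (g j) (f j)) (i∉ ∘ Any.there))
    (Vec.lookup∘updateAt′ i (g j) (i∉ (Any.here refl)) ws)

  lookup-updates-∈ : ∀ {J : Set} (g : J → Fin n) f → (∀ {j j′} → g j ≡ g j′ → j ≡ j′) → ∀ {js} → Unique js →
    ∀ ws {j} → j ∈ js →
    lookup (updates g f js ws) (g j) ≡ f j (lookup ws (g j))
  lookup-updates-∈ g f inj (j∉ AllPairs.∷ u) ws {j} (Any.here refl) = trans
    (lookup-updates-∉ g f _ (updateAt ws (g j) (f j)) (λ j′∈ eq → All.lookup j∉ j′∈ (inj eq)))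
    (Vec.lookup∘updateAt (g j) ws)
  lookup-updates-∈ g f inj {j₀ L.∷ js} (j∉ AllPairs.∷ u) ws {j} (Any.there j∈) = trans
    (lookup-updates-∈ g f inj u (updateAt ws (g j₀) (f j₀)) j∈)
    (cong (f j) (Vec.lookup∘updateAt′ (g j) (g j₀) (λ eq → All.lookup j∉ j∈ (sym (inj eq))) ws))

  Ω-zeros : ∀ n → Ω (replicate n (0 , 0ℤ)) (replicate n 0ℤ) ≡ 1ℤ
  Ω-zeros zero = refl
  Ω-zeros (suc n) = trans (ℤ.*-identityˡ _) (Ω-zeros n)

  Ω-zeros-≢ : ∀ (e : Vec ℤ n) → e ≢ replicate n 0ℤ → Ω (replicate n (0 , 0ℤ)) e ≡ 0ℤ
  Ω-zeros-≢ [] e≢ = ⊥-elim (e≢ refl)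
  Ω-zeros-≢ {suc n} (pos zero ∷ e) e≢ = trans (ℤ.*-identityˡ _) (Ω-zeros-≢ e (λ eq → e≢ (cong (0ℤ ∷_) eq)))
  Ω-zeros-≢ {suc n} (pos (suc a) ∷ e) e≢ = ℤ.*-zeroˡ (Ω (replicate n (0 , 0ℤ)) e)
  Ω-zeros-≢ {suc n} (negsuc a ∷ e) e≢ = ℤ.*-zeroˡ (Ω (replicate n (0 , 0ℤ)) e)

  -- With all weights (0, 0) the functional `Ω` is the indicator of the zero exponent vector. This
  -- is the state before any factor is absorbed.
  ct-pairing : ∀ (p : LPoly n) → ct p ≡ Laurent.pairing p (Ω (replicate n (0 , 0ℤ)))
  ct-pairing L.[] = refl
  ct-pairing {n} ((e , c) L.∷ p) with Vec.≡-dec ℤ._≟_ e (replicate n 0ℤ)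
  ... | yes refl = cong₂ _+_ (sym (trans (cong (c *_) (Ω-zeros n)) (ℤ.*-identityʳ c))) (ct-pairing p)
  ... | no e≢ = trans (ct-pairing p) (trans (sym (ℤ.+-identityˡ _))
    (cong (λ z → z + Laurent.pairing p (Ω (replicate n (0 , 0ℤ))))
      (sym (trans (cong (c *_) (Ω-zeros-≢ e e≢)) (ℤ.*-zeroʳ c)))))

  toℤ : Weight → Weightℤ
  toℤ (b , d) = b , pos d

  module _ (m k t : ℕ) (k≤n : k ≤ k ℕ.+ t) (b : Vec ℕ k) where
    private
      N = k ℕ.+ t
      factors₁ : Fin k → Weightℤ
      factors₁ j = lookup b j , pos 1 - pos N
      factors₂ : Fin N → Weightℤ
      factors₂ i = m ℕ.+ k ℕ.+ 1 , (- pos N + pos (suc (toℕ i))) - pos k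
      select : Bool → Weightℤ → Weightℤ → Weightℤ
      select c w = if c then multiply w else id
      update₁ : Vec Weightℤ N → Vec Weightℤ N
      update₁ = updates (λ j → inject≤ j k≤n) (λ j → multiply (factors₁ j)) (L.allFin k)
      update₂ : Vec Weightℤ N → Vec Weightℤ N
      update₂ = updates id (λ i → select (k <ᵇ suc (toℕ i)) (factors₂ i)) (L.allFin N)

    ActsAt-part1 : ActsAt (part1 N k k≤n b) update₁
    ActsAt-part1 = subst (λ ps → ActsAt (prodP ps) update₁)
      (trans (sym (L.concatMap-map L.[_] f (L.allFin k))) (L.concatMap-pure (L.map f (L.allFin k))))
      (ActsAt-prodP (λ j → inject≤ j k≤n) (λ j → multiply (factors₁ j)) (λ j → L.[ f j ]) single (L.allFin k))
      where
      f : Fin k → LPoly N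
      f j = factor (inject≤ j k≤n) (factors₁ j)
      single : ∀ j → ActsAt (prodP L.[ f j ]) (λ ws → updateAt ws (inject≤ j k≤n) (multiply (factors₁ j)))
      single j ws = Acts-mul {p = f j} {q = oneP} (ActsAt-factor (inject≤ j k≤n) (factors₁ j) ws) Acts-one

    ActsAt-part2 : ActsAt (part2 m N k) update₂
    ActsAt-part2 = ActsAt-prodP id (λ i → select (k <ᵇ suc (toℕ i)) (factors₂ i))
      (λ i → if k <ᵇ suc (toℕ i) then L.[ factor i (factors₂ i) ] else L.[])
      (λ i → optional i (k <ᵇ suc (toℕ i))) (L.allFin N)
      where
      optional : ∀ i c → ActsAt (prodP (if c then L.[ factor i (factors₂ i) ] else L.[]))
        (λ ws → updateAt ws i (select c (factors₂ i)))
      optional i true ws = Acts-mul {p = factor i (factors₂ i)} {q = oneP} (ActsAt-factor i (factors₂ i) ws)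
        Acts-one
      optional i false = ActsAt-one i

    private
      M : ℕ
      M = suc (m ℕ.+ k)
      target : Vec Weight N
      target = map (_, pred N) b ++ staircase M k t
      ws₁ ws₂ : Vec Weightℤ N
      ws₁ = update₁ (replicate N (0 , 0ℤ))
      ws₂ = update₂ ws₁

      ↑ˡ-inject≤ : ∀ j → j ↑ˡ t ≡ inject≤ j k≤n
      ↑ˡ-inject≤ j = Fin.toℕ-injective (trans (Fin.toℕ-↑ˡ j t) (sym (Fin.toℕ-inject≤ j k≤n)))

      lookup-ws₁ˡ : ∀ j → lookup ws₁ (j ↑ˡ t) ≡ toℤ (lookup b j , pred N)
      lookup-ws₁ˡ j = trans (cong (lookup ws₁) (↑ˡ-inject≤ j))
        (trans (lookup-updates-∈ (λ j → inject≤ j k≤n) (λ j → multiply (factors₁ j))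
          (Fin.inject≤-injective k≤n k≤n _ _)
                 (Unique.allFin⁺ k) (replicate N (0 , 0ℤ)) (∈-allFin j))
        (trans (cong (multiply (factors₁ j)) (Vec.lookup-replicate (inject≤ j k≤n) (0 , 0ℤ)))
               (cong₂ _,_ (ℕ.+-identityʳ (lookup b j)) (depth (inject≤ j k≤n)))))
        where
        depth : ∀ {n} → Fin n → 0ℤ - (pos 1 - pos n) ≡ pos (pred n)
        depth {suc n} _ = trans (solve 1 (λ n → con 0ℤ :- (con 1ℤ :- (con 1ℤ :+ n)) := n) refl (pos n)) refl
          where open +-*-Solver

      lookup-ws₁ʳ : ∀ j → lookup ws₁ (k ↑ʳ j) ≡ (0 , 0ℤ)
      lookup-ws₁ʳ j = trans (lookup-updates-∉ (λ j → inject≤ j k≤n) (λ j → multiply (factors₁ j)) (L.allFin k)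
        (replicate N (0 , 0ℤ)) differ)
        (Vec.lookup-replicate (k ↑ʳ j) (0 , 0ℤ))
        where
        differ : ∀ {j′} → j′ ∈ L.allFin k → k ↑ʳ j ≢ inject≤ j′ k≤n
        differ {j′} _ eq = ℕ.<⇒≱ (Fin.toℕ<n j′) (ℕ.≤-trans (ℕ.m≤m+n k (toℕ j))
          (ℕ.≤-reflexive (trans (sym (Fin.toℕ-↑ʳ k j)) (trans (cong toℕ eq) (Fin.toℕ-inject≤ j′ k≤n)))))

      lookup-ws₂ : ∀ i → lookup ws₂ i ≡ select (k <ᵇ suc (toℕ i)) (factors₂ i) (lookup ws₁ i)
      lookup-ws₂ i = lookup-updates-∈ id (λ i → select (k <ᵇ suc (toℕ i)) (factors₂ i)) id (Unique.allFin⁺ N)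
        ws₁ (∈-allFin i)

      <ᵇ-false : ∀ {a b} → b ≤ a → (a <ᵇ b) ≡ false
      <ᵇ-false {a} {zero} _ = refl
      <ᵇ-false {suc a} {suc b} (s≤s b≤a) = <ᵇ-false b≤a

      <ᵇ-true : ∀ {a b} → a < b → (a <ᵇ b) ≡ true
      <ᵇ-true {zero} (s≤s _) = refl
      <ᵇ-true {suc a} (s≤s a<b) = <ᵇ-true a<b

      lookup-staircase : ∀ M t (j : Fin t) → lookup (staircase M k t) j ≡ (M , (t ℕ.∸ suc (toℕ j)) ℕ.+ k)
      lookup-staircase M (suc t) zero = refl
      lookup-staircase M (suc t) (suc j) = lookup-staircase M t j

      -- The two products change complementary positions: `part1` the first k, `part2` the last t,
      -- where its test `k <ᵇ suc (toℕ i)` succeeds. Each position is therefore updated from (0, 0)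
      -- exactly once.
      lookup-target : ∀ i → lookup ws₂ i ≡ toℤ (lookup target i)
      lookup-target i with splitAt k i in eq
      ... | inj₁ j with Fin.splitAt⁻¹-↑ˡ eq
      ... | refl = trans (lookup-ws₂ (j ↑ˡ t)) (trans
        (cong (λ c → select c (factors₂ (j ↑ˡ t)) (lookup ws₁ (j ↑ˡ t)))
          (<ᵇ-false (subst (_< k) (sym (Fin.toℕ-↑ˡ j t)) (Fin.toℕ<n j))))
        (trans (lookup-ws₁ˡ j) (cong toℤ
          (sym (trans (Vec.lookup-++ˡ (map (_, pred N) b) (staircase M k t) j)
          (Vec.lookup-map j (_, pred N) b))))))
      lookup-target i | inj₂ j with Fin.splitAt⁻¹-↑ʳ eq
      ... | refl = trans (lookup-ws₂ (k ↑ʳ j)) (trans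
        (cong₂ (λ c → select c (factors₂ (k ↑ʳ j)))
          (<ᵇ-true (s≤s (subst (k ≤_) (sym (Fin.toℕ-↑ʳ k j)) (ℕ.m≤m+n k (toℕ j))))) (lookup-ws₁ʳ j))
        (trans (cong₂ _,_ (trans (ℕ.+-identityʳ _) (ℕ.+-comm (m ℕ.+ k) 1)) depth)
               (cong toℤ (sym (trans (Vec.lookup-++ʳ (map (_, pred N) b) (staircase M k t) j)
                 (lookup-staircase M t j))))))
        where
        r = t ℕ.∸ suc (toℕ j)
        -- Writing n = k + (s + 1) + r, with s the offset among the last t variables, removes the
        -- truncated subtraction; the depth n + k - i at i = k + s + 1 is then r + k.
        N≡ : pos N ≡ pos k + (pos (suc (toℕ j)) + pos r)
        N≡ = cong (λ t → pos (k ℕ.+ t)) (sym (ℕ.m+[n∸m]≡n (Fin.toℕ<n j)))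
        depth : 0ℤ - ((- pos N + pos (suc (toℕ (k ↑ʳ j)))) - pos k) ≡ pos (r ℕ.+ k)
        depth = trans (cong₂ (λ N i → 0ℤ - ((- N + i) - pos k)) N≡ (cong (pos ∘ suc) (Fin.toℕ-↑ʳ k j)))
          (solve 3 (λ k s r → con 0ℤ :- ((:- (k :+ ((con 1ℤ :+ s) :+ r)) :+ (con 1ℤ :+ (k :+ s))) :- k) := r
            :+ k) refl
             (pos k) (pos (toℕ j)) (pos r))
          where open +-*-Solver

    ct-gogPoly : ct (gogPoly m (k ℕ.+ t) k k≤n b) ≡ trapezoidCT t b (suc (m ℕ.+ k))
    ct-gogPoly = begin
      ct (gogPoly m N k k≤n b)
        ≡⟨ ct-pairing (gogPoly m N k k≤n b) ⟩
      Laurent.pairing (part1 N k k≤n b ⊗ (part2 m N k ⊗ part3 N)) (Ω (replicate N (0 , 0ℤ)))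
        ≡⟨ Laurent.Acts⇒pairing (ActsAt-part1 (replicate N (0 , 0ℤ))) (part2 m N k ⊗ part3 N) ⟩
      Laurent.pairing (part2 m N k ⊗ part3 N) (Ω ws₁)
        ≡⟨ Laurent.Acts⇒pairing (ActsAt-part2 ws₁) (part3 N) ⟩
      Laurent.pairing (part3 N) (Ω ws₂)
        ≡⟨ Laurent.pairing-≡ (part3-embed N) (Ω ws₂) ⟩
      Laurent.pairing (Embed.mapExp (Products.gogProd (vars N))) (Ω ws₂)
        ≡⟨ Embed.pairing-mapExp (Products.gogProd (vars N)) (Ω ws₂) ⟩
      Polynomial.pairing (Products.gogProd (vars N)) (λ e → Ω ws₂ (map pos e))
        ≡⟨ Polynomial.pairing-cong (Products.gogProd (vars N))
          (λ e → trans (cong (λ ws → Ω ws (map pos e)) ws₂≡) (Ω-pos target e)) ⟩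
      gogCT target ∎
      where
      open ≡-Reasoning
      ws₂≡ : ws₂ ≡ map toℤ target
      ws₂≡ = trans (sym (Vec.tabulate∘lookup ws₂)) (trans
        (Vec.tabulate-cong (λ i → trans (lookup-target i) (sym (Vec.lookup-map i toℤ target))))
          (Vec.tabulate∘lookup (map toℤ target)))

open import Defs
open import Data.Nat using (_+_)
open import Data.Vec using (_∷ʳ_; toList)
open import Function using (_∘_)
open import Relation.Binary.PropositionalEquality using (refl; sym; trans; cong; cong₂; subst)
import Data.List as L
open Interlacing
open Trapezoids
open GogPolynomial

-- The hypotheses of the theorem in inductive form, and its proof.

extensionality : ∀ (r : List ℕ) (b : Vec ℕ k) → length r ≡ k → (∀ j → idx (toℕ j) r ≡ lookup b j) →
  r ≡ toList b
extensionality L.[] [] _ _ = refl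
extensionality (y L.∷ r) (v ∷ b) len eq =
  cong₂ L._∷_ (eq zero) (extensionality r b (ℕ.suc-injective len) (eq ∘ suc))

idx-lookup : ∀ (b : Vec ℕ k) j → idx (toℕ j) (toList b) ≡ lookup b j
idx-lookup (_ ∷ b) zero = refl
idx-lookup (_ ∷ b) (suc j) = idx-lookup b j

StrictlyIncreasing⇒Increasing : ∀ {u M} (b : Vec ℕ k) → (∀ i j → toℕ i < toℕ j → lookup b i < lookup b j) →
  (∀ i → u ≤ lookup b i) → (∀ i → suc (toℕ i) ≡ k → lookup b i < M) → u ≤ M → Increasing u (b ∷ʳ M)
StrictlyIncreasing⇒Increasing [] strict lower upper u≤M = u≤M , _
StrictlyIncreasing⇒Increasing (v ∷ []) strict lower upper u≤M = lower zero , upper zero refl , _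
StrictlyIncreasing⇒Increasing (v ∷ b@(_ ∷ _)) strict lower upper u≤M = lower zero ,
  StrictlyIncreasing⇒Increasing b (λ i j i<j → strict (suc i) (suc j) (s≤s i<j))
    (λ i → strict zero (suc i) (s≤s z≤n))
    (λ i eq → upper (suc i) (cong suc eq))
    -- The bound v < M needed for the tail passes through the last entry `fromℕ _`, the one that
    -- `upper` compares with M.
    (ℕ.≤-trans (strict zero (suc (fromℕ _)) (s≤s z≤n))
      (ℕ.<⇒≤ (upper (suc (fromℕ _)) (cong (λ n → suc (suc n)) (Fin.toℕ-fromℕ _)))))

theorem3p1 : (m n k : ℕ) (k≤n : k ≤ n) →
    ((b : Vec ℕ k) →
    (∀ (i j : Fin k) → toℕ i < toℕ j → lookup b i < lookup b j) →
    (∀ (i : Fin k) → 1 ≤ lookup b i) →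
    (∀ (i : Fin k) → suc (toℕ i) ≡ k → lookup b i ≤ m + k) →
    NumberOf (λ a → IsGog m n k a × HasBottom n k b a) (ct (gogPoly m n k k≤n b)))
    × NumberOf (IsGog 0 n k) (ct (gogPoly 0 n k k≤n (tabulate (λ i → suc (toℕ i)))))
theorem3p1 m n k k≤n with ℕ.m≤n⇒∃[o]m+o≡n k≤n
... | t , refl = number m , counted
  where
  number : ∀ m (b : Vec ℕ k) → (∀ (i j : Fin k) → toℕ i < toℕ j → lookup b i < lookup b j) →
    (∀ (i : Fin k) → 1 ≤ lookup b i) → (∀ (i : Fin k) → suc (toℕ i) ≡ k → lookup b i ≤ m + k) →
    NumberOf (λ a → IsGog m (k + t) k a × HasBottom (k + t) k b a) (ct (gogPoly m (k + t) k k≤n b))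
  number m b strict positive bounded = trapezoids t b M , trapezoids-unique t b M , sound , complete ,
    trans (length-trapezoids t b M (Increasing-≤ (b ∷ʳ M) z≤n inc)) (sym (ct-gogPoly m k t k≤n b))
    where
    M : ℕ
    M = suc (m + k)
    inc : Increasing 1 (b ∷ʳ M)
    inc = StrictlyIncreasing⇒Increasing b strict positive (λ i eq → s≤s (bounded i eq)) (s≤s z≤n)
    sound : ∀ a → a ∈ trapezoids t b M → IsGog m (k + t) k a × HasBottom (k + t) k b a
    sound a a∈ = fromIsGog₀ (trapezoids-sound t m (k + t) M b refl refl inc a∈) ,
      λ j → trans (cong (idx (toℕ j)) (proj₂ (trapezoids-shape t b M a∈))) (idx-lookup b j)
    complete : ∀ a → IsGog m (k + t) k a × HasBottom (k + t) k b a → a ∈ trapezoids t b M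
    complete a (gog , bottom) = trapezoids-complete t m (k + t) M b refl refl inc (toIsGog₀ gog)
      (extensionality _ b (IsRow.rowLength (IsGog₀⇒IsRow k≤n (toIsGog₀ gog))) bottom)

  least : Vec ℕ k
  least = tabulate (λ i → suc (toℕ i))

  lookup-least : ∀ i → lookup least i ≡ suc (toℕ i)
  lookup-least = Vec.lookup∘tabulate (λ i → suc (toℕ i))

  -- Row n is strictly increasing with j-th entry at most j, so it is (1, …, k).
  bottom-least : ∀ a → IsGog 0 (k + t) k a → HasBottom (k + t) k least a
  bottom-least a gog j = trans (ℕ.≤-antisym (rowBounded (Fin.toℕ<n j)) (lower (Fin.toℕ<n j)))
    (sym (lookup-least j))
    where
    open IsRow (IsGog₀⇒IsRow k≤n (toIsGog₀ gog))
    lower : ∀ {j} → j < k → suc j ≤ idx j (rowAt (k + t ∸ 1) a)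
    lower {zero} j<k = rowPositive j<k
    lower {suc j} j<k = ℕ.≤-trans (s≤s (lower (ℕ.<⇒≤ j<k))) (rowIncrease j<k)

  counted : NumberOf (IsGog 0 (k + t) k) (ct (gogPoly 0 (k + t) k k≤n least))
  counted with number 0 least
    (λ i j i<j → subst (λ z → z < lookup least j) (sym (lookup-least i))
      (subst (suc (toℕ i) <_) (sym (lookup-least j)) (s≤s i<j)))
    (λ i → subst (1 ≤_) (sym (lookup-least i)) (s≤s z≤n))
    (λ i eq → ℕ.≤-reflexive (trans (lookup-least i) eq))
  ... | as , unique , sound , complete , len =
    as , unique , (λ a a∈ → proj₁ (sound a a∈)) , (λ a gog → complete a (gog , bottom-least a gog)) , len
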